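{- Let $\Sigma$ be a set of generators. There is an isomorphism $\mathbf T_\Sigma\cong\mathsf{PMCsp}_D(\mathbf{Hyp}_\Sigma)$ between the traced PROP freely generated over $\Sigma$ and the PROP of partial monogamous cospans of $\Sigma$-labelled hypergraphs.
   Context: A PROP is a strict symmetric monoidal category with objects $\mathbb N$ and addition as tensor on objects. A set of generators $\Sigma$ is a set equipped with functions $\mathrm{dom},\mathrm{cod}\colon\Sigma\to\mathbb N$. $\mathbf T_\Sigma$ is the (symmetric) traced PROP freely generated over $\Sigma$. Let $\mathbf X$ be the category with object set $(\mathbb N\times\mathbb N)+\{\star\}$ and (non-identity) morphisms $\mathsf s_i\colon(k,l)\to\star$ for each $i<k$ and $\mathsf t_j\colon(k,l)\to\star$ for each $j<l$. The category of hypergraphs $\mathbf{Hyp}$ is the functor category $[\mathbf X,\mathbf{Set}]$; for a hypergraph $F$, $F_\star$ is its set of vertices and $F_{k,l}$ its set of hyperedges with $k$ (ordered) sources and $l$ (ordered) targets. The hypergraph signature $[\![\Sigma]\!]$ is the hypergraph with a single vertex and, for each $g\in\Sigma$, one hyperedge $e_g$ with $\mathrm{dom}(g)$ sources and $\mathrm{cod}(g)$ targets. The category of $\Sigma$-labelled hypergraphs $\mathbf{Hyp}_\Sigma$ is the slice category of $\mathbf{Hyp}$ over $[\![\Sigma]\!]$. Write $n$ also for the discrete hypergraph (no hyperedges) with vertices $0,\dots,n-1$. $\mathsf{Csp}_D(\mathbf{Hyp}_\Sigma)$ is the PROP whose morphisms $m\to n$ are isomorphism classes of cospans $m\to F\leftarrow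 n$ in $\mathbf{Hyp}_\Sigma$, with composition by pushout and tensor by coproduct. The degree of a vertex $v$ of a hypergraph is the tuple $(i,o)$ where $i$ is the number of hyperedges with $v$ as a target, and $o$ is the number of hyperedges with $v$ as a source. For a cospan $m\xrightarrow{f}F\xleftarrow{g}n$, let $\mathrm{in}(F)$ and $\mathrm{out}(F)$ be the images of $f$ and $g$ respectively. The cospan is partial monogamous if $f$ and $g$ are mono and, for every vertex $v$, the degree of $v$ is: $(0,0)$ if $v\in\mathrm{in}(F)$ and $v\in\mathrm{out}(F)$; $(0,1)$ if $v\in\mathrm{in}(F)$ (only); $(1,0)$ if $v\in\mathrm{out}(F)$ (only); and $(0,0)$ or $(1,1)$ otherwise. $\mathsf{PMCsp}_D(\mathbf{Hyp}_\Sigma)$ is the sub-PROP of $\mathsf{Csp}_D(\mathbf{Hyp}_\Sigma)$ containing only the partial monogamous cospans of hypergraphs.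
   Formalization: Cospans are taken with finite hypergraphs F (finitely many vertices and hyperedges), as infinite discrete cospans 0→F←0 refute the literal claim; the degree of a vertex counts hyperedges with multiplicity, once per source or target position. -}

module Defs where

open import Data.Nat using (ℕ; zero; suc; _+_)
open import Data.Nat.Properties using (+-assoc; +-identityʳ)
open import Data.Fin using (Fin; zero; suc; splitAt; _↑ˡ_; _↑ʳ_)
import Data.Fin as Fin
open import Data.Fin.Properties using (+↔⊎; splitAt-↑ˡ; splitAt-↑ʳ; join-splitAt; cast-is-id; toℕ-cast; toℕ-↑ˡ; toℕ-↑ʳ; toℕ-injective; any?)
import Data.Fin.Properties as Finₚ
open import Data.Empty using (⊥; ⊥-elim)
open import Data.Unit using (⊤; tt)
open import Data.Product using (Σ; Σ-syntax; ∃; _×_; _,_; proj₁; proj₂)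
open import Data.Sum using (_⊎_; inj₁; inj₂; [_,_]′; swap; assocʳ; assocˡ)
import Data.Sum as Sum
import Data.Sum.Properties as Sumₚ
open import Data.Sum.Function.Propositional using (_⊎-↔_)
open import Data.Irrelevant using ([_])
open import Data.Refinement.Base using (Refinement; _,_; value)
open import Data.Refinement.Properties using (value-injective)
open import Function using (_∘_; _↔_; mk↔ₛ′; Inverse)
open import Function.Properties.Inverse using (↔⇒↣)
open import Function.Construct.Composition using (_↔-∘_)
open import Function.Construct.Symmetry using (↔-sym)
open import Level using (Level; _⊔_) renaming (zero to 0ℓ; suc to lsuc)
open import Relation.Binary.Core using (Rel)
open import Relation.Binary.Definitions using (DecidableEquality)
open import Relation.Binary.Structures using (IsEquivalence)
open import Relation.Binary.Construct.Closure.Equivalence using (EqClosure; return)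
import Relation.Binary.Construct.Closure.Equivalence as Eq*
open import Relation.Binary.PropositionalEquality using (_≡_; refl; sym; trans; cong; subst; subst₂)
import Relation.Binary.PropositionalEquality as ≡
open import Relation.Binary.PropositionalEquality.WithK using (≡-irrelevant)
import Relation.Nullary
open import Relation.Nullary using (¬_; Dec; yes; no)
open import Relation.Nullary.Decidable using (recompute)
import Relation.Nullary.Decidable as Dec

-- Homs are setoids, so that quotients (of terms by equations, of cospans by
-- isomorphism) are expressed by the choice of _≈_.  The tensor is strictly
-- associative and unital; these laws live over equations between natural
-- numbers, along which `cast` transports.  Composition is diagrammatic.

record PROP (a ℓ : Level) : Set (lsuc (a ⊔ ℓ)) where
  infix  4 _≈_
  infixl 6 _⨾_
  infixl 7 _⊗_
  field
    Hom : ℕ → ℕ → Set a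
    _≈_ : ∀ {m n} → Rel (Hom m n) ℓ
    id  : ∀ m → Hom m m
    _⨾_ : ∀ {m n p} → Hom m n → Hom n p → Hom m p
    _⊗_ : ∀ {m n p q} → Hom m n → Hom p q → Hom (m + p) (n + q)
    σ   : ∀ m n → Hom (m + n) (n + m)

  cast : ∀ {m m′ n n′} → m ≡ m′ → n ≡ n′ → Hom m n → Hom m′ n′
  cast = subst₂ Hom

  field
    isEquivalence : ∀ {m n} → IsEquivalence (_≈_ {m} {n})

    ⨾-cong      : ∀ {m n p} {f f′ : Hom m n} {g g′ : Hom n p} →
                  f ≈ f′ → g ≈ g′ → f ⨾ g ≈ f′ ⨾ g′
    ⨾-identityˡ : ∀ {m n} (f : Hom m n) → id m ⨾ f ≈ f
    ⨾-identityʳ : ∀ {m n} (f : Hom m n) → f ⨾ id n ≈ f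
    ⨾-assoc     : ∀ {m n p q} (f : Hom m n) (g : Hom n p) (h : Hom p q) →
                  (f ⨾ g) ⨾ h ≈ f ⨾ (g ⨾ h)

    ⊗-cong      : ∀ {m n p q} {f f′ : Hom m n} {g g′ : Hom p q} →
                  f ≈ f′ → g ≈ g′ → f ⊗ g ≈ f′ ⊗ g′
    ⊗-id        : ∀ m n → id m ⊗ id n ≈ id (m + n)
    ⊗-⨾         : ∀ {m n p m′ n′ p′} (f : Hom m n) (g : Hom n p)
                  (h : Hom m′ n′) (k : Hom n′ p′) →
                  (f ⨾ g) ⊗ (h ⨾ k) ≈ (f ⊗ h) ⨾ (g ⊗ k)
    ⊗-identityˡ : ∀ {m n} (f : Hom m n) → id 0 ⊗ f ≈ f
    ⊗-identityʳ : ∀ {m n} (f : Hom m n) →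
                  cast (+-identityʳ m) (+-identityʳ n) (f ⊗ id 0) ≈ f
    ⊗-assoc     : ∀ {m n p q r s} (f : Hom m n) (g : Hom p q) (h : Hom r s) →
                  cast (+-assoc m p r) (+-assoc n q s) ((f ⊗ g) ⊗ h) ≈ f ⊗ (g ⊗ h)

    σ-natural   : ∀ {m n p q} (f : Hom m n) (g : Hom p q) →
                  (f ⊗ g) ⨾ σ n q ≈ σ m p ⨾ (g ⊗ f)
    σ-involutive : ∀ m n → σ m n ⨾ σ n m ≈ id (m + n)
    σ-hexagon   : ∀ m n p →
                  cast (+-assoc m n p) (sym (+-assoc n p m))
                    ((σ m n ⊗ id p) ⨾ cast (sym (+-assoc n m p)) refl (id n ⊗ σ m p))
                  ≈ σ m (n + p)

record PROPMorphism {a ℓ b r} (P : PROP a ℓ) (Q : PROP b r) : Set (a ⊔ ℓ ⊔ b ⊔ r) where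
  private
    module P = PROP P
    module Q = PROP Q
  field
    ⟪_⟫    : ∀ {m n} → P.Hom m n → Q.Hom m n
    ⟪⟫-cong : ∀ {m n} {f g : P.Hom m n} → f P.≈ g → ⟪ f ⟫ Q.≈ ⟪ g ⟫
    ⟪⟫-id   : ∀ m → ⟪ P.id m ⟫ Q.≈ Q.id m
    ⟪⟫-⨾    : ∀ {m n p} (f : P.Hom m n) (g : P.Hom n p) → ⟪ f P.⨾ g ⟫ Q.≈ ⟪ f ⟫ Q.⨾ ⟪ g ⟫
    ⟪⟫-⊗    : ∀ {m n p q} (f : P.Hom m n) (g : P.Hom p q) → ⟪ f P.⊗ g ⟫ Q.≈ ⟪ f ⟫ Q.⊗ ⟪ g ⟫
    ⟪⟫-σ    : ∀ m n → ⟪ P.σ m n ⟫ Q.≈ Q.σ m n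

infix 4 _≅_
record _≅_ {a ℓ b r} (P : PROP a ℓ) (Q : PROP b r) : Set (a ⊔ ℓ ⊔ b ⊔ r) where
  private
    module P = PROP P
    module Q = PROP Q
  field
    to   : PROPMorphism P Q
    from : PROPMorphism Q P
  open PROPMorphism
  field
    from-to : ∀ {m n} (f : P.Hom m n) → ⟪ from ⟫ (⟪ to ⟫ f) P.≈ f
    to-from : ∀ {m n} (f : Q.Hom m n) → ⟪ to ⟫ (⟪ from ⟫ f) Q.≈ f

record SubPROP {a ℓ} (P : PROP a ℓ) (b : Level) : Set (a ⊔ lsuc b) where
  open PROP P
  field
    _∈Sub    : ∀ {m n} → Hom m n → Set b
    id-closed : ∀ m → id m ∈Sub
    ⨾-closed  : ∀ {m n p} {f : Hom m n} {g : Hom n p} → f ∈Sub → g ∈Sub → (f ⨾ g) ∈Sub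
    ⊗-closed  : ∀ {m n p q} {f : Hom m n} {g : Hom p q} → f ∈Sub → g ∈Sub → (f ⊗ g) ∈Sub
    σ-closed  : ∀ m n → σ m n ∈Sub

  private
    ≈-reflexive : ∀ {m n} {f g : Hom m n} → f ≡ g → f ≈ g
    ≈-reflexive = IsEquivalence.reflexive isEquivalence

    ≈-trans : ∀ {m n} {f g h : Hom m n} → f ≈ g → g ≈ h → f ≈ h
    ≈-trans = IsEquivalence.trans isEquivalence

    SubHom : ℕ → ℕ → Set (a ⊔ b)
    SubHom m n = Σ (Hom m n) _∈Sub

    proj-cast : ∀ {m m′ n n′} (p : m ≡ m′) (q : n ≡ n′) (f : SubHom m n) →
                proj₁ (subst₂ SubHom p q f) ≡ cast p q (proj₁ f)
    proj-cast refl refl f = refl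

  prop : PROP (a ⊔ b) ℓ
  prop = record
    { Hom = SubHom
    ; _≈_ = λ f g → proj₁ f ≈ proj₁ g
    ; id  = λ m → id m , id-closed m
    ; _⨾_ = λ f g → proj₁ f ⨾ proj₁ g , ⨾-closed (proj₂ f) (proj₂ g)
    ; _⊗_ = λ f g → proj₁ f ⊗ proj₁ g , ⊗-closed (proj₂ f) (proj₂ g)
    ; σ   = λ m n → σ m n , σ-closed m n
    ; isEquivalence = record
        { refl  = IsEquivalence.refl isEquivalence
        ; sym   = IsEquivalence.sym isEquivalence
        ; trans = IsEquivalence.trans isEquivalence }
    ; ⨾-cong      = ⨾-cong
    ; ⨾-identityˡ = λ f → ⨾-identityˡ (proj₁ f)
    ; ⨾-identityʳ = λ f → ⨾-identityʳ (proj₁ f)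
    ; ⨾-assoc     = λ f g h → ⨾-assoc (proj₁ f) (proj₁ g) (proj₁ h)
    ; ⊗-cong      = ⊗-cong
    ; ⊗-id        = ⊗-id
    ; ⊗-⨾         = λ f g h k → ⊗-⨾ (proj₁ f) (proj₁ g) (proj₁ h) (proj₁ k)
    ; ⊗-identityˡ = λ f → ⊗-identityˡ (proj₁ f)
    ; ⊗-identityʳ = λ {m} {n} f → ≈-trans
        (≈-reflexive (proj-cast (+-identityʳ m) (+-identityʳ n) _)) (⊗-identityʳ (proj₁ f))
    ; ⊗-assoc     = λ {m} {n} {p} {q} {r} {s} f g h → ≈-trans
        (≈-reflexive (proj-cast (+-assoc m p r) (+-assoc n q s) _))
        (⊗-assoc (proj₁ f) (proj₁ g) (proj₁ h))
    ; σ-natural   = λ f g → σ-natural (proj₁ f) (proj₁ g)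
    ; σ-involutive = σ-involutive
    ; σ-hexagon   = λ m n p → ≈-trans
        (≈-reflexive (trans (proj-cast (+-assoc m n p) (sym (+-assoc n p m)) _)
          (cong (λ h → cast (+-assoc m n p) (sym (+-assoc n p m)) ((σ m n ⊗ id p) ⨾ h))
            (proj-cast (sym (+-assoc n m p)) refl _))))
        (σ-hexagon m n p)
    }

-- The Joyal–Street–Verity axioms, in the strict symmetric case, for the trace
-- that closes the first x wires.

record TracedPROP (a ℓ : Level) : Set (lsuc (a ⊔ ℓ)) where
  field
    prop : PROP a ℓ
  open PROP prop public
  field
    Tr : ∀ x {m n} → Hom (x + m) (x + n) → Hom m n
    Tr-cong     : ∀ x {m n} {f g : Hom (x + m) (x + n)} → f ≈ g → Tr x f ≈ Tr x g
    tightening  : ∀ x {m n p q} (h : Hom m n) (f : Hom (x + n) (x + p)) (k : Hom p q) →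
                  Tr x ((id x ⊗ h) ⨾ f ⨾ (id x ⊗ k)) ≈ h ⨾ Tr x f ⨾ k
    sliding     : ∀ x y {m n} (f : Hom (x + m) (y + n)) (g : Hom y x) →
                  Tr x (f ⨾ (g ⊗ id n)) ≈ Tr y ((g ⊗ id m) ⨾ f)
    vanishing₀  : ∀ {m n} (f : Hom m n) → Tr 0 f ≈ f
    vanishing₊  : ∀ x y {m n} (f : Hom ((x + y) + m) ((x + y) + n)) →
                  Tr (x + y) f ≈ Tr y (Tr x (cast (+-assoc x y m) (+-assoc x y n) f))
    superposing : ∀ x {m n p q} (f : Hom (x + m) (x + n)) (g : Hom p q) →
                  Tr x (cast (+-assoc x m p) (+-assoc x n q) (f ⊗ g)) ≈ Tr x f ⊗ g
    yanking     : ∀ x → Tr x (σ x x) ≈ id x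

record TracedPROPMorphism {a ℓ b r} (P : TracedPROP a ℓ) (Q : TracedPROP b r) :
    Set (a ⊔ ℓ ⊔ b ⊔ r) where
  private
    module P = TracedPROP P
    module Q = TracedPROP Q
  field
    morphism : PROPMorphism P.prop Q.prop
  open PROPMorphism morphism public
  field
    ⟪⟫-Tr : ∀ x {m n} (f : P.Hom (x + m) (x + n)) → ⟪ P.Tr x f ⟫ Q.≈ Q.Tr x ⟪ f ⟫

record Generators : Set₁ where
  field
    Carrier : Set
    dom cod : Carrier → ℕ

module Free (𝓢 : Generators) where
  open Generators 𝓢

  infixl 6 _⨾_
  infixl 7 _⊗_
  data Term : ℕ → ℕ → Set where
    gen : ∀ g → Term (dom g) (cod g)
    id  : ∀ m → Term m m
    _⨾_ : ∀ {m n p} → Term m n → Term n p → Term m p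
    _⊗_ : ∀ {m n p q} → Term m n → Term p q → Term (m + p) (n + q)
    σ   : ∀ m n → Term (m + n) (n + m)
    Tr  : ∀ x {m n} → Term (x + m) (x + n) → Term m n

  cast : ∀ {m m′ n n′} → m ≡ m′ → n ≡ n′ → Term m n → Term m′ n′
  cast = subst₂ Term

  infix 4 _≈_
  data _≈_ : ∀ {m n} → Rel (Term m n) 0ℓ where
    ≈-refl  : ∀ {m n} {f : Term m n} → f ≈ f
    ≈-sym   : ∀ {m n} {f g : Term m n} → f ≈ g → g ≈ f
    ≈-trans : ∀ {m n} {f g h : Term m n} → f ≈ g → g ≈ h → f ≈ h

    ⨾-cong      : ∀ {m n p} {f f′ : Term m n} {g g′ : Term n p} →
                  f ≈ f′ → g ≈ g′ → f ⨾ g ≈ f′ ⨾ g′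
    ⨾-identityˡ : ∀ {m n} (f : Term m n) → id m ⨾ f ≈ f
    ⨾-identityʳ : ∀ {m n} (f : Term m n) → f ⨾ id n ≈ f
    ⨾-assoc     : ∀ {m n p q} (f : Term m n) (g : Term n p) (h : Term p q) →
                  (f ⨾ g) ⨾ h ≈ f ⨾ (g ⨾ h)

    ⊗-cong      : ∀ {m n p q} {f f′ : Term m n} {g g′ : Term p q} →
                  f ≈ f′ → g ≈ g′ → f ⊗ g ≈ f′ ⊗ g′
    ⊗-id        : ∀ m n → id m ⊗ id n ≈ id (m + n)
    ⊗-⨾         : ∀ {m n p m′ n′ p′} (f : Term m n) (g : Term n p)
                  (h : Term m′ n′) (k : Term n′ p′) →
                  (f ⨾ g) ⊗ (h ⨾ k) ≈ (f ⊗ h) ⨾ (g ⊗ k)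
    ⊗-identityˡ : ∀ {m n} (f : Term m n) → id 0 ⊗ f ≈ f
    ⊗-identityʳ : ∀ {m n} (f : Term m n) →
                  cast (+-identityʳ m) (+-identityʳ n) (f ⊗ id 0) ≈ f
    ⊗-assoc     : ∀ {m n p q r s} (f : Term m n) (g : Term p q) (h : Term r s) →
                  cast (+-assoc m p r) (+-assoc n q s) ((f ⊗ g) ⊗ h) ≈ f ⊗ (g ⊗ h)

    σ-natural   : ∀ {m n p q} (f : Term m n) (g : Term p q) →
                  (f ⊗ g) ⨾ σ n q ≈ σ m p ⨾ (g ⊗ f)
    σ-involutive : ∀ m n → σ m n ⨾ σ n m ≈ id (m + n)
    σ-hexagon   : ∀ m n p →
                  cast (+-assoc m n p) (sym (+-assoc n p m))
                    ((σ m n ⊗ id p) ⨾ cast (sym (+-assoc n m p)) refl (id n ⊗ σ m p))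
                  ≈ σ m (n + p)

    Tr-cong     : ∀ x {m n} {f g : Term (x + m) (x + n)} → f ≈ g → Tr x f ≈ Tr x g
    tightening  : ∀ x {m n p q} (h : Term m n) (f : Term (x + n) (x + p)) (k : Term p q) →
                  Tr x ((id x ⊗ h) ⨾ f ⨾ (id x ⊗ k)) ≈ h ⨾ Tr x f ⨾ k
    sliding     : ∀ x y {m n} (f : Term (x + m) (y + n)) (g : Term y x) →
                  Tr x (f ⨾ (g ⊗ id n)) ≈ Tr y ((g ⊗ id m) ⨾ f)
    vanishing₀  : ∀ {m n} (f : Term m n) → Tr 0 f ≈ f
    vanishing₊  : ∀ x y {m n} (f : Term ((x + y) + m) ((x + y) + n)) →
                  Tr (x + y) f ≈ Tr y (Tr x (cast (+-assoc x y m) (+-assoc x y n) f))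
    superposing : ∀ x {m n p q} (f : Term (x + m) (x + n)) (g : Term p q) →
                  Tr x (cast (+-assoc x m p) (+-assoc x n q) (f ⊗ g)) ≈ Tr x f ⊗ g
    yanking     : ∀ x → Tr x (σ x x) ≈ id x

𝐓 : Generators → TracedPROP 0ℓ 0ℓ
𝐓 𝓢 = record
  { prop = record
      { Hom = Term ; _≈_ = _≈_ ; id = id ; _⨾_ = _⨾_ ; _⊗_ = _⊗_ ; σ = σ
      ; isEquivalence = record { refl = ≈-refl ; sym = ≈-sym ; trans = ≈-trans }
      ; ⨾-cong = ⨾-cong ; ⨾-identityˡ = ⨾-identityˡ ; ⨾-identityʳ = ⨾-identityʳ
      ; ⨾-assoc = ⨾-assoc
      ; ⊗-cong = ⊗-cong ; ⊗-id = ⊗-id ; ⊗-⨾ = ⊗-⨾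
      ; ⊗-identityˡ = ⊗-identityˡ ; ⊗-identityʳ = ⊗-identityʳ ; ⊗-assoc = ⊗-assoc
      ; σ-natural = σ-natural ; σ-involutive = σ-involutive ; σ-hexagon = σ-hexagon }
  ; Tr = Tr ; Tr-cong = Tr-cong ; tightening = tightening ; sliding = sliding
  ; vanishing₀ = vanishing₀ ; vanishing₊ = vanishing₊
  ; superposing = superposing ; yanking = yanking }
  where open Free 𝓢

-- The universal property of 𝐓 𝓢 among traced PROPs.
module Freeness (𝓢 : Generators) {a ℓ} (P : TracedPROP a ℓ) where
  open Generators 𝓢
  private
    module T = Free 𝓢
    module P = TracedPROP P
    module P-eq {m n} = IsEquivalence (P.isEquivalence {m} {n})

  module _ (φ : ∀ g → P.Hom (dom g) (cod g)) where
    fold : ∀ {m n} → T.Term m n → P.Hom m n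
    fold (T.gen g)   = φ g
    fold (T.id m)    = P.id m
    fold (f T.⨾ g)   = fold f P.⨾ fold g
    fold (f T.⊗ g)   = fold f P.⊗ fold g
    fold (T.σ m n)   = P.σ m n
    fold (T.Tr x f)  = P.Tr x (fold f)

    private
      fold-cast : ∀ {m m′ n n′} (p : m ≡ m′) (q : n ≡ n′) (f : T.Term m n) →
                  fold (T.cast p q f) ≡ P.cast p q (fold f)
      fold-cast refl refl f = refl

    fold-cong : ∀ {m n} {f g : T.Term m n} → f T.≈ g → fold f P.≈ fold g
    fold-cong T.≈-refl = P-eq.refl
    fold-cong (T.≈-sym p) = P-eq.sym (fold-cong p)
    fold-cong (T.≈-trans p q) = P-eq.trans (fold-cong p) (fold-cong q)
    fold-cong (T.⨾-cong p q) = P.⨾-cong (fold-cong p) (fold-cong q)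
    fold-cong (T.⨾-identityˡ f) = P.⨾-identityˡ _
    fold-cong (T.⨾-identityʳ f) = P.⨾-identityʳ _
    fold-cong (T.⨾-assoc f g h) = P.⨾-assoc _ _ _
    fold-cong (T.⊗-cong p q) = P.⊗-cong (fold-cong p) (fold-cong q)
    fold-cong (T.⊗-id m n) = P.⊗-id m n
    fold-cong (T.⊗-⨾ f g h k) = P.⊗-⨾ _ _ _ _
    fold-cong (T.⊗-identityˡ f) = P.⊗-identityˡ _
    fold-cong (T.⊗-identityʳ f) =
      P-eq.trans (P-eq.reflexive (fold-cast _ _ (f T.⊗ T.id 0))) (P.⊗-identityʳ _)
    fold-cong (T.⊗-assoc f g h) =
      P-eq.trans (P-eq.reflexive (fold-cast _ _ ((f T.⊗ g) T.⊗ h))) (P.⊗-assoc _ _ _)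
    fold-cong (T.σ-natural f g) = P.σ-natural _ _
    fold-cong (T.σ-involutive m n) = P.σ-involutive m n
    fold-cong (T.σ-hexagon m n p) = P-eq.trans
      (P-eq.reflexive (trans
        (fold-cast (+-assoc m n p) (sym (+-assoc n p m))
          ((T.σ m n T.⊗ T.id p) T.⨾ T.cast (sym (+-assoc n m p)) refl (T.id n T.⊗ T.σ m p)))
        (cong (λ h → P.cast (+-assoc m n p) (sym (+-assoc n p m)) ((P.σ m n P.⊗ P.id p) P.⨾ h))
          (fold-cast (sym (+-assoc n m p)) refl (T.id n T.⊗ T.σ m p)))))
      (P.σ-hexagon m n p)
    fold-cong (T.Tr-cong x p) = P.Tr-cong x (fold-cong p)
    fold-cong (T.tightening x h f k) = P.tightening x _ _ _
    fold-cong (T.sliding x y f g) = P.sliding x y _ _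
    fold-cong (T.vanishing₀ f) = P.vanishing₀ _
    fold-cong (T.vanishing₊ x y f) = P-eq.trans (P.vanishing₊ x y _)
      (P.Tr-cong y (P.Tr-cong x (P-eq.reflexive (sym (fold-cast _ _ f)))))
    fold-cong (T.superposing x f g) = P-eq.trans
      (P.Tr-cong x (P-eq.reflexive (fold-cast _ _ (f T.⊗ g)))) (P.superposing x _ _)
    fold-cong (T.yanking x) = P.yanking x

    extend : TracedPROPMorphism (𝐓 𝓢) P
    extend = record
      { morphism = record
          { ⟪_⟫ = fold ; ⟪⟫-cong = fold-cong
          ; ⟪⟫-id = λ _ → P-eq.refl ; ⟪⟫-⨾ = λ _ _ → P-eq.refl
          ; ⟪⟫-⊗ = λ _ _ → P-eq.refl ; ⟪⟫-σ = λ _ _ → P-eq.refl }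
      ; ⟪⟫-Tr = λ _ _ → P-eq.refl }

    extend-unique : (M : TracedPROPMorphism (𝐓 𝓢) P) → let open TracedPROPMorphism M in
                    (∀ g → ⟪ T.gen g ⟫ P.≈ φ g) →
                    ∀ {m n} (f : T.Term m n) → ⟪ f ⟫ P.≈ fold f
    extend-unique M agree = go
      where
      open TracedPROPMorphism M
      go : ∀ {m n} (f : T.Term m n) → ⟪ f ⟫ P.≈ fold f
      go (T.gen g)  = agree g
      go (T.id m)   = ⟪⟫-id m
      go (f T.⨾ g)  = P-eq.trans (⟪⟫-⨾ f g) (P.⨾-cong (go f) (go g))
      go (f T.⊗ g)  = P-eq.trans (⟪⟫-⊗ f g) (P.⊗-cong (go f) (go g))
      go (T.σ m n)  = ⟪⟫-σ m n
      go (T.Tr x f) = P-eq.trans (⟪⟫-Tr x f) (P.Tr-cong x (go f))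

record Finite (A : Set) : Set where
  field
    size : ℕ
    enum : A ↔ Fin size

finite⇒≟ : ∀ {A} → Finite A → DecidableEquality A
finite⇒≟ fin = Finₚ.inj⇒≟ (↔⇒↣ (Finite.enum fin))

finite-Fin : ∀ n → Finite (Fin n)
finite-Fin n = record { size = n ; enum = mk↔ₛ′ (λ i → i) (λ i → i) (λ _ → refl) (λ _ → refl) }

finite-↔ : ∀ {A B} → A ↔ B → Finite B → Finite A
finite-↔ A↔B fin = record { size = Finite.size fin ; enum = Finite.enum fin ↔-∘ A↔B }

finite-⊎ : ∀ {A B} → Finite A → Finite B → Finite (A ⊎ B)
finite-⊎ finA finB = record
  { size = Finite.size finA + Finite.size finB
  ; enum = ↔-sym +↔⊎ ↔-∘ (Finite.enum finA ⊎-↔ Finite.enum finB) }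

private
  refine-step : ∀ {n} {P : Fin (suc n) → Set} → Dec (P zero) →
                Finite (Refinement (Fin n) (P ∘ suc)) → Finite (Refinement (Fin (suc n)) P)
  refine-step {n} {P} (yes p) fin = finite-↔
    (mk↔ₛ′ to from to-from from-to) (finite-⊎ (finite-Fin 1) fin)
    where
    to : Refinement (Fin (suc n)) P → Fin 1 ⊎ Refinement (Fin n) (P ∘ suc)
    to (zero  , _) = inj₁ zero
    to (suc i , q) = inj₂ (i , q)
    from : Fin 1 ⊎ Refinement (Fin n) (P ∘ suc) → Refinement (Fin (suc n)) P
    from (inj₁ zero)    = zero , [ p ]
    from (inj₂ (i , q)) = suc i , q
    to-from : ∀ x → to (from x) ≡ x
    to-from (inj₁ zero) = refl
    to-from (inj₂ _)    = refl
    from-to : ∀ x → from (to x) ≡ x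
    from-to (zero  , _) = refl
    from-to (suc i , _) = refl
  refine-step {n} {P} (no ¬p) fin = finite-↔ (mk↔ₛ′ to from (λ _ → refl) from-to) fin
    where
    to : Refinement (Fin (suc n)) P → Refinement (Fin n) (P ∘ suc)
    to (zero  , [ p ]) = Relation.Nullary.contradiction-irr p ¬p
    to (suc i , q)     = i , q
    from : Refinement (Fin n) (P ∘ suc) → Refinement (Fin (suc n)) P
    from (i , q) = suc i , q
    from-to : ∀ x → from (to x) ≡ x
    from-to (zero  , [ p ]) = Relation.Nullary.contradiction-irr p ¬p
    from-to (suc i , _)     = refl

  finite-refine-Fin : ∀ n {P : Fin n → Set} → (∀ i → Dec (P i)) → Finite (Refinement (Fin n) P)
  finite-refine-Fin zero    P? = finite-↔
    (mk↔ₛ′ value (λ ()) (λ ()) (λ { (() , _) })) (finite-Fin 0)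
  finite-refine-Fin (suc n) P? = refine-step (P? zero) (finite-refine-Fin n (P? ∘ suc))

finite-refine : ∀ {A} {P : A → Set} → Finite A → (∀ a → Dec (P a)) → Finite (Refinement A P)
finite-refine {A} {P} fin P? = finite-↔
  (mk↔ₛ′ to′ from′ to-from from-to)
  (finite-refine-Fin size (P? ∘ from))
  where
  open Finite fin
  open Inverse enum using (to; from; strictlyInverseˡ; strictlyInverseʳ)
  to′ : Refinement A P → Refinement (Fin size) (P ∘ from)
  to′ (a , [ p ]) = to a , [ subst P (sym (strictlyInverseʳ a)) p ]
  from′ : Refinement (Fin size) (P ∘ from) → Refinement A P
  from′ (i , p) = from i , p
  to-from : ∀ x → to′ (from′ x) ≡ x
  to-from (i , _) = value-injective (strictlyInverseˡ i)
  from-to : ∀ x → from′ (to′ x) ≡ x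
  from-to (a , _) = value-injective (strictlyInverseʳ a)

data Glue {A : Set} {n} (l r : Fin n → A) : Rel A 0ℓ where
  glue : ∀ i → Glue l r (l i) (r i)

-- The quotient of A by the equivalence relation generated by l i ∼ r i.
record Quotient {A : Set} {n} (l r : Fin n → A) : Set₁ where
  field
    Class    : Set
    ⟦_⟧      : A → Class
    rep      : Class → A
    ⟦rep⟧    : ∀ c → ⟦ rep c ⟧ ≡ c
    ⟦⟧-glue  : ∀ i → ⟦ l i ⟧ ≡ ⟦ r i ⟧
    rep⟦⟧    : ∀ a → EqClosure (Glue l r) (rep ⟦ a ⟧) a

  elim : ∀ {p} (P : Class → Set p) → (∀ a → P ⟦ a ⟧) → ∀ c → P c
  elim P p c = subst P (⟦rep⟧ c) (p (rep c))

  rec : ∀ {B : Set} → (A → B) → Class → B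
  rec h c = h (rep c)

  rec-β : ∀ {B : Set} (h : A → B) → (∀ i → h (l i) ≡ h (r i)) → ∀ a → rec h ⟦ a ⟧ ≡ h a
  rec-β h resp a = Eq*.gfold ≡.isEquivalence h (λ { (glue i) → resp i }) (rep⟦⟧ a)

  effective : ∀ {a b} → ⟦ a ⟧ ≡ ⟦ b ⟧ → EqClosure (Glue l r) a b
  effective {a} {b} eq = Eq*.transitive _ (Eq*.symmetric _ (rep⟦⟧ a))
    (subst (λ c → EqClosure (Glue l r) (rep c) b) (sym eq) (rep⟦⟧ b))

private
  module Redirect {A : Set} (_≟_ : DecidableEquality A) (x y : A) where
    redirect : A → A
    redirect a with a ≟ x
    ... | yes _ = y
    ... | no  _ = a

    cases : ∀ a → (a ≡ x × redirect a ≡ y) ⊎ redirect a ≡ a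
    cases a with a ≟ x
    ... | yes p = inj₁ (p , refl)
    ... | no  _ = inj₂ refl

    redirect-x : redirect x ≡ y
    redirect-x with x ≟ x
    ... | yes _ = refl
    ... | no ¬p = ⊥-elim (¬p refl)

    redirect-y : redirect y ≡ y
    redirect-y with y ≟ x
    ... | yes _ = refl
    ... | no  _ = refl

    redirect-idem : ∀ a → redirect (redirect a) ≡ redirect a
    redirect-idem a with a ≟ x in eq
    ... | yes _ = redirect-y
    ... | no  _ rewrite eq = refl

  record Canonical {A : Set} {n} (l r : Fin n → A) : Set where
    field
      ρ      : A → A
      ρ-idem : ∀ a → ρ (ρ a) ≡ ρ a
      ρ-glue : ∀ i → ρ (l i) ≡ ρ (r i)
      ρ-∼    : ∀ a → EqClosure (Glue l r) (ρ a) a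

  canonical : ∀ {A : Set} → DecidableEquality A → ∀ {n} (l r : Fin n → A) → Canonical l r
  canonical {A} _≟_ {zero} l r = record
    { ρ = λ a → a ; ρ-idem = λ _ → refl ; ρ-glue = λ () ; ρ-∼ = λ _ → Eq*.reflexive _ }
  canonical {A} _≟_ {suc n} l r = record
    { ρ = λ a → redirect (ρ a)
    ; ρ-idem = λ a → trans (cong redirect (ρ-redirect a)) (redirect-idem (ρ a))
    ; ρ-glue = λ { zero    → trans redirect-x (sym redirect-y)
                 ; (suc i) → cong redirect (ρ-glue i) }
    ; ρ-∼ = redirect-∼ }
    where
    open Canonical (canonical _≟_ (l ∘ suc) (r ∘ suc))
    open Redirect _≟_ (ρ (l zero)) (ρ (r zero))

    ρ-redirect : ∀ a → ρ (redirect (ρ a)) ≡ redirect (ρ a)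
    ρ-redirect a with cases (ρ a)
    ... | inj₁ (_ , eq) = trans (cong ρ eq) (trans (ρ-idem _) (sym eq))
    ... | inj₂ eq       = trans (cong ρ eq) (trans (ρ-idem _) (sym eq))

    ∼-trans : ∀ {a b c} → EqClosure (Glue l r) a b → EqClosure (Glue l r) b c →
              EqClosure (Glue l r) a c
    ∼-trans = Eq*.transitive (Glue l r)

    ∼-sym : ∀ {a b} → EqClosure (Glue l r) a b → EqClosure (Glue l r) b a
    ∼-sym = Eq*.symmetric (Glue l r)

    ρ-∼′ : ∀ a → EqClosure (Glue l r) (ρ a) a
    ρ-∼′ a = Eq*.map (λ { (glue i) → glue (suc i) }) (ρ-∼ a)

    redirect-∼ : ∀ a → EqClosure (Glue l r) (redirect (ρ a)) a
    redirect-∼ a with cases (ρ a)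
    ... | inj₁ (ρa≡x , eq) = subst (λ z → EqClosure (Glue l r) z a) (sym eq)
          (∼-trans (ρ-∼′ (r zero)) (∼-trans (∼-sym (return (glue zero)))
          (∼-trans (∼-sym (ρ-∼′ (l zero)))
          (subst (λ z → EqClosure (Glue l r) z a) ρa≡x (ρ-∼′ a)))))
    ... | inj₂ eq = subst (λ z → EqClosure (Glue l r) z a) (sym eq) (ρ-∼′ a)

opaque
  quotient : ∀ {A : Set} → DecidableEquality A → ∀ {n} (l r : Fin n → A) → Quotient l r
  quotient {A} _≟_ l r = record
    { Class   = Refinement A (λ a → ρ a ≡ a)
    ; ⟦_⟧     = λ a → ρ a , [ ρ-idem a ]
    ; rep     = value
    ; ⟦rep⟧   = λ { (a , [ eq ]) → value-injective (recompute (ρ a ≟ a) eq) }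
    ; ⟦⟧-glue = λ i → value-injective (ρ-glue i)
    ; rep⟦⟧   = ρ-∼ }
    where open Canonical (canonical _≟_ l r)

  finite-quotient : ∀ {A : Set} (fin : Finite A) → ∀ {n} (l r : Fin n → A) →
                    Finite (Quotient.Class (quotient (finite⇒≟ fin) l r))
  finite-quotient fin l r = finite-refine fin (λ a → finite⇒≟ fin _ a)

-- A set-valued functor on the category with objects ℕ × ℕ + {⋆} generated by
-- k + l arrows (k , l) → ⋆ (k sources and l targets of a hyperedge); there are
-- no composites of non-identity arrows, hence no functor laws to impose.
record Hypergraph : Set₁ where
  field
    V : Set
    E : ℕ → ℕ → Set
    s : ∀ {k l} → E k l → Fin k → V
    t : ∀ {k l} → E k l → Fin l → V

  Edge : Set
  Edge = Σ[ k ∈ ℕ ] Σ[ l ∈ ℕ ] E k l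

  -- A hyperedge may have a vertex as a source (or target) at several
  -- positions, each of which is counted separately in the degree.
  SourceTentacle : Set
  SourceTentacle = Σ[ k ∈ ℕ ] Σ[ l ∈ ℕ ] (E k l × Fin k)

  TargetTentacle : Set
  TargetTentacle = Σ[ k ∈ ℕ ] Σ[ l ∈ ℕ ] (E k l × Fin l)

  sourceOf : SourceTentacle → V
  sourceOf (_ , _ , e , i) = s e i

  targetOf : TargetTentacle → V
  targetOf (_ , _ , e , j) = t e j

  HasDegree : V → ℕ × ℕ → Set
  HasDegree v (i , o) = ((Σ[ x ∈ TargetTentacle ] targetOf x ≡ v) ↔ Fin i)
                      × ((Σ[ x ∈ SourceTentacle ] sourceOf x ≡ v) ↔ Fin o)

infix 3 _⇒_
record _⇒_ (F G : Hypergraph) : Set where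
  private
    module F = Hypergraph F
    module G = Hypergraph G
  field
    onV  : F.V → G.V
    onE  : ∀ {k l} → F.E k l → G.E k l
    on-s : ∀ {k l} (e : F.E k l) i → onV (F.s e i) ≡ G.s (onE e) i
    on-t : ∀ {k l} (e : F.E k l) j → onV (F.t e j) ≡ G.t (onE e) j
open _⇒_

infix 3 _≈ʰ_
record _≈ʰ_ {F G : Hypergraph} (f g : F ⇒ G) : Set where
  constructor _,_
  private module F = Hypergraph F
  field
    V≡ : ∀ v → onV f v ≡ onV g v
    E≡ : ∀ {k l} (e : F.E k l) → onE f e ≡ onE g e
open _≈ʰ_

idʰ : ∀ {F} → F ⇒ F
idʰ = record { onV = λ v → v ; onE = λ e → e ; on-s = λ _ _ → refl ; on-t = λ _ _ → refl }

infixr 9 _∘ʰ_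
_∘ʰ_ : ∀ {F G H} → G ⇒ H → F ⇒ G → F ⇒ H
g ∘ʰ f = record
  { onV  = onV g ∘ onV f
  ; onE  = onE g ∘ onE f
  ; on-s = λ e i → trans (cong (onV g) (on-s f e i)) (on-s g (onE f e) i)
  ; on-t = λ e j → trans (cong (onV g) (on-t f e j)) (on-t g (onE f e) j) }

data SignatureEdge (𝓢 : Generators) : ℕ → ℕ → Set where
  edge : ∀ g → SignatureEdge 𝓢 (Generators.dom 𝓢 g) (Generators.cod 𝓢 g)

signature : Generators → Hypergraph
signature 𝓢 = record { V = ⊤ ; E = SignatureEdge 𝓢 ; s = λ _ _ → tt ; t = λ _ _ → tt }

module Labelled (𝓢 : Generators) where

  record LHyp : Set₁ where
    field
      graph : Hypergraph
      label : graph ⇒ signature 𝓢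
    open Hypergraph graph public

  infix 3 _⇒ₗ_
  record _⇒ₗ_ (F G : LHyp) : Set where
    field
      map  : LHyp.graph F ⇒ LHyp.graph G
      comm : (LHyp.label G ∘ʰ map) ≈ʰ LHyp.label F
    mapV : LHyp.V F → LHyp.V G
    mapV = onV map
    mapE : ∀ {k l} → LHyp.E F k l → LHyp.E G k l
    mapE = onE map
  open _⇒ₗ_ public

  infix 3 _≈ₗ_
  _≈ₗ_ : ∀ {F G} → F ⇒ₗ G → F ⇒ₗ G → Set
  f ≈ₗ g = map f ≈ʰ map g

  idₗ : ∀ {F} → F ⇒ₗ F
  idₗ = record { map = idʰ ; comm = (λ _ → refl) , (λ _ → refl) }

  infixr 9 _∘ₗ_
  _∘ₗ_ : ∀ {F G H} → G ⇒ₗ H → F ⇒ₗ G → F ⇒ₗ H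
  g ∘ₗ f = record
    { map  = map g ∘ʰ map f
    ; comm = (λ _ → refl) , (λ e → trans (E≡ (comm g) (mapE f e)) (E≡ (comm f) e)) }

  Mono : ∀ {F G} → F ⇒ₗ G → Set₁
  Mono {F} f = ∀ {H} (a b : H ⇒ₗ F) → f ∘ₗ a ≈ₗ f ∘ₗ b → a ≈ₗ b

  record IsIso {F G} (f : F ⇒ₗ G) : Set where
    field
      inverse : G ⇒ₗ F
      invˡ    : f ∘ₗ inverse ≈ₗ idₗ
      invʳ    : inverse ∘ₗ f ≈ₗ idₗ

  record IsPushout {A F G P} (f : A ⇒ₗ F) (g : A ⇒ₗ G) (ι₁ : F ⇒ₗ P) (ι₂ : G ⇒ₗ P) : Set₁ where
    field
      commute   : ι₁ ∘ₗ f ≈ₗ ι₂ ∘ₗ g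
      universal : ∀ {H} (h₁ : F ⇒ₗ H) (h₂ : G ⇒ₗ H) → h₁ ∘ₗ f ≈ₗ h₂ ∘ₗ g → P ⇒ₗ H
      β₁        : ∀ {H} (h₁ : F ⇒ₗ H) (h₂ : G ⇒ₗ H) (q : h₁ ∘ₗ f ≈ₗ h₂ ∘ₗ g) →
                  universal h₁ h₂ q ∘ₗ ι₁ ≈ₗ h₁
      β₂        : ∀ {H} (h₁ : F ⇒ₗ H) (h₂ : G ⇒ₗ H) (q : h₁ ∘ₗ f ≈ₗ h₂ ∘ₗ g) →
                  universal h₁ h₂ q ∘ₗ ι₂ ≈ₗ h₂
      unique    : ∀ {H} (u v : P ⇒ₗ H) → u ∘ₗ ι₁ ≈ₗ v ∘ₗ ι₁ → u ∘ₗ ι₂ ≈ₗ v ∘ₗ ι₂ → u ≈ₗ v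

  record IsCoproduct {F G P} (ι₁ : F ⇒ₗ P) (ι₂ : G ⇒ₗ P) : Set₁ where
    field
      universal : ∀ {H} → F ⇒ₗ H → G ⇒ₗ H → P ⇒ₗ H
      β₁        : ∀ {H} (h₁ : F ⇒ₗ H) (h₂ : G ⇒ₗ H) → universal h₁ h₂ ∘ₗ ι₁ ≈ₗ h₁
      β₂        : ∀ {H} (h₁ : F ⇒ₗ H) (h₂ : G ⇒ₗ H) → universal h₁ h₂ ∘ₗ ι₂ ≈ₗ h₂
      unique    : ∀ {H} (u v : P ⇒ₗ H) → u ∘ₗ ι₁ ≈ₗ v ∘ₗ ι₁ → u ∘ₗ ι₂ ≈ₗ v ∘ₗ ι₂ → u ≈ₗ v

  D : ℕ → LHyp
  D n = record
    { graph = record { V = Fin n ; E = λ _ _ → ⊥ ; s = λ () ; t = λ () }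
    ; label = record { onV = λ _ → tt ; onE = λ () ; on-s = λ () ; on-t = λ () } }

  vertices : ∀ {n} (F : LHyp) → (Fin n → LHyp.V F) → D n ⇒ₗ F
  vertices F f = record
    { map = record { onV = f ; onE = λ () ; on-s = λ () ; on-t = λ () }
    ; comm = (λ _ → refl) , (λ ()) }

  FiniteHyp : LHyp → Set
  FiniteHyp F = Finite (LHyp.V F) × Finite (LHyp.Edge F)

  infixr 6 _+ₗ_
  _+ₗ_ : LHyp → LHyp → LHyp
  F +ₗ G = record
    { graph = record
        { V = F.V ⊎ G.V
        ; E = λ k l → F.E k l ⊎ G.E k l
        ; s = λ { (inj₁ e) i → inj₁ (F.s e i) ; (inj₂ e) i → inj₂ (G.s e i) }
        ; t = λ { (inj₁ e) j → inj₁ (F.t e j) ; (inj₂ e) j → inj₂ (G.t e j) } }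
    ; label = record
        { onV = λ _ → tt
        ; onE = [ onE F.label , onE G.label ]′
        ; on-s = λ _ _ → refl
        ; on-t = λ _ _ → refl } }
    where
    module F = LHyp F
    module G = LHyp G

  module _ {F G : LHyp} where
    ι₁ : F ⇒ₗ F +ₗ G
    ι₁ = record
      { map = record { onV = inj₁ ; onE = inj₁ ; on-s = λ _ _ → refl ; on-t = λ _ _ → refl }
      ; comm = (λ _ → refl) , (λ _ → refl) }

    ι₂ : G ⇒ₗ F +ₗ G
    ι₂ = record
      { map = record { onV = inj₂ ; onE = inj₂ ; on-s = λ _ _ → refl ; on-t = λ _ _ → refl }
      ; comm = (λ _ → refl) , (λ _ → refl) }

    +ₗ-isCoproduct : IsCoproduct ι₁ ι₂
    +ₗ-isCoproduct = record
      { universal = λ h₁ h₂ → record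
          { map = record
              { onV = [ mapV h₁ , mapV h₂ ]′
              ; onE = [ mapE h₁ , mapE h₂ ]′
              ; on-s = λ { (inj₁ e) i → on-s (map h₁) e i ; (inj₂ e) i → on-s (map h₂) e i }
              ; on-t = λ { (inj₁ e) j → on-t (map h₁) e j ; (inj₂ e) j → on-t (map h₂) e j } }
          ; comm = (λ _ → refl) , λ { (inj₁ e) → E≡ (comm h₁) e ; (inj₂ e) → E≡ (comm h₂) e } }
      ; β₁ = λ _ _ → (λ _ → refl) , (λ _ → refl)
      ; β₂ = λ _ _ → (λ _ → refl) , (λ _ → refl)
      ; unique = λ u v p q →
          (λ { (inj₁ x) → V≡ p x ; (inj₂ y) → V≡ q y }) ,
          (λ { (inj₁ x) → E≡ p x ; (inj₂ y) → E≡ q y }) }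

  private
    edges-⊎ : (F G : LHyp) →
              (Σ[ k ∈ ℕ ] Σ[ l ∈ ℕ ] (LHyp.E F k l ⊎ LHyp.E G k l)) ↔ (LHyp.Edge F ⊎ LHyp.Edge G)
    edges-⊎ F G = mk↔ₛ′
      (λ { (k , l , inj₁ e) → inj₁ (k , l , e) ; (k , l , inj₂ e) → inj₂ (k , l , e) })
      (λ { (inj₁ (k , l , e)) → k , l , inj₁ e ; (inj₂ (k , l , e)) → k , l , inj₂ e })
      (λ { (inj₁ _) → refl ; (inj₂ _) → refl })
      (λ { (_ , _ , inj₁ _) → refl ; (_ , _ , inj₂ _) → refl })

  finite-+ₗ : ∀ {F G} → FiniteHyp F → FiniteHyp G → FiniteHyp (F +ₗ G)
  finite-+ₗ {F} {G} (vF , eF) (vG , eG) =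
    finite-⊎ vF vG , finite-↔ (edges-⊎ F G) (finite-⊎ eF eG)

  finite-D : ∀ n → FiniteHyp (D n)
  finite-D n = finite-Fin n , record
    { size = 0 ; enum = mk↔ₛ′ (λ { (_ , _ , ()) }) (λ ()) (λ ()) (λ { (_ , _ , ()) }) }

  -- Pushouts of finite hypergraphs along discrete ones: the vertices are
  -- glued, while the hyperedges of the pushout are a disjoint union.

  module Pushout {n} {F G : LHyp} (finF : Finite (LHyp.V F)) (finG : Finite (LHyp.V G))
                 (f : D n ⇒ₗ F) (g : D n ⇒ₗ G) where
    private
      module F = LHyp F
      module G = LHyp G

    open Quotient (quotient (finite⇒≟ (finite-⊎ finF finG)) (inj₁ ∘ mapV f) (inj₂ ∘ mapV g)) public

    in₁ : F.V → Class
    in₁ x = ⟦ inj₁ x ⟧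

    in₂ : G.V → Class
    in₂ y = ⟦ inj₂ y ⟧

    object : LHyp
    object = record
      { graph = record
          { V = Class
          ; E = λ k l → F.E k l ⊎ G.E k l
          ; s = λ { (inj₁ e) i → in₁ (F.s e i) ; (inj₂ e) i → in₂ (G.s e i) }
          ; t = λ { (inj₁ e) j → in₁ (F.t e j) ; (inj₂ e) j → in₂ (G.t e j) } }
      ; label = record
          { onV = λ _ → tt
          ; onE = [ onE F.label , onE G.label ]′
          ; on-s = λ _ _ → refl
          ; on-t = λ _ _ → refl } }

    κ₁ : F ⇒ₗ object
    κ₁ = record
      { map = record { onV = in₁ ; onE = inj₁ ; on-s = λ _ _ → refl ; on-t = λ _ _ → refl }
      ; comm = (λ _ → refl) , (λ _ → refl) }

    κ₂ : G ⇒ₗ object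
    κ₂ = record
      { map = record { onV = in₂ ; onE = inj₂ ; on-s = λ _ _ → refl ; on-t = λ _ _ → refl }
      ; comm = (λ _ → refl) , (λ _ → refl) }

    isPushout : IsPushout f g κ₁ κ₂
    isPushout = record
      { commute = ⟦⟧-glue , (λ ())
      ; universal = λ h₁ h₂ q → record
          { map = record
              { onV = rec [ mapV h₁ , mapV h₂ ]′
              ; onE = [ mapE h₁ , mapE h₂ ]′
              ; on-s = λ { (inj₁ e) i → trans (rec-β [ mapV h₁ , mapV h₂ ]′ (V≡ q) _) (on-s (map h₁) e i)
                         ; (inj₂ e) i → trans (rec-β [ mapV h₁ , mapV h₂ ]′ (V≡ q) _) (on-s (map h₂) e i) }
              ; on-t = λ { (inj₁ e) j → trans (rec-β [ mapV h₁ , mapV h₂ ]′ (V≡ q) _) (on-t (map h₁) e j)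
                         ; (inj₂ e) j → trans (rec-β [ mapV h₁ , mapV h₂ ]′ (V≡ q) _) (on-t (map h₂) e j) } }
          ; comm = (λ _ → refl) , λ { (inj₁ e) → E≡ (comm h₁) e ; (inj₂ e) → E≡ (comm h₂) e } }
      ; β₁ = λ h₁ h₂ q → (λ x → rec-β [ mapV h₁ , mapV h₂ ]′ (V≡ q) (inj₁ x)) , (λ _ → refl)
      ; β₂ = λ h₁ h₂ q → (λ y → rec-β [ mapV h₁ , mapV h₂ ]′ (V≡ q) (inj₂ y)) , (λ _ → refl)
      ; unique = λ u v p q →
          elim _ (λ { (inj₁ x) → V≡ p x ; (inj₂ y) → V≡ q y }) ,
          (λ { (inj₁ x) → E≡ p x ; (inj₂ y) → E≡ q y }) }

    finite : Finite F.Edge → Finite G.Edge → FiniteHyp object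
    finite eF eG =
      finite-quotient (finite-⊎ finF finG) (inj₁ ∘ mapV f) (inj₂ ∘ mapV g) ,
      finite-↔ (edges-⊎ F G) (finite-⊎ eF eG)

copair : ∀ {A : Set} m {n} → (Fin m → A) → (Fin n → A) → Fin (m + n) → A
copair m f g i = [ f , g ]′ (splitAt m i)

copair-ˡ : ∀ {A : Set} {m n} (f : Fin m → A) (g : Fin n → A) i → copair m f g (i ↑ˡ n) ≡ f i
copair-ˡ {m = m} {n} f g i = cong [ f , g ]′ (splitAt-↑ˡ m i n)

copair-ʳ : ∀ {A : Set} {m n} (f : Fin m → A) (g : Fin n → A) j → copair m f g (m ↑ʳ j) ≡ g j
copair-ʳ {m = m} {n} f g j = cong [ f , g ]′ (splitAt-↑ʳ m n j)

split-elim : ∀ {p} m {n} (P : Fin (m + n) → Set p) →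
             (∀ i → P (i ↑ˡ n)) → (∀ j → P (m ↑ʳ j)) → ∀ i → P i
split-elim m {n} P l r i = subst P (join-splitAt m n i) (go (splitAt m i))
  where
  go : ∀ x → P (Fin.join m n x)
  go (inj₁ i) = l i
  go (inj₂ j) = r j

swapFin : ∀ m n → Fin (m + n) → Fin (n + m)
swapFin m n = copair m (n ↑ʳ_) (_↑ˡ m)

module Cospans (𝓢 : Generators) where
  open Labelled 𝓢

  -- The apex is finite: terms denote finite hypergraphs only, and cospans
  -- with arbitrary apices do not even have a set of isomorphism classes.
  record Cospan (m n : ℕ) : Set₁ where
    field
      apex   : LHyp
      finite : FiniteHyp apex
      left   : D m ⇒ₗ apex
      right  : D n ⇒ₗ apex
    open LHyp apex public
    leftV : Fin m → V
    leftV = mapV left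
    rightV : Fin n → V
    rightV = mapV right
    labelE : ∀ {k l} → E k l → SignatureEdge 𝓢 k l
    labelE = onE label
  open Cospan

  infix 4 _≈_
  record _≈_ {m n} (X Y : Cospan m n) : Set where
    field
      iso     : apex X ⇒ₗ apex Y
      isIso   : IsIso iso
      onLeft  : iso ∘ₗ left X ≈ₗ left Y
      onRight : iso ∘ₗ right X ≈ₗ right Y

  perm : ∀ {m n} → D n ⇒ₗ D m → Cospan m n
  perm {m} r = record { apex = D m ; finite = finite-D m ; left = idₗ ; right = r }

  identity : ∀ m → Cospan m m
  identity m = perm idₗ

  symmetry : ∀ m n → Cospan (m + n) (n + m)
  symmetry m n = perm (vertices (D (m + n)) (swapFin n m))

  module Composite {m n p} (X : Cospan m n) (Y : Cospan n p) =
    Pushout (proj₁ (finite X)) (proj₁ (finite Y)) (right X) (left Y)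

  infixl 6 _⨾_
  _⨾_ : ∀ {m n p} → Cospan m n → Cospan n p → Cospan m p
  X ⨾ Y = record
    { apex   = object
    ; finite = PO-finite (proj₂ (finite X)) (proj₂ (finite Y))
    ; left   = κ₁ ∘ₗ left X
    ; right  = κ₂ ∘ₗ right Y }
    where open Composite X Y renaming (finite to PO-finite)

  copairD : ∀ {m n F} → D m ⇒ₗ F → D n ⇒ₗ F → D (m + n) ⇒ₗ F
  copairD {m} {F = F} f g = vertices F (copair m (mapV f) (mapV g))

  D-isCoproduct : ∀ m n → IsCoproduct (vertices (D (m + n)) (_↑ˡ n)) (vertices (D (m + n)) (m ↑ʳ_))
  D-isCoproduct m n = record
    { universal = copairD
    ; β₁ = λ f g → copair-ˡ (mapV f) (mapV g) , (λ ())
    ; β₂ = λ f g → copair-ʳ (mapV f) (mapV g) , (λ ())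
    ; unique = λ u v p q → split-elim m _ (V≡ p) (V≡ q) , (λ ()) }

  infixl 7 _⊗_
  _⊗_ : ∀ {m n p q} → Cospan m n → Cospan p q → Cospan (m + p) (n + q)
  X ⊗ Y = record
    { apex   = apex X +ₗ apex Y
    ; finite = finite-+ₗ {apex X} {apex Y} (finite X) (finite Y)
    ; left   = copairD (ι₁ ∘ₗ left X) (ι₂ ∘ₗ left Y)
    ; right  = copairD (ι₁ ∘ₗ right X) (ι₂ ∘ₗ right Y) }

  record Iso {m n} (X Y : Cospan m n) : Set where
    private
      module X = Cospan X
      module Y = Cospan Y
    field
      vTo   : X.V → Y.V
      vFrom : Y.V → X.V
      v-tf  : ∀ y → vTo (vFrom y) ≡ y
      v-ft  : ∀ x → vFrom (vTo x) ≡ x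
      eTo   : ∀ {k l} → X.E k l → Y.E k l
      eFrom : ∀ {k l} → Y.E k l → X.E k l
      e-tf  : ∀ {k l} (y : Y.E k l) → eTo (eFrom y) ≡ y
      e-ft  : ∀ {k l} (x : X.E k l) → eFrom (eTo x) ≡ x
      to-s  : ∀ {k l} (x : X.E k l) i → vTo (X.s x i) ≡ Y.s (eTo x) i
      to-t  : ∀ {k l} (x : X.E k l) j → vTo (X.t x j) ≡ Y.t (eTo x) j
      to-l  : ∀ {k l} (x : X.E k l) → Y.labelE (eTo x) ≡ X.labelE x
      to-left  : ∀ i → vTo (X.leftV i) ≡ Y.leftV i
      to-right : ∀ i → vTo (X.rightV i) ≡ Y.rightV i

  mkIso : ∀ {m n} {X Y : Cospan m n} → Iso X Y → X ≈ Y
  mkIso {X = X} {Y} I = record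
    { iso = record
        { map = record { onV = vTo ; onE = eTo ; on-s = to-s ; on-t = to-t }
        ; comm = (λ _ → refl) , to-l }
    ; isIso = record
        { inverse = record
            { map = record
                { onV = vFrom ; onE = eFrom
                ; on-s = λ y i → trans (cong vFrom
                    (trans (cong (λ z → Y.s z i) (sym (e-tf y))) (sym (to-s (eFrom y) i)))) (v-ft _)
                ; on-t = λ y j → trans (cong vFrom
                    (trans (cong (λ z → Y.t z j) (sym (e-tf y))) (sym (to-t (eFrom y) j)))) (v-ft _) }
            ; comm = (λ _ → refl) ,
                (λ y → trans (sym (to-l (eFrom y))) (cong Y.labelE (e-tf y))) }
        ; invˡ = v-tf , e-tf
        ; invʳ = v-ft , e-ft }
    ; onLeft = to-left , (λ ())
    ; onRight = to-right , (λ ()) }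
    where
    open Iso I
    module X = Cospan X
    module Y = Cospan Y

  unIso : ∀ {m n} {X Y : Cospan m n} → X ≈ Y → Iso X Y
  unIso p = record
    { vTo = mapV iso ; vFrom = mapV inverse ; v-tf = V≡ invˡ ; v-ft = V≡ invʳ
    ; eTo = mapE iso ; eFrom = mapE inverse ; e-tf = E≡ invˡ ; e-ft = E≡ invʳ
    ; to-s = on-s (map iso) ; to-t = on-t (map iso) ; to-l = E≡ (comm iso)
    ; to-left = V≡ onLeft ; to-right = V≡ onRight }
    where
    open _≈_ p
    open IsIso isIso

  ≈-refl : ∀ {m n} {X : Cospan m n} → X ≈ X
  ≈-refl {X = X} = mkIso {X = X} {X} record
    { vTo = λ v → v ; vFrom = λ v → v ; v-tf = λ _ → refl ; v-ft = λ _ → refl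
    ; eTo = λ e → e ; eFrom = λ e → e ; e-tf = λ _ → refl ; e-ft = λ _ → refl
    ; to-s = λ _ _ → refl ; to-t = λ _ _ → refl ; to-l = λ _ → refl
    ; to-left = λ _ → refl ; to-right = λ _ → refl }

  ≈-sym : ∀ {m n} {X Y : Cospan m n} → X ≈ Y → Y ≈ X
  ≈-sym {X = X} {Y} p = record
    { iso = inverse
    ; isIso = record { inverse = iso ; invˡ = invʳ ; invʳ = invˡ }
    ; onLeft = (λ i → trans (cong (mapV inverse) (sym (V≡ onLeft i))) (V≡ invʳ _)) , (λ ())
    ; onRight = (λ i → trans (cong (mapV inverse) (sym (V≡ onRight i))) (V≡ invʳ _)) , (λ ()) }
    where
    open _≈_ p
    open IsIso isIso

  ≈-trans : ∀ {m n} {X Y Z : Cospan m n} → X ≈ Y → Y ≈ Z → X ≈ Z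
  ≈-trans p q = record
    { iso = iso q ∘ₗ iso p
    ; isIso = record
        { inverse = inverse (isIso p) ∘ₗ inverse (isIso q)
        ; invˡ = (λ v → trans (cong (mapV (iso q)) (V≡ (invˡ (isIso p)) _)) (V≡ (invˡ (isIso q)) v)) ,
                 (λ e → trans (cong (mapE (iso q)) (E≡ (invˡ (isIso p)) _)) (E≡ (invˡ (isIso q)) e))
        ; invʳ = (λ v → trans (cong (mapV (inverse (isIso p))) (V≡ (invʳ (isIso q)) _)) (V≡ (invʳ (isIso p)) v)) ,
                 (λ e → trans (cong (mapE (inverse (isIso p))) (E≡ (invʳ (isIso q)) _)) (E≡ (invʳ (isIso p)) e)) }
    ; onLeft = (λ i → trans (cong (mapV (iso q)) (V≡ (onLeft p) i)) (V≡ (onLeft q) i)) , (λ ())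
    ; onRight = (λ i → trans (cong (mapV (iso q)) (V≡ (onRight p) i)) (V≡ (onRight q) i)) , (λ ()) }
    where
    open _≈_
    open IsIso

  ⨾-cong : ∀ {m n p} {X X′ : Cospan m n} {Y Y′ : Cospan n p} → X ≈ X′ → Y ≈ Y′ → X ⨾ Y ≈ X′ ⨾ Y′
  ⨾-cong {X = X} {X′} {Y} {Y′} p q = mkIso record
    { vTo = Q.rec fwd ; vFrom = Q′.rec bwd
    ; v-tf = Q′.elim _ λ
        { (inj₁ x) → trans (cong (Q.rec fwd) (Q′.rec-β bwd bwd-glue (inj₁ x)))
            (trans (Q.rec-β fwd fwd-glue _) (cong Q′.in₁ (I.v-tf x)))
        ; (inj₂ y) → trans (cong (Q.rec fwd) (Q′.rec-β bwd bwd-glue (inj₂ y)))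
            (trans (Q.rec-β fwd fwd-glue _) (cong Q′.in₂ (J.v-tf y))) }
    ; v-ft = Q.elim _ λ
        { (inj₁ x) → trans (cong (Q′.rec bwd) (Q.rec-β fwd fwd-glue (inj₁ x)))
            (trans (Q′.rec-β bwd bwd-glue _) (cong Q.in₁ (I.v-ft x)))
        ; (inj₂ y) → trans (cong (Q′.rec bwd) (Q.rec-β fwd fwd-glue (inj₂ y)))
            (trans (Q′.rec-β bwd bwd-glue _) (cong Q.in₂ (J.v-ft y))) }
    ; eTo = Sum.map I.eTo J.eTo ; eFrom = Sum.map I.eFrom J.eFrom
    ; e-tf = λ { (inj₁ e) → cong inj₁ (I.e-tf e) ; (inj₂ e) → cong inj₂ (J.e-tf e) }
    ; e-ft = λ { (inj₁ e) → cong inj₁ (I.e-ft e) ; (inj₂ e) → cong inj₂ (J.e-ft e) }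
    ; to-s = λ { (inj₁ e) i → trans (Q.rec-β fwd fwd-glue _) (cong Q′.in₁ (I.to-s e i))
               ; (inj₂ e) i → trans (Q.rec-β fwd fwd-glue _) (cong Q′.in₂ (J.to-s e i)) }
    ; to-t = λ { (inj₁ e) i → trans (Q.rec-β fwd fwd-glue _) (cong Q′.in₁ (I.to-t e i))
               ; (inj₂ e) i → trans (Q.rec-β fwd fwd-glue _) (cong Q′.in₂ (J.to-t e i)) }
    ; to-l = λ { (inj₁ e) → I.to-l e ; (inj₂ e) → J.to-l e }
    ; to-left  = λ i → trans (Q.rec-β fwd fwd-glue _) (cong Q′.in₁ (I.to-left i))
    ; to-right = λ i → trans (Q.rec-β fwd fwd-glue _) (cong Q′.in₂ (J.to-right i)) }
    where
    module I = Iso (unIso p)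
    module J = Iso (unIso q)
    module Q = Composite X Y
    module Q′ = Composite X′ Y′

    fwd : V X ⊎ V Y → Q′.Class
    fwd = [ Q′.in₁ ∘ I.vTo , Q′.in₂ ∘ J.vTo ]′

    fwd-glue : ∀ i → Q′.in₁ (I.vTo (rightV X i)) ≡ Q′.in₂ (J.vTo (leftV Y i))
    fwd-glue i = trans (cong Q′.in₁ (I.to-right i))
      (trans (Q′.⟦⟧-glue i) (cong Q′.in₂ (sym (J.to-left i))))

    bwd : V X′ ⊎ V Y′ → Q.Class
    bwd = [ Q.in₁ ∘ I.vFrom , Q.in₂ ∘ J.vFrom ]′

    bwd-glue : ∀ i → Q.in₁ (I.vFrom (rightV X′ i)) ≡ Q.in₂ (J.vFrom (leftV Y′ i))
    bwd-glue i = trans (cong Q.in₁ (trans (cong I.vFrom (sym (I.to-right i))) (I.v-ft _)))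
      (trans (Q.⟦⟧-glue i)
        (cong Q.in₂ (sym (trans (cong J.vFrom (sym (J.to-left i))) (J.v-ft _)))))

  ⊗-cong : ∀ {m n p q} {X X′ : Cospan m n} {Y Y′ : Cospan p q} → X ≈ X′ → Y ≈ Y′ → X ⊗ Y ≈ X′ ⊗ Y′
  ⊗-cong {m} {n} {X = X} {X′} {Y} {Y′} p q = mkIso record
    { vTo = Sum.map I.vTo J.vTo ; vFrom = Sum.map I.vFrom J.vFrom
    ; v-tf = λ { (inj₁ x) → cong inj₁ (I.v-tf x) ; (inj₂ y) → cong inj₂ (J.v-tf y) }
    ; v-ft = λ { (inj₁ x) → cong inj₁ (I.v-ft x) ; (inj₂ y) → cong inj₂ (J.v-ft y) }
    ; eTo = Sum.map I.eTo J.eTo ; eFrom = Sum.map I.eFrom J.eFrom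
    ; e-tf = λ { (inj₁ e) → cong inj₁ (I.e-tf e) ; (inj₂ e) → cong inj₂ (J.e-tf e) }
    ; e-ft = λ { (inj₁ e) → cong inj₁ (I.e-ft e) ; (inj₂ e) → cong inj₂ (J.e-ft e) }
    ; to-s = λ { (inj₁ e) i → cong inj₁ (I.to-s e i) ; (inj₂ e) i → cong inj₂ (J.to-s e i) }
    ; to-t = λ { (inj₁ e) i → cong inj₁ (I.to-t e i) ; (inj₂ e) i → cong inj₂ (J.to-t e i) }
    ; to-l = λ { (inj₁ e) → I.to-l e ; (inj₂ e) → J.to-l e }
    ; to-left  = legs m I.to-left J.to-left
    ; to-right = legs n I.to-right J.to-right }
    where
    module I = Iso (unIso p)
    module J = Iso (unIso q)

    legs : ∀ m {n} {f : Fin m → V X} {f′ : Fin m → V X′} {g : Fin n → V Y} {g′ : Fin n → V Y′} →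
           (∀ i → I.vTo (f i) ≡ f′ i) → (∀ j → J.vTo (g j) ≡ g′ j) →
           ∀ i → Sum.map I.vTo J.vTo (copair m (inj₁ ∘ f) (inj₂ ∘ g) i)
               ≡ copair m (inj₁ ∘ f′) (inj₂ ∘ g′) i
    legs m p q i with splitAt m i
    ... | inj₁ a = cong inj₁ (p a)
    ... | inj₂ b = cong inj₂ (q b)

  ⨾-assoc : ∀ {m n p q} (X : Cospan m n) (Y : Cospan n p) (Z : Cospan p q) →
            (X ⨾ Y) ⨾ Z ≈ X ⨾ (Y ⨾ Z)
  ⨾-assoc X Y Z = mkIso record
    { vTo = L.rec fwd ; vFrom = R.rec bwd
    ; v-tf = R.elim _ λ
        { (inj₁ x) → trans (cong (L.rec fwd) (R.rec-β bwd bwd-glue _))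
            (trans (L.rec-β fwd fwd-glue _) (XY.rec-β fwdXY fwdXY-glue _))
        ; (inj₂ c) → YZ.elim (λ c → L.rec fwd (R.rec bwd (R.in₂ c)) ≡ R.in₂ c) (λ
            { (inj₁ y) → trans (cong (L.rec fwd) (trans (R.rec-β bwd bwd-glue _) (YZ.rec-β bwdYZ bwdYZ-glue _)))
                (trans (L.rec-β fwd fwd-glue _) (XY.rec-β fwdXY fwdXY-glue _))
            ; (inj₂ z) → trans (cong (L.rec fwd) (trans (R.rec-β bwd bwd-glue _) (YZ.rec-β bwdYZ bwdYZ-glue _)))
                (L.rec-β fwd fwd-glue _) }) c }
    ; v-ft = L.elim _ λ
        { (inj₁ c) → XY.elim (λ c → R.rec bwd (L.rec fwd (L.in₁ c)) ≡ L.in₁ c) (λ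
            { (inj₁ x) → trans (cong (R.rec bwd) (trans (L.rec-β fwd fwd-glue _) (XY.rec-β fwdXY fwdXY-glue _)))
                (R.rec-β bwd bwd-glue _)
            ; (inj₂ y) → trans (cong (R.rec bwd) (trans (L.rec-β fwd fwd-glue _) (XY.rec-β fwdXY fwdXY-glue _)))
                (trans (R.rec-β bwd bwd-glue _) (YZ.rec-β bwdYZ bwdYZ-glue _)) }) c
        ; (inj₂ z) → trans (cong (R.rec bwd) (L.rec-β fwd fwd-glue _))
            (trans (R.rec-β bwd bwd-glue _) (YZ.rec-β bwdYZ bwdYZ-glue _)) }
    ; eTo = assocʳ ; eFrom = assocˡ
    ; e-tf = λ { (inj₁ _) → refl ; (inj₂ (inj₁ _)) → refl ; (inj₂ (inj₂ _)) → refl }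
    ; e-ft = λ { (inj₁ (inj₁ _)) → refl ; (inj₁ (inj₂ _)) → refl ; (inj₂ _) → refl }
    ; to-s = λ
        { (inj₁ (inj₁ e)) i → trans (L.rec-β fwd fwd-glue _) (XY.rec-β fwdXY fwdXY-glue _)
        ; (inj₁ (inj₂ e)) i → trans (L.rec-β fwd fwd-glue _) (XY.rec-β fwdXY fwdXY-glue _)
        ; (inj₂ e) i → L.rec-β fwd fwd-glue _ }
    ; to-t = λ
        { (inj₁ (inj₁ e)) i → trans (L.rec-β fwd fwd-glue _) (XY.rec-β fwdXY fwdXY-glue _)
        ; (inj₁ (inj₂ e)) i → trans (L.rec-β fwd fwd-glue _) (XY.rec-β fwdXY fwdXY-glue _)
        ; (inj₂ e) i → L.rec-β fwd fwd-glue _ }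
    ; to-l = λ { (inj₁ (inj₁ e)) → refl ; (inj₁ (inj₂ e)) → refl ; (inj₂ e) → refl }
    ; to-left = λ i → trans (L.rec-β fwd fwd-glue _) (XY.rec-β fwdXY fwdXY-glue _)
    ; to-right = λ i → L.rec-β fwd fwd-glue _ }
    where
    module XY = Composite X Y
    module YZ = Composite Y Z
    module L = Composite (X ⨾ Y) Z
    module R = Composite X (Y ⨾ Z)

    fwdXY : V X ⊎ V Y → R.Class
    fwdXY = [ R.in₁ , R.in₂ ∘ YZ.in₁ ]′

    fwdXY-glue : ∀ i → R.in₁ (rightV X i) ≡ R.in₂ (YZ.in₁ (leftV Y i))
    fwdXY-glue = R.⟦⟧-glue

    fwd : XY.Class ⊎ V Z → R.Class
    fwd = [ XY.rec fwdXY , R.in₂ ∘ YZ.in₂ ]′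

    fwd-glue : ∀ i → XY.rec fwdXY (XY.in₂ (rightV Y i)) ≡ R.in₂ (YZ.in₂ (leftV Z i))
    fwd-glue i = trans (XY.rec-β fwdXY fwdXY-glue _) (cong R.in₂ (YZ.⟦⟧-glue i))

    bwdYZ : V Y ⊎ V Z → L.Class
    bwdYZ = [ L.in₁ ∘ XY.in₂ , L.in₂ ]′

    bwdYZ-glue : ∀ i → L.in₁ (XY.in₂ (rightV Y i)) ≡ L.in₂ (leftV Z i)
    bwdYZ-glue = L.⟦⟧-glue

    bwd : V X ⊎ YZ.Class → L.Class
    bwd = [ L.in₁ ∘ XY.in₁ , YZ.rec bwdYZ ]′

    bwd-glue : ∀ i → L.in₁ (XY.in₁ (rightV X i)) ≡ YZ.rec bwdYZ (YZ.in₁ (leftV Y i))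
    bwd-glue i = trans (cong L.in₁ (XY.⟦⟧-glue i)) (sym (YZ.rec-β bwdYZ bwdYZ-glue _))

  ⊗-⨾ : ∀ {m n p m′ n′ p′} (X : Cospan m n) (Y : Cospan n p) (X′ : Cospan m′ n′) (Y′ : Cospan n′ p′) →
        (X ⨾ Y) ⊗ (X′ ⨾ Y′) ≈ (X ⊗ X′) ⨾ (Y ⊗ Y′)
  ⊗-⨾ {m} {n} {p} {n′ = n′} X Y X′ Y′ = mkIso record
    { vTo = [ A.rec fwd₁ , B.rec fwd₂ ]′ ; vFrom = Q.rec bwd
    ; v-tf = Q.elim _ λ
        { (inj₁ (inj₁ x)) → trans (cong vTo (Q.rec-β bwd bwd-glue _)) (A.rec-β fwd₁ glue₁ _)
        ; (inj₁ (inj₂ x)) → trans (cong vTo (Q.rec-β bwd bwd-glue _)) (B.rec-β fwd₂ glue₂ _)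
        ; (inj₂ (inj₁ x)) → trans (cong vTo (Q.rec-β bwd bwd-glue _)) (A.rec-β fwd₁ glue₁ _)
        ; (inj₂ (inj₂ x)) → trans (cong vTo (Q.rec-β bwd bwd-glue _)) (B.rec-β fwd₂ glue₂ _) }
    ; v-ft = λ
        { (inj₁ c) → A.elim (λ c → Q.rec bwd (A.rec fwd₁ c) ≡ inj₁ c) (λ
            { (inj₁ x) → trans (cong (Q.rec bwd) (A.rec-β fwd₁ glue₁ _)) (Q.rec-β bwd bwd-glue _)
            ; (inj₂ y) → trans (cong (Q.rec bwd) (A.rec-β fwd₁ glue₁ _)) (Q.rec-β bwd bwd-glue _) }) c
        ; (inj₂ c) → B.elim (λ c → Q.rec bwd (B.rec fwd₂ c) ≡ inj₂ c) (λ
            { (inj₁ x) → trans (cong (Q.rec bwd) (B.rec-β fwd₂ glue₂ _)) (Q.rec-β bwd bwd-glue _)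
            ; (inj₂ y) → trans (cong (Q.rec bwd) (B.rec-β fwd₂ glue₂ _)) (Q.rec-β bwd bwd-glue _) }) c }
    ; eTo = λ
        { (inj₁ (inj₁ e)) → inj₁ (inj₁ e) ; (inj₁ (inj₂ e)) → inj₂ (inj₁ e)
        ; (inj₂ (inj₁ e)) → inj₁ (inj₂ e) ; (inj₂ (inj₂ e)) → inj₂ (inj₂ e) }
    ; eFrom = λ
        { (inj₁ (inj₁ e)) → inj₁ (inj₁ e) ; (inj₁ (inj₂ e)) → inj₂ (inj₁ e)
        ; (inj₂ (inj₁ e)) → inj₁ (inj₂ e) ; (inj₂ (inj₂ e)) → inj₂ (inj₂ e) }
    ; e-tf = λ
        { (inj₁ (inj₁ e)) → refl ; (inj₁ (inj₂ e)) → refl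
        ; (inj₂ (inj₁ e)) → refl ; (inj₂ (inj₂ e)) → refl }
    ; e-ft = λ
        { (inj₁ (inj₁ e)) → refl ; (inj₁ (inj₂ e)) → refl
        ; (inj₂ (inj₁ e)) → refl ; (inj₂ (inj₂ e)) → refl }
    ; to-s = λ
        { (inj₁ (inj₁ e)) i → A.rec-β fwd₁ glue₁ _ ; (inj₁ (inj₂ e)) i → A.rec-β fwd₁ glue₁ _
        ; (inj₂ (inj₁ e)) i → B.rec-β fwd₂ glue₂ _ ; (inj₂ (inj₂ e)) i → B.rec-β fwd₂ glue₂ _ }
    ; to-t = λ
        { (inj₁ (inj₁ e)) i → A.rec-β fwd₁ glue₁ _ ; (inj₁ (inj₂ e)) i → A.rec-β fwd₁ glue₁ _
        ; (inj₂ (inj₁ e)) i → B.rec-β fwd₂ glue₂ _ ; (inj₂ (inj₂ e)) i → B.rec-β fwd₂ glue₂ _ }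
    ; to-l = λ
        { (inj₁ (inj₁ e)) → refl ; (inj₁ (inj₂ e)) → refl
        ; (inj₂ (inj₁ e)) → refl ; (inj₂ (inj₂ e)) → refl }
    ; to-left = to-left
    ; to-right = to-right }
    where
    module A = Composite X Y
    module B = Composite X′ Y′
    module Q = Composite (X ⊗ X′) (Y ⊗ Y′)

    fwd₁ : V X ⊎ V Y → Q.Class
    fwd₁ = [ Q.in₁ ∘ inj₁ , Q.in₂ ∘ inj₁ ]′

    glue₁ : ∀ i → Q.in₁ (inj₁ (rightV X i)) ≡ Q.in₂ (inj₁ (leftV Y i))
    glue₁ i = trans (cong Q.in₁ (sym (copair-ˡ {n = n′} (inj₁ ∘ rightV X) (inj₂ ∘ rightV X′) i)))
      (trans (Q.⟦⟧-glue (i ↑ˡ n′)) (cong Q.in₂ (copair-ˡ (inj₁ ∘ leftV Y) (inj₂ ∘ leftV Y′) i)))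

    fwd₂ : V X′ ⊎ V Y′ → Q.Class
    fwd₂ = [ Q.in₁ ∘ inj₂ , Q.in₂ ∘ inj₂ ]′

    glue₂ : ∀ i → Q.in₁ (inj₂ (rightV X′ i)) ≡ Q.in₂ (inj₂ (leftV Y′ i))
    glue₂ i = trans (cong Q.in₁ (sym (copair-ʳ {m = n} (inj₁ ∘ rightV X) (inj₂ ∘ rightV X′) i)))
      (trans (Q.⟦⟧-glue (n ↑ʳ i)) (cong Q.in₂ (copair-ʳ (inj₁ ∘ leftV Y) (inj₂ ∘ leftV Y′) i)))

    vTo : A.Class ⊎ B.Class → Q.Class
    vTo = [ A.rec fwd₁ , B.rec fwd₂ ]′

    bwd : (V X ⊎ V X′) ⊎ (V Y ⊎ V Y′) → A.Class ⊎ B.Class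
    bwd = [ Sum.map A.in₁ B.in₁ , Sum.map A.in₂ B.in₂ ]′

    bwd-glue : ∀ i → Sum.map A.in₁ B.in₁ (rightV (X ⊗ X′) i) ≡ Sum.map A.in₂ B.in₂ (leftV (Y ⊗ Y′) i)
    bwd-glue i with splitAt n i
    ... | inj₁ a = cong inj₁ (A.⟦⟧-glue a)
    ... | inj₂ b = cong inj₂ (B.⟦⟧-glue b)

    to-left : ∀ i → vTo (leftV ((X ⨾ Y) ⊗ (X′ ⨾ Y′)) i) ≡ leftV ((X ⊗ X′) ⨾ (Y ⊗ Y′)) i
    to-left i with splitAt m i
    ... | inj₁ _ = A.rec-β fwd₁ glue₁ _
    ... | inj₂ _ = B.rec-β fwd₂ glue₂ _

    to-right : ∀ i → vTo (rightV ((X ⨾ Y) ⊗ (X′ ⨾ Y′)) i) ≡ rightV ((X ⊗ X′) ⨾ (Y ⊗ Y′)) i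
    to-right i with splitAt p i
    ... | inj₁ _ = A.rec-β fwd₁ glue₁ _
    ... | inj₂ _ = B.rec-β fwd₂ glue₂ _

  withLegs : ∀ {m n m′ n′} (X : Cospan m n) → D m′ ⇒ₗ apex X → D n′ ⇒ₗ apex X → Cospan m′ n′
  withLegs X f g = record { apex = apex X ; finite = finite X ; left = f ; right = g }

  legs≈ : ∀ {m n m′ n′} (X : Cospan m n) {f f′ : D m′ ⇒ₗ apex X} {g g′ : D n′ ⇒ₗ apex X} →
          (∀ i → mapV f i ≡ mapV f′ i) → (∀ i → mapV g i ≡ mapV g′ i) →
          withLegs X f g ≈ withLegs X f′ g′
  legs≈ X {f} {f′} {g} {g′} p q = mkIso {X = withLegs X f g} {withLegs X f′ g′} record
    { vTo = λ v → v ; vFrom = λ v → v ; v-tf = λ _ → refl ; v-ft = λ _ → refl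
    ; eTo = λ e → e ; eFrom = λ e → e ; e-tf = λ _ → refl ; e-ft = λ _ → refl
    ; to-s = λ _ _ → refl ; to-t = λ _ _ → refl ; to-l = λ _ → refl
    ; to-left = p ; to-right = q }

  perm-cong : ∀ {m n} {r r′ : D n ⇒ₗ D m} → (∀ i → mapV r i ≡ mapV r′ i) → perm r ≈ perm r′
  perm-cong {m} {r = r} {r′} p = legs≈ (identity m) {g = r} {r′} (λ _ → refl) p

  reindexʳ : ∀ {m n p} (X : Cospan m n) (r : D p ⇒ₗ D n) →
             X ⨾ perm r ≈ withLegs X (left X) (right X ∘ₗ r)
  reindexʳ {n = n} X r = mkIso record
    { vTo = Q.rec fwd ; vFrom = Q.in₁
    ; v-tf = λ x → β (inj₁ x)
    ; v-ft = Q.elim _ λ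
        { (inj₁ x) → cong Q.in₁ (β (inj₁ x))
        ; (inj₂ j) → trans (cong Q.in₁ (β (inj₂ j))) (Q.⟦⟧-glue j) }
    ; eTo = λ { (inj₁ e) → e } ; eFrom = inj₁
    ; e-tf = λ _ → refl ; e-ft = λ { (inj₁ _) → refl }
    ; to-s = λ { (inj₁ e) i → β (inj₁ (s X e i)) }
    ; to-t = λ { (inj₁ e) i → β (inj₁ (t X e i)) }
    ; to-l = λ { (inj₁ _) → refl }
    ; to-left = λ i → β (inj₁ (leftV X i))
    ; to-right = λ i → β (inj₂ (mapV r i)) }
    where
    module Q = Composite X (perm r)

    fwd : V X ⊎ Fin n → V X
    fwd = [ (λ v → v) , rightV X ]′

    β : ∀ a → Q.rec fwd Q.⟦ a ⟧ ≡ fwd a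
    β = Q.rec-β fwd (λ _ → refl)

  reindexˡ : ∀ {m n p} (r : D n ⇒ₗ D m) (r⁻¹ : D m ⇒ₗ D n) →
             (∀ i → mapV r (mapV r⁻¹ i) ≡ i) → (∀ i → mapV r⁻¹ (mapV r i) ≡ i) →
             (Y : Cospan n p) → perm r ⨾ Y ≈ withLegs Y (left Y ∘ₗ r⁻¹) (right Y)
  reindexˡ {m} r r⁻¹ rr⁻¹ r⁻¹r Y = mkIso record
    { vTo = Q.rec fwd ; vFrom = Q.in₂
    ; v-tf = λ y → β (inj₂ y)
    ; v-ft = Q.elim _ λ
        { (inj₁ i) → trans (cong Q.in₂ (β (inj₁ i)))
            (trans (sym (Q.⟦⟧-glue (mapV r⁻¹ i))) (cong Q.in₁ (rr⁻¹ i)))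
        ; (inj₂ y) → cong Q.in₂ (β (inj₂ y)) }
    ; eTo = λ { (inj₂ e) → e } ; eFrom = inj₂
    ; e-tf = λ _ → refl ; e-ft = λ { (inj₂ _) → refl }
    ; to-s = λ { (inj₂ e) i → β (inj₂ (s Y e i)) }
    ; to-t = λ { (inj₂ e) i → β (inj₂ (t Y e i)) }
    ; to-l = λ { (inj₂ _) → refl }
    ; to-left = λ i → β (inj₁ i)
    ; to-right = λ i → β (inj₂ (rightV Y i)) }
    where
    module Q = Composite (perm r) Y

    fwd : Fin m ⊎ V Y → V Y
    fwd = [ leftV Y ∘ mapV r⁻¹ , (λ v → v) ]′

    β : ∀ a → Q.rec fwd Q.⟦ a ⟧ ≡ fwd a
    β = Q.rec-β fwd (λ i → cong (leftV Y) (r⁻¹r i))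

  ⨾-identityʳ : ∀ {m n} (X : Cospan m n) → X ⨾ identity n ≈ X
  ⨾-identityʳ X = ≈-trans (reindexʳ X idₗ) (legs≈ X (λ _ → refl) (λ _ → refl))

  ⨾-identityˡ : ∀ {m n} (X : Cospan m n) → identity m ⨾ X ≈ X
  ⨾-identityˡ X = ≈-trans (reindexˡ idₗ idₗ (λ _ → refl) (λ _ → refl) X)
    (legs≈ X (λ _ → refl) (λ _ → refl))

  perm-⊗ : ∀ {m n m′ n′} (r : D n ⇒ₗ D m) (r′ : D n′ ⇒ₗ D m′) →
           perm r ⊗ perm r′ ≈
           perm (vertices (D (m + m′)) (copair n ((_↑ˡ m′) ∘ mapV r) ((m ↑ʳ_) ∘ mapV r′)))
  perm-⊗ {m} {n} {m′} r r′ = mkIso record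
    { vTo = Fin.join m m′ ; vFrom = splitAt m
    ; v-tf = join-splitAt m m′ ; v-ft = Finₚ.splitAt-join m m′
    ; eTo = λ { (inj₁ ()) ; (inj₂ ()) } ; eFrom = λ () ; e-tf = λ () ; e-ft = λ { (inj₁ ()) ; (inj₂ ()) }
    ; to-s = λ { (inj₁ ()) ; (inj₂ ()) } ; to-t = λ { (inj₁ ()) ; (inj₂ ()) }
    ; to-l = λ { (inj₁ ()) ; (inj₂ ()) }
    ; to-left = split-elim m _
        (λ i → cong (Fin.join m m′) (copair-ˡ inj₁ inj₂ i))
        (λ i → cong (Fin.join m m′) (copair-ʳ {m = m} inj₁ inj₂ i))
    ; to-right = to-right }
    where
    to-right : ∀ i → Fin.join m m′ (rightV (perm r ⊗ perm r′) i)
                   ≡ copair n ((_↑ˡ m′) ∘ mapV r) ((m ↑ʳ_) ∘ mapV r′) i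
    to-right i with splitAt n i
    ... | inj₁ _ = refl
    ... | inj₂ _ = refl

  ⊗-id : ∀ m n → identity m ⊗ identity n ≈ identity (m + n)
  ⊗-id m n = ≈-trans (perm-⊗ idₗ idₗ) (perm-cong {r′ = idₗ} (join-splitAt m n))

  castD : ∀ {m n} → .(m ≡ n) → D m ⇒ₗ D n
  castD {n = n} eq = vertices (D n) (Fin.cast eq)

  cast : ∀ {m m′ n n′} → m ≡ m′ → n ≡ n′ → Cospan m n → Cospan m′ n′
  cast = subst₂ Cospan

  cast≈ : ∀ {m m′ n n′} (p : m ≡ m′) (q : n ≡ n′) (X : Cospan m n) →
          cast p q X ≈ withLegs X (left X ∘ₗ castD (sym p)) (right X ∘ₗ castD (sym q))
  cast≈ refl refl X = legs≈ X
    (λ i → cong (leftV X) (sym (cast-is-id refl i))) (λ i → cong (rightV X) (sym (cast-is-id refl i)))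

  cast-perm : ∀ {m m′ n n′} (p : m ≡ m′) (q : n ≡ n′) (r : D n ⇒ₗ D m) →
              cast p q (perm r) ≈ perm (castD p ∘ₗ r ∘ₗ castD (sym q))
  cast-perm refl refl r = perm-cong
    (λ i → sym (trans (cast-is-id refl _) (cong (mapV r) (cast-is-id refl i))))

  cast-cong : ∀ {m m′ n n′} (p : m ≡ m′) (q : n ≡ n′) {X Y : Cospan m n} →
              X ≈ Y → cast p q X ≈ cast p q Y
  cast-cong refl refl p = p

  private
    module _ {m n o : ℕ} where
      cast-l : .(eq : (m + n) + o ≡ m + (n + o)) (a : Fin m) →
               Fin.cast eq ((a ↑ˡ n) ↑ˡ o) ≡ a ↑ˡ (n + o)
      cast-l eq a = toℕ-injective (trans (toℕ-cast eq _)
        (trans (toℕ-↑ˡ (a ↑ˡ n) o) (trans (toℕ-↑ˡ a n) (sym (toℕ-↑ˡ a (n + o))))))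

      cast-m : .(eq : (m + n) + o ≡ m + (n + o)) (b : Fin n) →
               Fin.cast eq ((m ↑ʳ b) ↑ˡ o) ≡ m ↑ʳ (b ↑ˡ o)
      cast-m eq b = toℕ-injective (trans (toℕ-cast eq _)
        (trans (toℕ-↑ˡ (m ↑ʳ b) o) (trans (toℕ-↑ʳ m b)
        (sym (trans (toℕ-↑ʳ m (b ↑ˡ o)) (cong (m +_) (toℕ-↑ˡ b o)))))))

      cast-r : .(eq : (m + n) + o ≡ m + (n + o)) (c : Fin o) →
               Fin.cast eq ((m + n) ↑ʳ c) ≡ m ↑ʳ (n ↑ʳ c)
      cast-r eq c = toℕ-injective (trans (toℕ-cast eq _)
        (trans (toℕ-↑ʳ (m + n) c) (trans (+-assoc m n _)
        (sym (trans (toℕ-↑ʳ m (n ↑ʳ c)) (cong (m +_) (toℕ-↑ʳ n c)))))))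

      cast-flip : .(eq : (m + n) + o ≡ m + (n + o)) .(eq′ : m + (n + o) ≡ (m + n) + o) →
                  ∀ {i j} → Fin.cast eq i ≡ j → Fin.cast eq′ j ≡ i
      cast-flip eq eq′ {i} p = trans (cong (Fin.cast eq′) (sym p)) (Finₚ.cast-involutive eq′ eq i)

  ⊗-identityˡ : ∀ {m n} (X : Cospan m n) → identity 0 ⊗ X ≈ X
  ⊗-identityˡ X = mkIso record
    { vTo = λ { (inj₂ v) → v } ; vFrom = inj₂ ; v-tf = λ _ → refl ; v-ft = λ { (inj₂ _) → refl }
    ; eTo = λ { (inj₂ e) → e } ; eFrom = inj₂ ; e-tf = λ _ → refl ; e-ft = λ { (inj₂ _) → refl }
    ; to-s = λ { (inj₂ _) _ → refl } ; to-t = λ { (inj₂ _) _ → refl } ; to-l = λ { (inj₂ _) → refl }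
    ; to-left = λ _ → refl ; to-right = λ _ → refl }

  ⊗-identityʳ : ∀ {m n} (X : Cospan m n) →
                cast (+-identityʳ m) (+-identityʳ n) (X ⊗ identity 0) ≈ X
  ⊗-identityʳ {m} {n} X = ≈-trans (cast≈ (+-identityʳ m) (+-identityʳ n) (X ⊗ identity 0)) (mkIso record
    { vTo = vTo ; vFrom = inj₁ ; v-tf = λ _ → refl ; v-ft = λ { (inj₁ _) → refl }
    ; eTo = λ { (inj₁ e) → e } ; eFrom = inj₁ ; e-tf = λ _ → refl ; e-ft = λ { (inj₁ _) → refl }
    ; to-s = λ { (inj₁ _) _ → refl } ; to-t = λ { (inj₁ _) _ → refl } ; to-l = λ { (inj₁ _) → refl }
    ; to-left = leg (+-identityʳ m) (leftV X) ; to-right = leg (+-identityʳ n) (rightV X) })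
    where
    vTo : V X ⊎ Fin 0 → V X
    vTo (inj₁ v) = v

    leg : ∀ {k} (eq : k + 0 ≡ k) (f : Fin k → V X) {g : Fin 0 → V X ⊎ Fin 0} i →
          vTo (copair k (inj₁ ∘ f) g (Fin.cast (sym eq) i)) ≡ f i
    leg eq f {g} i = trans
      (cong (vTo ∘ copair _ (inj₁ ∘ f) g) (toℕ-injective (trans (toℕ-cast (sym eq) i) (sym (toℕ-↑ˡ i 0)))))
      (cong vTo (copair-ˡ (inj₁ ∘ f) g i))

  ⊗-assoc : ∀ {m n p q r s} (X : Cospan m n) (Y : Cospan p q) (Z : Cospan r s) →
            cast (+-assoc m p r) (+-assoc n q s) ((X ⊗ Y) ⊗ Z) ≈ X ⊗ (Y ⊗ Z)
  ⊗-assoc {m} {n} {p} {q} {r} {s} X Y Z =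
    ≈-trans (cast≈ (+-assoc m p r) (+-assoc n q s) ((X ⊗ Y) ⊗ Z)) (mkIso record
    { vTo = assocʳ ; vFrom = assocˡ ; v-tf = ʳ-ˡ ; v-ft = ˡ-ʳ
    ; eTo = assocʳ ; eFrom = assocˡ ; e-tf = ʳ-ˡ ; e-ft = ˡ-ʳ
    ; to-s = λ { (inj₁ (inj₁ _)) _ → refl ; (inj₁ (inj₂ _)) _ → refl ; (inj₂ _) _ → refl }
    ; to-t = λ { (inj₁ (inj₁ _)) _ → refl ; (inj₁ (inj₂ _)) _ → refl ; (inj₂ _) _ → refl }
    ; to-l = λ { (inj₁ (inj₁ _)) → refl ; (inj₁ (inj₂ _)) → refl ; (inj₂ _) → refl }
    ; to-left  = leg m p (+-assoc m p r) (leftV X) (leftV Y) (leftV Z)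
    ; to-right = leg n q (+-assoc n q s) (rightV X) (rightV Y) (rightV Z) })
    where
    ʳ-ˡ : ∀ {A B C : Set} (x : A ⊎ (B ⊎ C)) → assocʳ (assocˡ x) ≡ x
    ʳ-ˡ (inj₁ _) = refl
    ʳ-ˡ (inj₂ (inj₁ _)) = refl
    ʳ-ˡ (inj₂ (inj₂ _)) = refl

    ˡ-ʳ : ∀ {A B C : Set} (x : (A ⊎ B) ⊎ C) → assocˡ (assocʳ x) ≡ x
    ˡ-ʳ (inj₁ (inj₁ _)) = refl
    ˡ-ʳ (inj₁ (inj₂ _)) = refl
    ˡ-ʳ (inj₂ _) = refl

    leg : ∀ {A B C : Set} a b {c} (eq : (a + b) + c ≡ a + (b + c))
          (f : Fin a → A) (g : Fin b → B) (h : Fin c → C) i →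
          assocʳ (copair (a + b) (inj₁ ∘ copair a (inj₁ ∘ f) (inj₂ ∘ g)) (inj₂ ∘ h) (Fin.cast (sym eq) i))
          ≡ copair a (inj₁ ∘ f) (inj₂ ∘ copair b (inj₁ ∘ g) (inj₂ ∘ h)) i
    leg {A} {B} {C} a b {c} eq f g h = split-elim a _
      (λ i → trans (cong (assocʳ ∘ fgh) (cast-flip {a} {b} {c} eq (sym eq) (cast-l {a} {b} {c} eq i)))
        (trans (cong assocʳ (trans (copair-ˡ (inj₁ ∘ fg) (inj₂ ∘ h) (i ↑ˡ b)) (cong inj₁ (copair-ˡ (inj₁ ∘ f) (inj₂ ∘ g) i))))
        (sym (copair-ˡ (inj₁ ∘ f) (inj₂ ∘ gh) i))))
      (split-elim b _
        (λ j → trans (cong (assocʳ ∘ fgh) (cast-flip {a} {b} {c} eq (sym eq) (cast-m {a} {b} {c} eq j)))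
          (trans (cong assocʳ (trans (copair-ˡ (inj₁ ∘ fg) (inj₂ ∘ h) (a ↑ʳ j)) (cong inj₁ (copair-ʳ (inj₁ ∘ f) (inj₂ ∘ g) j))))
          (sym (trans (copair-ʳ (inj₁ ∘ f) (inj₂ ∘ gh) (j ↑ˡ c)) (cong inj₂ (copair-ˡ (inj₁ ∘ g) (inj₂ ∘ h) j))))))
        (λ k → trans (cong (assocʳ ∘ fgh) (cast-flip {a} {b} {c} eq (sym eq) (cast-r {a} {b} {c} eq k)))
          (trans (cong assocʳ (copair-ʳ (inj₁ ∘ fg) (inj₂ ∘ h) k))
          (sym (trans (copair-ʳ (inj₁ ∘ f) (inj₂ ∘ gh) (b ↑ʳ k)) (cong inj₂ (copair-ʳ (inj₁ ∘ g) (inj₂ ∘ h) k)))))))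
      where
      fg : Fin (a + b) → A ⊎ B
      fg = copair a (inj₁ ∘ f) (inj₂ ∘ g)
      gh : Fin (b + c) → B ⊎ C
      gh = copair b (inj₁ ∘ g) (inj₂ ∘ h)
      fgh : Fin ((a + b) + c) → (A ⊎ B) ⊎ C
      fgh = copair (a + b) (inj₁ ∘ fg) (inj₂ ∘ h)

  swapFin-↑ˡ : ∀ m n (i : Fin m) → swapFin m n (i ↑ˡ n) ≡ n ↑ʳ i
  swapFin-↑ˡ m n i = copair-ˡ (n ↑ʳ_) (_↑ˡ m) i

  swapFin-↑ʳ : ∀ m n (j : Fin n) → swapFin m n (m ↑ʳ j) ≡ j ↑ˡ m
  swapFin-↑ʳ m n j = copair-ʳ (n ↑ʳ_) (_↑ˡ m) j

  swapFin-involutive : ∀ m n i → swapFin n m (swapFin m n i) ≡ i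
  swapFin-involutive m n = split-elim m _
    (λ i → trans (cong (swapFin n m) (swapFin-↑ˡ m n i)) (swapFin-↑ʳ n m i))
    (λ j → trans (cong (swapFin n m) (swapFin-↑ʳ m n j)) (swapFin-↑ˡ n m j))

  swapD : ∀ m n → D (m + n) ⇒ₗ D (n + m)
  swapD m n = vertices (D (n + m)) (swapFin m n)

  σ-involutive : ∀ m n → symmetry m n ⨾ symmetry n m ≈ identity (m + n)
  σ-involutive m n = ≈-trans (reindexʳ (symmetry m n) (swapD m n))
    (perm-cong {r′ = idₗ} (swapFin-involutive m n))

  σ-natural : ∀ {m n p q} (X : Cospan m n) (Y : Cospan p q) →
              (X ⊗ Y) ⨾ symmetry n q ≈ symmetry m p ⨾ (Y ⊗ X)
  σ-natural {m} {n} {p} {q} X Y =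
    ≈-trans (reindexʳ (X ⊗ Y) (swapD q n))
    (≈-trans (mkIso swapped)
    (≈-sym (reindexˡ (swapD p m) (swapD m p) (swapFin-involutive m p) (swapFin-involutive p m) (Y ⊗ X))))
    where
    legs : ∀ {A B : Set} a {b} (f : Fin a → A) (g : Fin b → B) i →
           swap (copair a (inj₁ ∘ f) (inj₂ ∘ g) i) ≡ copair b (inj₁ ∘ g) (inj₂ ∘ f) (swapFin a b i)
    legs a {b} f g = split-elim a _
      (λ i → trans (cong swap (copair-ˡ (inj₁ ∘ f) (inj₂ ∘ g) i))
        (sym (trans (cong (copair b (inj₁ ∘ g) (inj₂ ∘ f)) (swapFin-↑ˡ a b i)) (copair-ʳ (inj₁ ∘ g) (inj₂ ∘ f) i))))
      (λ j → trans (cong swap (copair-ʳ (inj₁ ∘ f) (inj₂ ∘ g) j))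
        (sym (trans (cong (copair b (inj₁ ∘ g) (inj₂ ∘ f)) (swapFin-↑ʳ a b j)) (copair-ˡ (inj₁ ∘ g) (inj₂ ∘ f) j))))

    swapped : Iso (withLegs (X ⊗ Y) (left (X ⊗ Y)) (right (X ⊗ Y) ∘ₗ swapD q n))
                  (withLegs (Y ⊗ X) (left (Y ⊗ X) ∘ₗ swapD m p) (right (Y ⊗ X)))
    swapped = record
      { vTo = swap ; vFrom = swap ; v-tf = Sumₚ.swap-involutive ; v-ft = Sumₚ.swap-involutive
      ; eTo = swap ; eFrom = swap ; e-tf = Sumₚ.swap-involutive ; e-ft = Sumₚ.swap-involutive
      ; to-s = λ { (inj₁ _) _ → refl ; (inj₂ _) _ → refl }
      ; to-t = λ { (inj₁ _) _ → refl ; (inj₂ _) _ → refl }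
      ; to-l = λ { (inj₁ _) → refl ; (inj₂ _) → refl }
      ; to-left = legs m (leftV X) (leftV Y)
      ; to-right = λ i → trans (legs n (rightV X) (rightV Y) (swapFin q n i))
          (cong (copair q (inj₁ ∘ rightV Y) (inj₂ ∘ rightV X)) (swapFin-involutive q n i)) }

  σ-hexagon : ∀ m n p →
              cast (+-assoc m n p) (sym (+-assoc n p m))
                ((symmetry m n ⊗ identity p) ⨾
                 cast (sym (+-assoc n m p)) refl (identity n ⊗ symmetry m p))
              ≈ symmetry m (n + p)
  σ-hexagon m n p =
    ≈-trans (cast-cong (+-assoc m n p) (sym (+-assoc n p m))
      (≈-trans (⨾-cong (perm-⊗ (swapD n m) idₗ)
        (≈-trans (cast-cong (sym (+-assoc n m p)) refl (perm-⊗ idₗ (swapD p m)))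
          (cast-perm (sym (+-assoc n m p)) refl (vertices _ r₂))))
        (reindexʳ (perm (vertices _ r₁)) R′)))
    (≈-trans (cast-perm (+-assoc m n p) (sym (+-assoc n p m)) R)
    (perm-cong (split-elim (n + p) _ (split-elim n _ left-l left-r) right-c)))
    where
    r₁ : Fin ((n + m) + p) → Fin ((m + n) + p)
    r₁ = copair (n + m) ((_↑ˡ p) ∘ swapFin n m) ((m + n) ↑ʳ_)

    r₂ : Fin (n + (p + m)) → Fin (n + (m + p))
    r₂ = copair n (_↑ˡ (m + p)) ((n ↑ʳ_) ∘ swapFin p m)

    c₁ : Fin (n + (p + m)) → Fin (n + (p + m))
    c₁ = Fin.cast refl

    c₂ : Fin (n + (m + p)) → Fin ((n + m) + p)
    c₂ = Fin.cast (sym (+-assoc n m p))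

    c₃ : Fin ((n + p) + m) → Fin (n + (p + m))
    c₃ = Fin.cast (sym (sym (+-assoc n p m)))

    c₄ : Fin ((m + n) + p) → Fin (m + (n + p))
    c₄ = Fin.cast (+-assoc m n p)

    ω : Fin ((n + p) + m) → Fin (m + (n + p))
    ω = swapFin (n + p) m

    R′ : D (n + (p + m)) ⇒ₗ D ((n + m) + p)
    R′ = castD (sym (+-assoc n m p)) ∘ₗ vertices (D (n + (m + p))) r₂ ∘ₗ castD refl

    R : D (n + (p + m)) ⇒ₗ D ((m + n) + p)
    R = vertices (D ((m + n) + p)) r₁ ∘ₗ R′

    chain : ∀ {i j k l x y} → c₃ i ≡ j → r₂ j ≡ k → c₂ k ≡ l → r₁ l ≡ x → c₄ x ≡ y →
            c₄ (r₁ (c₂ (r₂ (c₁ (c₃ i))))) ≡ y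
    chain refl refl refl refl refl = cong (c₄ ∘ r₁ ∘ c₂ ∘ r₂) (cast-is-id refl _)

    left-l : ∀ a → c₄ (r₁ (c₂ (r₂ (c₁ (c₃ ((a ↑ˡ p) ↑ˡ m)))))) ≡ ω ((a ↑ˡ p) ↑ˡ m)
    left-l a = trans
      (chain (cast-l {n} {p} {m} (+-assoc n p m) a)
        (copair-ˡ (_↑ˡ (m + p)) ((n ↑ʳ_) ∘ swapFin p m) a)
        (cast-flip {n} {m} {p} (+-assoc n m p) (sym (+-assoc n m p)) (cast-l {n} {m} {p} (+-assoc n m p) a))
        (trans (copair-ˡ ((_↑ˡ p) ∘ swapFin n m) ((m + n) ↑ʳ_) (a ↑ˡ m)) (cong (_↑ˡ p) (swapFin-↑ˡ n m a)))
        (cast-m {m} {n} {p} (+-assoc m n p) a))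
      (sym (swapFin-↑ˡ (n + p) m (a ↑ˡ p)))

    left-r : ∀ b → c₄ (r₁ (c₂ (r₂ (c₁ (c₃ ((n ↑ʳ b) ↑ˡ m)))))) ≡ ω ((n ↑ʳ b) ↑ˡ m)
    left-r b = trans
      (chain (cast-m {n} {p} {m} (+-assoc n p m) b)
        (trans (copair-ʳ {m = n} (_↑ˡ (m + p)) ((n ↑ʳ_) ∘ swapFin p m) (b ↑ˡ m)) (cong (n ↑ʳ_) (swapFin-↑ˡ p m b)))
        (cast-flip {n} {m} {p} (+-assoc n m p) (sym (+-assoc n m p)) (cast-r {n} {m} {p} (+-assoc n m p) b))
        (copair-ʳ ((_↑ˡ p) ∘ swapFin n m) ((m + n) ↑ʳ_) b)
        (cast-r {m} {n} {p} (+-assoc m n p) b))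
      (sym (swapFin-↑ˡ (n + p) m (n ↑ʳ b)))

    right-c : ∀ c → c₄ (r₁ (c₂ (r₂ (c₁ (c₃ ((n + p) ↑ʳ c)))))) ≡ ω ((n + p) ↑ʳ c)
    right-c c = trans
      (chain (cast-r {n} {p} {m} (+-assoc n p m) c)
        (trans (copair-ʳ {m = n} (_↑ˡ (m + p)) ((n ↑ʳ_) ∘ swapFin p m) (p ↑ʳ c)) (cong (n ↑ʳ_) (swapFin-↑ʳ p m c)))
        (cast-flip {n} {m} {p} (+-assoc n m p) (sym (+-assoc n m p)) (cast-m {n} {m} {p} (+-assoc n m p) c))
        (trans (copair-ˡ ((_↑ˡ p) ∘ swapFin n m) ((m + n) ↑ʳ_) (n ↑ʳ c)) (cong (_↑ˡ p) (swapFin-↑ʳ n m c)))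
        (cast-l {m} {n} {p} (+-assoc m n p) c))
      (sym (swapFin-↑ʳ (n + p) m c))

Csp : Generators → PROP (lsuc 0ℓ) 0ℓ
Csp 𝓢 = record
  { Hom = Cospan ; _≈_ = _≈_ ; id = identity ; _⨾_ = _⨾_ ; _⊗_ = _⊗_ ; σ = symmetry
  ; isEquivalence = record { refl = ≈-refl ; sym = ≈-sym ; trans = ≈-trans }
  ; ⨾-cong = ⨾-cong ; ⨾-identityˡ = ⨾-identityˡ ; ⨾-identityʳ = ⨾-identityʳ ; ⨾-assoc = ⨾-assoc
  ; ⊗-cong = ⊗-cong ; ⊗-id = ⊗-id ; ⊗-⨾ = ⊗-⨾
  ; ⊗-identityˡ = ⊗-identityˡ ; ⊗-identityʳ = ⊗-identityʳ ; ⊗-assoc = ⊗-assoc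
  ; σ-natural = σ-natural ; σ-involutive = σ-involutive ; σ-hexagon = σ-hexagon }
  where open Cospans 𝓢

module _ {𝓢 : Generators} where
  open Labelled 𝓢
  open Cospans 𝓢
  open Cospan

  module _ {m n} (X : Cospan m n) where
    _∈in : V X → Set
    v ∈in = ∃ λ i → leftV X i ≡ v

    _∈out : V X → Set
    v ∈out = ∃ λ j → rightV X j ≡ v

    record PartialMonogamous : Set₁ where
      field
        left-mono  : Mono (left X)
        right-mono : Mono (right X)
        in-out     : ∀ {v} → v ∈in → v ∈out → HasDegree X v (0 , 0)
        in-only    : ∀ {v} → v ∈in → ¬ v ∈out → HasDegree X v (0 , 1)
        out-only   : ∀ {v} → ¬ v ∈in → v ∈out → HasDegree X v (1 , 0)
        internal   : ∀ {v} → ¬ v ∈in → ¬ v ∈out →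
                     HasDegree X v (0 , 0) ⊎ HasDegree X v (1 , 1)
  open PartialMonogamous

  private
    Inj : ∀ {A B : Set} → (A → B) → Set
    Inj f = ∀ {x y} → f x ≡ f y → x ≡ y

    mono⇒inj : ∀ {m F} (f : D m ⇒ₗ F) → Mono f → Inj (mapV f)
    mono⇒inj {m} f mono {x} {y} eq = V≡ (mono {D 1} (vertices (D m) (λ _ → x)) (vertices (D m) (λ _ → y))
      ((λ _ → eq) , (λ ()))) zero

    inj⇒mono : ∀ {m F} (f : D m ⇒ₗ F) → Inj (mapV f) → Mono f
    inj⇒mono f inj a b p = (λ v → inj (V≡ p v)) , (λ e → ⊥-elim (mapE a e))

    Fib : ∀ {A B : Set} → (A → B) → B → Set
    Fib {A} f b = Σ[ a ∈ A ] f a ≡ b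

    fib≡ : ∀ {A B : Set} {f : A → B} {b} {x y : Fib f b} → proj₁ x ≡ proj₁ y → x ≡ y
    fib≡ {x = _ , p} {_ , q} refl = cong (_ ,_) (≡-irrelevant p q)

    empty : ∀ {A : Set} → (A → ⊥) → A ↔ Fin 0
    empty ¬a = mk↔ₛ′ (λ a → ⊥-elim (¬a a)) (λ ()) (λ ()) (λ a → ⊥-elim (¬a a))

    -- The fibres of a map into a set covered by two pieces, whose domain
    -- is split accordingly.
    module Split {A B C V₁ V₂ W : Set} (f : A → V₁) (g : B → V₂) (h : C → W)
                 (j₁ : V₁ → W) (j₂ : V₂ → W) (C↔ : C ↔ (A ⊎ B))
                 (h₁ : ∀ a → h (Inverse.from C↔ (inj₁ a)) ≡ j₁ (f a))
                 (h₂ : ∀ b → h (Inverse.from C↔ (inj₂ b)) ≡ j₂ (g b)) where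
      open Inverse C↔ using (to; from; strictlyInverseˡ; strictlyInverseʳ)

      split : ∀ w → Fib h w ↔ (Fib (j₁ ∘ f) w ⊎ Fib (j₂ ∘ g) w)
      split w = mk↔ₛ′ to′ from′ to-from from-to
        where
        bwd : ∀ c x → to c ≡ x → from x ≡ c
        bwd c x eq = trans (cong from (sym eq)) (strictlyInverseʳ c)

        go : ∀ c → h c ≡ w → (x : A ⊎ B) → from x ≡ c → Fib (j₁ ∘ f) w ⊎ Fib (j₂ ∘ g) w
        go c p (inj₁ a) eq = inj₁ (a , trans (sym (h₁ a)) (trans (cong h eq) p))
        go c p (inj₂ b) eq = inj₂ (b , trans (sym (h₂ b)) (trans (cong h eq) p))

        to′ : Fib h w → Fib (j₁ ∘ f) w ⊎ Fib (j₂ ∘ g) w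
        to′ (c , p) = go c p (to c) (strictlyInverseʳ c)

        from′ : Fib (j₁ ∘ f) w ⊎ Fib (j₂ ∘ g) w → Fib h w
        from′ (inj₁ (a , p)) = from (inj₁ a) , trans (h₁ a) p
        from′ (inj₂ (b , p)) = from (inj₂ b) , trans (h₂ b) p

        go-irr : ∀ c p x eq y → x ≡ y → (q : Fib (j₁ ∘ f) w ⊎ Fib (j₂ ∘ g) w) →
                 y ≡ Sum.map proj₁ proj₁ q → go c p x eq ≡ q
        go-irr c p (inj₁ a) eq _ refl (inj₁ (a′ , _)) refl = cong inj₁ (fib≡ refl)
        go-irr c p (inj₂ b) eq _ refl (inj₂ (b′ , _)) refl = cong inj₂ (fib≡ refl)

        to-from : ∀ q → to′ (from′ q) ≡ q
        to-from (inj₁ (a , p)) = go-irr _ _ _ _ _ (strictlyInverseˡ (inj₁ a)) (inj₁ (a , p)) refl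
        to-from (inj₂ (b , p)) = go-irr _ _ _ _ _ (strictlyInverseˡ (inj₂ b)) (inj₂ (b , p)) refl

        from-go : ∀ c p x eq → from′ (go c p x eq) ≡ (c , p)
        from-go c p (inj₁ a) eq = fib≡ eq
        from-go c p (inj₂ b) eq = fib≡ eq

        from-to : ∀ x → from′ (to′ x) ≡ x
        from-to (c , p) = from-go c p (to c) (strictlyInverseʳ c)

    -- The fibre of j ∘ f over w when x is the only point of j over w,
    -- and when there is none.
    fib-one : ∀ {A V₁ W : Set} (f : A → V₁) (j : V₁ → W) {w x} → j x ≡ w →
              (∀ y → j y ≡ w → y ≡ x) → Fib (j ∘ f) w ↔ Fib f x
    fib-one f j jx only = mk↔ₛ′
      (λ { (a , p) → a , only (f a) p })
      (λ { (a , p) → a , trans (cong j p) jx })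
      (λ _ → fib≡ refl) (λ _ → fib≡ refl)

    fib-none : ∀ {A V₁ W : Set} (f : A → V₁) (j : V₁ → W) {w} →
               (∀ y → ¬ j y ≡ w) → Fib (j ∘ f) w ↔ Fin 0
    fib-none f j none = empty (λ { (a , p) → none (f a) p })

    sum↔ : ∀ {A B : Set} i {j} → A ↔ Fin i → B ↔ Fin j → (A ⊎ B) ↔ Fin (i + j)
    sum↔ i p q = ↔-sym +↔⊎ ↔-∘ (p ⊎-↔ q)

    tentacles-⊎ : (P : ℕ → ℕ → ℕ) (E₁ E₂ : ℕ → ℕ → Set) →
      (Σ[ k ∈ ℕ ] Σ[ l ∈ ℕ ] ((E₁ k l ⊎ E₂ k l) × Fin (P k l))) ↔
      ((Σ[ k ∈ ℕ ] Σ[ l ∈ ℕ ] (E₁ k l × Fin (P k l))) ⊎ (Σ[ k ∈ ℕ ] Σ[ l ∈ ℕ ] (E₂ k l × Fin (P k l))))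
    tentacles-⊎ P E₁ E₂ = mk↔ₛ′
      (λ { (k , l , inj₁ e , i) → inj₁ (k , l , e , i) ; (k , l , inj₂ e , i) → inj₂ (k , l , e , i) })
      (λ { (inj₁ (k , l , e , i)) → k , l , inj₁ e , i ; (inj₂ (k , l , e , i)) → k , l , inj₂ e , i })
      (λ { (inj₁ _) → refl ; (inj₂ _) → refl })
      (λ { (_ , _ , inj₁ _ , _) → refl ; (_ , _ , inj₂ _ , _) → refl })

    arityˡ arityʳ : ℕ → ℕ → ℕ
    arityˡ k l = k
    arityʳ k l = l

    -- Degrees in a hypergraph H covered by F and G, with disjoint edges.
    module Cover (F G H : Hypergraph)
      (j₁ : Hypergraph.V F → Hypergraph.V H) (j₂ : Hypergraph.V G → Hypergraph.V H)
      (T : Hypergraph.TargetTentacle H ↔ (Hypergraph.TargetTentacle F ⊎ Hypergraph.TargetTentacle G))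
      (T₁ : ∀ a → Hypergraph.targetOf H (Inverse.from T (inj₁ a)) ≡ j₁ (Hypergraph.targetOf F a))
      (T₂ : ∀ a → Hypergraph.targetOf H (Inverse.from T (inj₂ a)) ≡ j₂ (Hypergraph.targetOf G a))
      (S : Hypergraph.SourceTentacle H ↔ (Hypergraph.SourceTentacle F ⊎ Hypergraph.SourceTentacle G))
      (S₁ : ∀ a → Hypergraph.sourceOf H (Inverse.from S (inj₁ a)) ≡ j₁ (Hypergraph.sourceOf F a))
      (S₂ : ∀ a → Hypergraph.sourceOf H (Inverse.from S (inj₂ a)) ≡ j₂ (Hypergraph.sourceOf G a))
      where
      private
        module F = Hypergraph F
        module G = Hypergraph G
        module H = Hypergraph H
        module TS = Split F.targetOf G.targetOf H.targetOf j₁ j₂ T T₁ T₂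
        module SS = Split F.sourceOf G.sourceOf H.sourceOf j₁ j₂ S S₁ S₂

      only₁ : ∀ {w x d} → j₁ x ≡ w → (∀ y → j₁ y ≡ w → y ≡ x) → (∀ y → ¬ j₂ y ≡ w) →
              F.HasDegree x d → H.HasDegree w d
      only₁ {w} {x} {i , o} jx one none (p , q) =
        ↔-+0 i (sum↔ i (p ↔-∘ fib-one F.targetOf j₁ jx one) (fib-none G.targetOf j₂ none) ↔-∘ TS.split w) ,
        ↔-+0 o (sum↔ o (q ↔-∘ fib-one F.sourceOf j₁ jx one) (fib-none G.sourceOf j₂ none) ↔-∘ SS.split w)
        where
        ↔-+0 : ∀ {A : Set} i → A ↔ Fin (i + 0) → A ↔ Fin i
        ↔-+0 {A} i = subst (λ k → A ↔ Fin k) (+-identityʳ i)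

      only₂ : ∀ {w y d} → j₂ y ≡ w → (∀ z → j₂ z ≡ w → z ≡ y) → (∀ x → ¬ j₁ x ≡ w) →
              G.HasDegree y d → H.HasDegree w d
      only₂ {w} jy one none (p , q) =
        sum↔ 0 (fib-none F.targetOf j₁ none) (p ↔-∘ fib-one G.targetOf j₂ jy one) ↔-∘ TS.split w ,
        sum↔ 0 (fib-none F.sourceOf j₁ none) (q ↔-∘ fib-one G.sourceOf j₂ jy one) ↔-∘ SS.split w

      both : ∀ {w x y i o i′ o′} → j₁ x ≡ w → (∀ z → j₁ z ≡ w → z ≡ x) →
             j₂ y ≡ w → (∀ z → j₂ z ≡ w → z ≡ y) →
             F.HasDegree x (i , o) → G.HasDegree y (i′ , o′) → H.HasDegree w (i + i′ , o + o′)
      both {w} {i = i} {o} jx one₁ jy one₂ (p , q) (p′ , q′) =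
        sum↔ i (p ↔-∘ fib-one F.targetOf j₁ jx one₁) (p′ ↔-∘ fib-one G.targetOf j₂ jy one₂) ↔-∘ TS.split w ,
        sum↔ o (q ↔-∘ fib-one F.sourceOf j₁ jx one₁) (q′ ↔-∘ fib-one G.sourceOf j₂ jy one₂) ↔-∘ SS.split w

    no-edges : ∀ {m n} {r : D n ⇒ₗ D m} {v} → HasDegree (perm r) v (0 , 0)
    no-edges = empty (λ { ((_ , _ , () , _) , _) }) , empty (λ { ((_ , _ , () , _) , _) })

    perm-pm : ∀ {m n} (r : D n ⇒ₗ D m) → Inj (mapV r) → (∀ v → ∃ λ i → mapV r i ≡ v) →
              PartialMonogamous (perm r)
    perm-pm r inj surj = record
      { left-mono = inj⇒mono idₗ (λ p → p)
      ; right-mono = inj⇒mono r inj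
      ; in-out   = λ {v} _ _ → no-edges {r = r} {v}
      ; in-only  = λ {v} _ ∉out → ⊥-elim (∉out (surj v))
      ; out-only = λ {v} ∉in _ → ⊥-elim (∉in (v , refl))
      ; internal = λ {v} ∉in _ → ⊥-elim (∉in (v , refl)) }

    copair-inj : ∀ {m n} {A B : Set} (f : Fin m → A) (g : Fin n → B) → Inj f → Inj g →
                 Inj (copair m {n} (inj₁ ∘ f) (inj₂ ∘ g))
    copair-inj {m} {n} f g injf injg {x} {y} eq =
      trans (sym (join-splitAt m n x)) (trans (cong (Fin.join m n) (go (splitAt m x) (splitAt m y) eq)) (join-splitAt m n y))
      where
      go : ∀ a b → [ inj₁ ∘ f , inj₂ ∘ g ]′ a ≡ [ inj₁ ∘ f , inj₂ ∘ g ]′ b → a ≡ b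
      go (inj₁ a) (inj₁ b) p = cong inj₁ (injf (Sumₚ.inj₁-injective p))
      go (inj₂ a) (inj₂ b) p = cong inj₂ (injg (Sumₚ.inj₂-injective p))
      go (inj₁ a) (inj₂ b) ()
      go (inj₂ a) (inj₁ b) ()

  module Tensor {m n p q} (X : Cospan m n) (Y : Cospan p q)
                (pX : PartialMonogamous X) (pY : PartialMonogamous Y) where
    private
      module C = Cover (LHyp.graph (apex X)) (LHyp.graph (apex Y)) (LHyp.graph (apex (X ⊗ Y)))
        inj₁ inj₂
        (tentacles-⊎ arityʳ (E X) (E Y)) (λ _ → refl) (λ _ → refl)
        (tentacles-⊎ arityˡ (E X) (E Y)) (λ _ → refl) (λ _ → refl)

      deg₁ : ∀ {x d} → HasDegree X x d → HasDegree (X ⊗ Y) (inj₁ x) d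
      deg₁ = C.only₁ refl (λ _ → Sumₚ.inj₁-injective) (λ _ ())

      deg₂ : ∀ {y d} → HasDegree Y y d → HasDegree (X ⊗ Y) (inj₂ y) d
      deg₂ = C.only₂ refl (λ _ → Sumₚ.inj₂-injective) (λ _ ())

      module Legs {A B : Set} {a b} (f : Fin a → A) (g : Fin b → B) where
        fg : Fin (a + b) → A ⊎ B
        fg = copair a (inj₁ ∘ f) (inj₂ ∘ g)

        to₁ : ∀ {x} → Fib fg (inj₁ x) → Fib f x
        to₁ (i , eq) with splitAt a i
        to₁ (i , refl) | inj₁ j = j , refl
        to₁ (i , ())   | inj₂ j

        to₂ : ∀ {y} → Fib fg (inj₂ y) → Fib g y
        to₂ (i , eq) with splitAt a i
        to₂ (i , ())   | inj₁ j
        to₂ (i , refl) | inj₂ j = j , refl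

        from₁ : ∀ {x} → Fib f x → Fib fg (inj₁ x)
        from₁ (j , eq) = j ↑ˡ b , trans (copair-ˡ (inj₁ ∘ f) (inj₂ ∘ g) j) (cong inj₁ eq)

        from₂ : ∀ {y} → Fib g y → Fib fg (inj₂ y)
        from₂ (j , eq) = a ↑ʳ j , trans (copair-ʳ (inj₁ ∘ f) (inj₂ ∘ g) j) (cong inj₂ eq)

      module I = Legs (leftV X) (leftV Y)
      module O = Legs (rightV X) (rightV Y)

    pm : PartialMonogamous (X ⊗ Y)
    pm = record
      { left-mono = inj⇒mono (left (X ⊗ Y))
          (copair-inj (leftV X) (leftV Y) (mono⇒inj (left X) (left-mono pX)) (mono⇒inj (left Y) (left-mono pY)))
      ; right-mono = inj⇒mono (right (X ⊗ Y))
          (copair-inj (rightV X) (rightV Y) (mono⇒inj (right X) (right-mono pX)) (mono⇒inj (right Y) (right-mono pY)))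
      ; in-out   = λ { {inj₁ x} a b → deg₁ (in-out pX (I.to₁ a) (O.to₁ b))
                     ; {inj₂ y} a b → deg₂ (in-out pY (I.to₂ a) (O.to₂ b)) }
      ; in-only  = λ { {inj₁ x} a b → deg₁ (in-only pX (I.to₁ a) (b ∘ O.from₁))
                     ; {inj₂ y} a b → deg₂ (in-only pY (I.to₂ a) (b ∘ O.from₂)) }
      ; out-only = λ { {inj₁ x} a b → deg₁ (out-only pX (a ∘ I.from₁) (O.to₁ b))
                     ; {inj₂ y} a b → deg₂ (out-only pY (a ∘ I.from₂) (O.to₂ b)) }
      ; internal = λ { {inj₁ x} a b → Sum.map deg₁ deg₁ (internal pX (a ∘ I.from₁) (b ∘ O.from₁))
                     ; {inj₂ y} a b → Sum.map deg₂ deg₂ (internal pY (a ∘ I.from₂) (b ∘ O.from₂)) } }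

  module Compose {m n p} (X : Cospan m n) (Y : Cospan n p)
                 (pX : PartialMonogamous X) (pY : PartialMonogamous Y) where
    private
      module Q = Composite X Y
      module C = Cover (LHyp.graph (apex X)) (LHyp.graph (apex Y)) (LHyp.graph (apex (X ⨾ Y)))
        Q.in₁ Q.in₂
        (tentacles-⊎ arityʳ (E X) (E Y)) (λ _ → refl) (λ _ → refl)
        (tentacles-⊎ arityˡ (E X) (E Y)) (λ _ → refl) (λ _ → refl)

      r-inj : Inj (rightV X)
      r-inj = mono⇒inj (right X) (right-mono pX)

      l-inj : Inj (leftV Y)
      l-inj = mono⇒inj (left Y) (left-mono pY)

      -- An explicit description of the equivalence relation generated by
      -- gluing along injections.
      data _∼_ : Rel (V X ⊎ V Y) 0ℓ where
        same : ∀ {a} → a ∼ a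
        lr   : ∀ {x y} i → rightV X i ≡ x → leftV Y i ≡ y → inj₁ x ∼ inj₂ y
        rl   : ∀ {x y} i → rightV X i ≡ x → leftV Y i ≡ y → inj₂ y ∼ inj₁ x

      ∼-sym : ∀ {a b} → a ∼ b → b ∼ a
      ∼-sym same = same
      ∼-sym (lr i p q) = rl i p q
      ∼-sym (rl i p q) = lr i p q

      ∼-trans : ∀ {a b c} → a ∼ b → b ∼ c → a ∼ c
      ∼-trans same q = q
      ∼-trans p same = p
      ∼-trans (lr i p q) (rl j p′ q′) with l-inj (trans q (sym q′))
      ∼-trans (lr i refl q) (rl .i refl q′) | refl = same
      ∼-trans (rl i p q) (lr j p′ q′) with r-inj (trans p (sym p′))
      ∼-trans (rl i p refl) (lr .i p′ refl) | refl = same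

      glued : ∀ {a b} → Q.⟦ a ⟧ ≡ Q.⟦ b ⟧ → a ∼ b
      glued eq = Eq*.fold (record { refl = same ; sym = ∼-sym ; trans = ∼-trans })
        (λ { (glue i) → lr i refl refl }) (Q.effective eq)

      in₁-inj : Inj Q.in₁
      in₁-inj eq with glued eq
      ... | same = refl

      in₂-inj : Inj Q.in₂
      in₂-inj eq with glued eq
      ... | same = refl

      meet : ∀ {x y} → Q.in₁ x ≡ Q.in₂ y → Σ[ i ∈ Fin n ] (rightV X i ≡ x × leftV Y i ≡ y)
      meet eq with glued eq
      ... | lr i p q = i , p , q

      data Position (w : Q.Class) : Set where
        onlyX : ∀ x → Q.in₁ x ≡ w → ¬ _∈out X x → Position w
        onlyY : ∀ y → Q.in₂ y ≡ w → ¬ _∈in Y y → Position w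
        both  : ∀ i → Q.in₁ (rightV X i) ≡ w → Q.in₂ (leftV Y i) ≡ w → Position w

      position : ∀ w → Position w
      position = Q.elim Position pos
        where
        pos : ∀ a → Position Q.⟦ a ⟧
        pos (inj₁ x) with any? (λ i → finite⇒≟ (proj₁ (finite X)) (rightV X i) x)
        ... | yes (i , refl) = both i refl (sym (Q.⟦⟧-glue i))
        ... | no ¬p          = onlyX x refl ¬p
        pos (inj₂ y) with any? (λ i → finite⇒≟ (proj₁ (finite Y)) (leftV Y i) y)
        ... | yes (i , refl) = both i (Q.⟦⟧-glue i) refl
        ... | no ¬p          = onlyY y refl ¬p

      from-in : ∀ {x w} → Q.in₁ x ≡ w → _∈in (X ⨾ Y) w → _∈in X x
      from-in eq (i , p) = i , in₁-inj (trans p (sym eq))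

      to-in : ∀ {x w} → Q.in₁ x ≡ w → _∈in X x → _∈in (X ⨾ Y) w
      to-in eq (i , p) = i , trans (cong Q.in₁ p) eq

      from-out : ∀ {y w} → Q.in₂ y ≡ w → _∈out (X ⨾ Y) w → _∈out Y y
      from-out eq (i , p) = i , in₂-inj (trans p (sym eq))

      to-out : ∀ {y w} → Q.in₂ y ≡ w → _∈out Y y → _∈out (X ⨾ Y) w
      to-out eq (i , p) = i , trans (cong Q.in₂ p) eq

      not-out : ∀ {x w} → Q.in₁ x ≡ w → ¬ _∈out X x → ¬ _∈out (X ⨾ Y) w
      not-out eq ∉out (i , p) with meet (trans eq (sym p))
      ... | j , q , _ = ∉out (j , q)

      not-in : ∀ {y w} → Q.in₂ y ≡ w → ¬ _∈in Y y → ¬ _∈in (X ⨾ Y) w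
      not-in eq ∉in (i , p) with meet (trans p (sym eq))
      ... | j , _ , q = ∉in (j , q)

      degX : ∀ {x w d} → Q.in₁ x ≡ w → ¬ _∈out X x → HasDegree X x d → HasDegree (X ⨾ Y) w d
      degX {x} {w} eq ∉out = C.only₁ eq (λ z p → in₁-inj (trans p (sym eq))) none
        where
        none : ∀ y → ¬ Q.in₂ y ≡ w
        none y p with meet (trans eq (sym p))
        ... | j , q , _ = ∉out (j , q)

      degY : ∀ {y w d} → Q.in₂ y ≡ w → ¬ _∈in Y y → HasDegree Y y d → HasDegree (X ⨾ Y) w d
      degY {y} {w} eq ∉in = C.only₂ eq (λ z p → in₂-inj (trans p (sym eq))) none
        where
        none : ∀ x → ¬ Q.in₁ x ≡ w
        none x p with meet (trans p (sym eq))
        ... | j , _ , q = ∉in (j , q)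

      degB : ∀ {x y w i o i′ o′} → Q.in₁ x ≡ w → Q.in₂ y ≡ w →
             HasDegree X x (i , o) → HasDegree Y y (i′ , o′) → HasDegree (X ⨾ Y) w (i + i′ , o + o′)
      degB p q = C.both p (λ z r → in₁-inj (trans r (sym p))) q (λ z r → in₂-inj (trans r (sym q)))

      pm-in-out : ∀ {w} → _∈in (X ⨾ Y) w → _∈out (X ⨾ Y) w → HasDegree (X ⨾ Y) w (0 , 0)
      pm-in-out {w} a b with position w
      ... | onlyX x p ∉out = ⊥-elim (not-out p ∉out b)
      ... | onlyY y p ∉in  = ⊥-elim (not-in p ∉in a)
      ... | both i p q     = degB p q (in-out pX (from-in p a) (i , refl)) (in-out pY (i , refl) (from-out q b))

      pm-in-only : ∀ {w} → _∈in (X ⨾ Y) w → ¬ _∈out (X ⨾ Y) w → HasDegree (X ⨾ Y) w (0 , 1)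
      pm-in-only {w} a b with position w
      ... | onlyX x p ∉out = degX p ∉out (in-only pX (from-in p a) ∉out)
      ... | onlyY y p ∉in  = ⊥-elim (not-in p ∉in a)
      ... | both i p q     = degB p q (in-out pX (from-in p a) (i , refl)) (in-only pY (i , refl) (b ∘ to-out q))

      pm-out-only : ∀ {w} → ¬ _∈in (X ⨾ Y) w → _∈out (X ⨾ Y) w → HasDegree (X ⨾ Y) w (1 , 0)
      pm-out-only {w} a b with position w
      ... | onlyX x p ∉out = ⊥-elim (not-out p ∉out b)
      ... | onlyY y p ∉in  = degY p ∉in (out-only pY ∉in (from-out p b))
      ... | both i p q     = degB p q (out-only pX (a ∘ to-in p) (i , refl)) (in-out pY (i , refl) (from-out q b))

      pm-internal : ∀ {w} → ¬ _∈in (X ⨾ Y) w → ¬ _∈out (X ⨾ Y) w →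
                    HasDegree (X ⨾ Y) w (0 , 0) ⊎ HasDegree (X ⨾ Y) w (1 , 1)
      pm-internal {w} a b with position w
      ... | onlyX x p ∉out = Sum.map (degX p ∉out) (degX p ∉out) (internal pX (a ∘ to-in p) ∉out)
      ... | onlyY y p ∉in  = Sum.map (degY p ∉in) (degY p ∉in) (internal pY ∉in (b ∘ to-out p))
      ... | both i p q     = inj₂
            (degB p q (out-only pX (a ∘ to-in p) (i , refl)) (in-only pY (i , refl) (b ∘ to-out q)))

    pm : PartialMonogamous (X ⨾ Y)
    pm = record
      { left-mono  = inj⇒mono (left (X ⨾ Y)) (λ eq → mono⇒inj (left X) (left-mono pX) (in₁-inj eq))
      ; right-mono = inj⇒mono (right (X ⨾ Y)) (λ eq → mono⇒inj (right Y) (right-mono pY) (in₂-inj eq))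
      ; in-out = pm-in-out ; in-only = pm-in-only ; out-only = pm-out-only ; internal = pm-internal }

  identity-pm : ∀ m → PartialMonogamous (identity m)
  identity-pm m = perm-pm idₗ (λ p → p) (λ v → v , refl)

  symmetry-pm : ∀ m n → PartialMonogamous (symmetry m n)
  symmetry-pm m n = perm-pm (swapD n m)
    (λ {x} {y} eq → trans (sym (swapFin-involutive n m x))
      (trans (cong (swapFin m n) eq) (swapFin-involutive n m y)))
    (λ v → swapFin m n v , swapFin-involutive m n v)

PMCsp-sub : ∀ 𝓢 → SubPROP (Csp 𝓢) (lsuc 0ℓ)
PMCsp-sub 𝓢 = record
  { _∈Sub     = PartialMonogamous
  ; id-closed = identity-pm
  ; ⨾-closed  = λ {_} {_} {_} {X} {Y} → Compose.pm X Y
  ; ⊗-closed  = λ {_} {_} {_} {_} {X} {Y} → Tensor.pm X Y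
  ; σ-closed  = symmetry-pm }

PMCsp : Generators → PROP (lsuc 0ℓ) 0ℓ
PMCsp 𝓢 = SubPROP.prop (PMCsp-sub 𝓢)

{-# OPTIONS --safe #-}
-- The isomorphism is the interpretation of terms as cospans, once it is shown to
-- be well defined, faithful and full.  Cospans have a trace, which identifies the
-- first x inputs with the first x outputs, so the universal property of the free
-- traced PROP gives the interpretation.  In a traced PROP every term can be
-- brought to the form  loops k ⊗ c , where c is a permutation into which generators
-- have been fed back one at a time:  Tr (dom g) ((g ⊗ id) ⨾ c′).  On cospans such a
-- step adds one hyperedge, and a loop adds one isolated vertex.  Any hyperedge of
-- the interpretation of c can be made the last one that was added, so two
-- normal forms with isomorphic interpretations are compared by induction on the
-- number of hyperedges.  Conversely, partial monogamy says that every vertex has at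
-- most one inflow (an input or a target) and at most one outflow, and one exactly if
-- it has the other; this is stable under adding and removing hyperedges, and
-- without hyperedges only a bijection of inputs with outputs and isolated vertices
-- remain.
module Submission where

open import Defs
open import Data.Empty using (⊥-elim)
import Data.Fin as Fin
open import Data.Fin using (Fin; _↑ʳ_; _↑ˡ_; punchIn; suc; zero)
import Data.Fin.Permutation as Perm
import Data.Fin.Properties as Finₚ
open import Data.Fin.Properties using (any?; cast-is-id; join-splitAt; splitAt-join; splitAt-↑ʳ;
  splitAt-↑ˡ; toℕ-cast; toℕ-injective; toℕ-↑ʳ; toℕ-↑ˡ)
open import Data.Irrelevant using ([_])
open import Data.Nat using (_+_; suc; zero; ℕ)
open import Data.Nat.Properties using (+-assoc; +-identityʳ)
open import Data.Product using (_,_; _×_; proj₁; proj₂; Σ-syntax; ∃)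
open import Data.Refinement.Base using (Refinement; _,_; value)
import Data.Sum as Sum
open import Data.Sum using ([_,_]′; _⊎_; inj₁; inj₂)
open import Data.Sum.Function.Propositional using (_⊎-↔_)
import Data.Sum.Properties as Sumₚ
open import Data.Unit using (tt; ⊤)
open import Function using (Inverse; _↔_; _∘_; mk↔ₛ′)
open import Function.Construct.Identity using (↔-id)
open import Function.Construct.Symmetry using (↔-sym)
open import Level using (0ℓ; _⊔_) renaming (suc to lsuc)
open import Relation.Binary.Core using (Rel)
open import Relation.Binary.Definitions using (DecidableEquality)
open import Relation.Binary.PropositionalEquality using (_≡_; cong; refl; subst; subst₂; sym; trans)
open import Relation.Binary.PropositionalEquality.WithK using (≡-irrelevant)
open import Relation.Binary.Structures using (IsEquivalence)
open import Relation.Nullary using (Dec; contradiction-irr; no; yes; ¬_)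
import Relation.Nullary.Decidable as Dec

-- A composite of cospans is a quotient of vertices, so the trace axioms compare nested quotients;
-- composites and traces are therefore compared through presentations, on vertices that have not
-- been glued yet. Generators are fed back one at a time because on cospans such a step leaves the
-- set of vertices as it is: it turns legs into tentacles of a new hyperedge and involves no
-- quotient, which makes induction on the number of hyperedges possible in both directions. The
-- trace is put on the whole of `Csp`, where it exists for every cospan. That the interpretation of
-- a term is partial monogamous is read off its normal form afterwards. Permutations are written as
-- Lehmer codes because distinct codes give distinct bijections. Faithfulness on permutations is
-- then an equality of codes, and coherence for symmetries amounts to closure of the codes under
-- composition and tensor, whose one substantial ingredient is the braid relation.

-- j ∷ p sends the first wire to position j and permutes the others, by p, into
-- the remaining positions.
data Lehmer : ℕ → Set where
  []  : Lehmer 0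
  _∷_ : ∀ {n} → Fin (suc n) → Lehmer n → Lehmer (suc n)

-- Equational theory of terms, up to normal forms.

module Terms (𝓢 : Generators) where
  open Generators 𝓢
  open Free 𝓢

  -- Equality of terms whose arities agree only up to a propositional equality,
  -- so that associativity of ⊗ can be used without transporting along it.
  infix 4 _≋_
  data _≋_ {m n} (f : Term m n) : ∀ {m′ n′} → Term m′ n′ → Set where
    ≈⇒≋ : {g : Term m n} → f ≈ g → f ≋ g

  ≋⇒≈ : ∀ {m n} {f g : Term m n} → f ≋ g → f ≈ g
  ≋⇒≈ (≈⇒≋ p) = p

  ≋-refl : ∀ {m n} {f : Term m n} → f ≋ f
  ≋-refl = ≈⇒≋ ≈-refl

  ≋-sym : ∀ {m n m′ n′} {f : Term m n} {g : Term m′ n′} → f ≋ g → g ≋ f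
  ≋-sym (≈⇒≋ p) = ≈⇒≋ (≈-sym p)

  ≋-trans : ∀ {m n m′ n′ m″ n″} {f : Term m n} {g : Term m′ n′} {h : Term m″ n″} →
            f ≋ g → g ≋ h → f ≋ h
  ≋-trans (≈⇒≋ p) (≈⇒≋ q) = ≈⇒≋ (≈-trans p q)

  ≋-⨾ : ∀ {m n p m′ n′ p′} {f : Term m n} {g : Term n p} {f′ : Term m′ n′} {g′ : Term n′ p′} →
        f ≋ f′ → g ≋ g′ → f ⨾ g ≋ f′ ⨾ g′
  ≋-⨾ (≈⇒≋ p) (≈⇒≋ q) = ≈⇒≋ (⨾-cong p q)

  ≋-⊗ : ∀ {m n p q m′ n′ p′ q′} {f : Term m n} {g : Term p q} {f′ : Term m′ n′} {g′ : Term p′ q′} →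
        f ≋ f′ → g ≋ g′ → f ⊗ g ≋ f′ ⊗ g′
  ≋-⊗ (≈⇒≋ p) (≈⇒≋ q) = ≈⇒≋ (⊗-cong p q)

  -- The arity equations are separate arguments because matching on `f ≋ g` would have to unify
  -- `x + m` with `x + m′`, where addition blocks the unifier.
  ≋-Tr : ∀ x {m n m′ n′} {f : Term (x + m) (x + n)} {g : Term (x + m′) (x + n′)} →
         m ≡ m′ → n ≡ n′ → f ≋ g → Tr x f ≋ Tr x g
  ≋-Tr x refl refl p = ≈⇒≋ (Tr-cong x (≋⇒≈ p))

  cast-≋ : ∀ {m m′ n n′} (p : m ≡ m′) (q : n ≡ n′) (f : Term m n) → cast p q f ≋ f
  cast-≋ refl refl f = ≋-refl

  id-≋ : ∀ {m n} → m ≡ n → id m ≋ id n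
  id-≋ refl = ≋-refl

  infixr 20 ⨾⟨_
  infixl 10 _⟩⨾
  infix  1 begin_ begin≈_
  infixr 2 _≈⟨_⟩_ _≋⟨_⟩_
  infix  3 _∎

  begin_ : ∀ {m n m′ n′} {f : Term m n} {g : Term m′ n′} → f ≋ g → f ≋ g
  begin p = p

  begin≈_ : ∀ {m n} {f g : Term m n} → f ≋ g → f ≈ g
  begin≈ p = ≋⇒≈ p

  _≈⟨_⟩_ : ∀ {m n m′ n′} (f : Term m n) {g : Term m n} {h : Term m′ n′} → f ≈ g → g ≋ h → f ≋ h
  f ≈⟨ p ⟩ q = ≋-trans (≈⇒≋ p) q

  _≋⟨_⟩_ : ∀ {m n m′ n′ m″ n″} (f : Term m n) {g : Term m′ n′} {h : Term m″ n″} →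
           f ≋ g → g ≋ h → f ≋ h
  f ≋⟨ p ⟩ q = ≋-trans p q

  _∎ : ∀ {m n} (f : Term m n) → f ≋ f
  f ∎ = ≋-refl

  ⊗-assoc≋ : ∀ {m n p q r s} (f : Term m n) (g : Term p q) (h : Term r s) →
             (f ⊗ g) ⊗ h ≋ f ⊗ (g ⊗ h)
  ⊗-assoc≋ f g h = ≋-trans (≋-sym (cast-≋ _ _ _)) (≈⇒≋ (⊗-assoc f g h))

  ⊗-id0 : ∀ {m n} (f : Term m n) → f ⊗ id 0 ≋ f
  ⊗-id0 f = ≋-trans (≋-sym (cast-≋ _ _ _)) (≈⇒≋ (⊗-identityʳ f))

  _⟩⨾ : ∀ {m n p} {f f′ : Term m n} {g : Term n p} → f ≈ f′ → f ⨾ g ≈ f′ ⨾ g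
  p ⟩⨾ = ⨾-cong p ≈-refl

  ⨾⟨_ : ∀ {m n p} {f : Term m n} {g g′ : Term n p} → g ≈ g′ → f ⨾ g ≈ f ⨾ g′
  ⨾⟨ p = ⨾-cong ≈-refl p

  last² : ∀ {m n p q r} {f : Term m n} {g : Term n p} {h : Term p q} {g′ : Term n r} {h′ : Term r q} →
          g ⨾ h ≈ g′ ⨾ h′ → f ⨾ g ⨾ h ≈ f ⨾ g′ ⨾ h′
  last² p = ≈-trans (⨾-assoc _ _ _) (≈-trans (⨾⟨ p) (≈-sym (⨾-assoc _ _ _)))

  id⊗-⨾ : ∀ x {m n p} (f : Term m n) (g : Term n p) → id x ⊗ (f ⨾ g) ≈ (id x ⊗ f) ⨾ (id x ⊗ g)
  id⊗-⨾ x f g = ≈-trans (⊗-cong (≈-sym (⨾-identityˡ (id x))) ≈-refl) (⊗-⨾ _ _ _ _)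

  ⨾-⊗id : ∀ x {m n p} (f : Term m n) (g : Term n p) → (f ⨾ g) ⊗ id x ≈ (f ⊗ id x) ⨾ (g ⊗ id x)
  ⨾-⊗id x f g = ≈-trans (⊗-cong ≈-refl (≈-sym (⨾-identityˡ (id x)))) (⊗-⨾ _ _ _ _)

  ⊗-left-first : ∀ {m n p q} (f : Term m n) (g : Term p q) → (f ⊗ id p) ⨾ (id n ⊗ g) ≈ f ⊗ g
  ⊗-left-first f g = ≈-trans (≈-sym (⊗-⨾ _ _ _ _)) (⊗-cong (⨾-identityʳ f) (⨾-identityˡ g))

  ⊗-right-first : ∀ {m n p q} (f : Term m n) (g : Term p q) → (id m ⊗ g) ⨾ (f ⊗ id q) ≈ f ⊗ g
  ⊗-right-first f g = ≈-trans (≈-sym (⊗-⨾ _ _ _ _)) (⊗-cong (⨾-identityˡ f) (⨾-identityʳ g))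

  ⊗-exchange : ∀ {m n p q} (f : Term m n) (g : Term p q) →
               (f ⊗ id p) ⨾ (id n ⊗ g) ≈ (id m ⊗ g) ⨾ (f ⊗ id q)
  ⊗-exchange f g = ≈-trans (⊗-left-first f g) (≈-sym (⊗-right-first f g))

  id⊗id⊗ : ∀ a b {m n} (f : Term m n) → id (a + b) ⊗ f ≋ id a ⊗ (id b ⊗ f)
  id⊗id⊗ a b f = begin
    id (a + b) ⊗ f      ≈⟨ ⊗-cong (≈-sym (⊗-id a b)) ≈-refl ⟩
    (id a ⊗ id b) ⊗ f   ≋⟨ ⊗-assoc≋ _ _ _ ⟩
    id a ⊗ (id b ⊗ f)   ∎

  ⊗id⊗id : ∀ a b {m n} (f : Term m n) → (f ⊗ id a) ⊗ id b ≋ f ⊗ id (a + b)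
  ⊗id⊗id a b f = begin
    (f ⊗ id a) ⊗ id b   ≋⟨ ⊗-assoc≋ _ _ _ ⟩
    f ⊗ (id a ⊗ id b)   ≈⟨ ⊗-cong ≈-refl (⊗-id a b) ⟩
    f ⊗ id (a + b)      ∎

  -- The factor `h` is only required to agree with `id n ⊗ σ m p` up to reassociation, so each use
  -- may choose its own cast or none.
  hexagon : ∀ m n p {k} {h : Term ((n + m) + p) k} → h ≋ id n ⊗ σ m p →
            (σ m n ⊗ id p) ⨾ h ≋ σ m (n + p)
  hexagon m n p {h = h} q = begin
    (σ m n ⊗ id p) ⨾ h
      ≋⟨ ≋-⨾ ≋-refl (≋-trans q (≋-sym (cast-≋ (sym (+-assoc n m p)) refl _))) ⟩
    (σ m n ⊗ id p) ⨾ cast (sym (+-assoc n m p)) refl (id n ⊗ σ m p)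
      ≋⟨ ≋-sym (cast-≋ (+-assoc m n p) (sym (+-assoc n p m)) _) ⟩
    cast (+-assoc m n p) (sym (+-assoc n p m))
      ((σ m n ⊗ id p) ⨾ cast (sym (+-assoc n m p)) refl (id n ⊗ σ m p))
      ≈⟨ σ-hexagon m n p ⟩
    σ m (n + p) ∎

  right-inverse-unique : ∀ {m n} {f : Term m n} {g h : Term n m} →
                         f ⨾ g ≈ id m → h ⨾ f ≈ id n → g ≈ h
  right-inverse-unique {f = f} {g} {h} p q = begin≈
    g             ≈⟨ ≈-sym (⨾-identityˡ g) ⟩
    id _ ⨾ g      ≈⟨ ≈-sym q ⟩⨾ ⟩
    h ⨾ f ⨾ g     ≈⟨ ⨾-assoc h f g ⟩
    h ⨾ (f ⨾ g)   ≈⟨ ⨾⟨ p ⟩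
    h ⨾ id _      ≈⟨ ⨾-identityʳ h ⟩
    h             ∎

  -- With `m + 0` identified with `m`, the hexagon at `n = p = 0` makes this symmetry idempotent. It
  -- is also invertible, and an invertible idempotent is an identity.
  σ-0ʳ : ∀ m → σ m 0 ≋ id m
  σ-0ʳ m = begin
    σ m 0           ≋⟨ ≋-sym s≋ ⟩
    s               ≈⟨ ≈-sym (⨾-identityʳ s) ⟩
    s ⨾ id m        ≈⟨ ⨾⟨ ≈-sym s⨾u ⟩
    s ⨾ (s ⨾ u)     ≈⟨ ≈-sym (⨾-assoc s s u) ⟩
    s ⨾ s ⨾ u       ≈⟨ s⨾s ⟩⨾ ⟩
    s ⨾ u           ≈⟨ s⨾u ⟩
    id m            ∎
    where
    s u : Term m m
    s = cast (+-identityʳ m) refl (σ m 0)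
    u = cast refl (+-identityʳ m) (σ 0 m)
    s≋ : s ≋ σ m 0
    s≋ = cast-≋ _ _ _
    s⨾u : s ⨾ u ≈ id m
    s⨾u = begin≈
      s ⨾ u            ≋⟨ ≋-⨾ s≋ (cast-≋ _ _ _) ⟩
      σ m 0 ⨾ σ 0 m    ≈⟨ σ-involutive m 0 ⟩
      id (m + 0)       ≋⟨ id-≋ (+-identityʳ m) ⟩
      id m             ∎
    s⨾s : s ⨾ s ≈ s
    s⨾s = begin≈
      s ⨾ s
        ≋⟨ ≋-⨾ (≋-trans s≋ (≋-sym (⊗-id0 (σ m 0)))) (≋-sym (cast-≋ (sym (+-identityʳ m)) refl s)) ⟩
      (σ m 0 ⊗ id 0) ⨾ cast (sym (+-identityʳ m)) refl s
        ≋⟨ hexagon m 0 0 (≋-trans (cast-≋ (sym (+-identityʳ m)) refl s) (≋-trans s≋ (≈⇒≋ (≈-sym (⊗-identityˡ _))))) ⟩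
      σ m 0
        ≋⟨ ≋-sym s≋ ⟩
      s ∎

  σ-0ˡ : ∀ m → σ 0 m ≋ id m
  σ-0ˡ m = begin
    σ 0 m            ≈⟨ ≈-sym (⨾-identityʳ _) ⟩
    σ 0 m ⨾ id (m + 0)  ≋⟨ ≋-⨾ ≋-refl (≋-trans (id-≋ (+-identityʳ m)) (≋-sym (σ-0ʳ m))) ⟩
    σ 0 m ⨾ σ m 0    ≈⟨ σ-involutive 0 m ⟩
    id m             ∎

  -- Both sides are inverse to `σ p (m + n)`, which the first hexagon factors; inverses are unique.
  hexagonʳ : ∀ m n p {k} {h : Term k ((m + p) + n)} → h ≋ id m ⊗ σ n p →
             h ⨾ (σ m p ⊗ id n) ≋ σ (m + n) p
  hexagonʳ m n p {h = h} q = begin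
    h ⨾ (σ m p ⊗ id n)
      ≋⟨ ≋-⨾ (≋-trans q (≋-sym h′≋)) ≋-refl ⟩
    h′ ⨾ (σ m p ⊗ id n)
      ≋⟨ ≈⇒≋ (right-inverse-unique inv inv′) ⟩
    cast (+-assoc m n p) (sym (+-assoc p m n)) (σ (m + n) p)
      ≋⟨ cast-≋ _ _ _ ⟩
    σ (m + n) p ∎
    where
    h′ : Term (m + (n + p)) ((m + p) + n)
    h′ = cast refl (sym (+-assoc m p n)) (id m ⊗ σ n p)
    h′≋ : h′ ≋ id m ⊗ σ n p
    h′≋ = cast-≋ _ _ _
    k′ : Term ((m + p) + n) (m + (n + p))
    k′ = cast (sym (+-assoc m p n)) refl (id m ⊗ σ p n)
    f : Term ((p + m) + n) (m + (n + p))
    f = (σ p m ⊗ id n) ⨾ k′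
    f≋ : f ≋ σ p (m + n)
    f≋ = hexagon p m n (cast-≋ _ _ _)
    k⨾h : k′ ⨾ h′ ≈ id _
    k⨾h = begin≈
      k′ ⨾ h′                               ≋⟨ ≋-⨾ (cast-≋ _ _ _) h′≋ ⟩
      (id m ⊗ σ p n) ⨾ (id m ⊗ σ n p)       ≈⟨ ≈-sym (id⊗-⨾ m _ _) ⟩
      id m ⊗ (σ p n ⨾ σ n p)                ≈⟨ ⊗-cong ≈-refl (σ-involutive p n) ⟩
      id m ⊗ id (p + n)                     ≈⟨ ⊗-id m (p + n) ⟩
      id (m + (p + n))                      ≋⟨ id-≋ (sym (+-assoc m p n)) ⟩
      id ((m + p) + n)                      ∎
    inv : f ⨾ (h′ ⨾ (σ m p ⊗ id n)) ≈ id _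
    inv = begin≈
      f ⨾ (h′ ⨾ (σ m p ⊗ id n))             ≈⟨ ≈-sym (⨾-assoc _ _ _) ⟩
      f ⨾ h′ ⨾ (σ m p ⊗ id n)               ≈⟨ ≈-trans (⨾-assoc _ _ _) (⨾⟨ k⨾h) ⟩⨾ ⟩
      (σ p m ⊗ id n) ⨾ id _ ⨾ (σ m p ⊗ id n)  ≈⟨ ⨾-identityʳ _ ⟩⨾ ⟩
      (σ p m ⊗ id n) ⨾ (σ m p ⊗ id n)       ≈⟨ ≈-sym (⨾-⊗id n _ _) ⟩
      (σ p m ⨾ σ m p) ⊗ id n                ≈⟨ ⊗-cong (σ-involutive p m) ≈-refl ⟩
      id (p + m) ⊗ id n                     ≈⟨ ⊗-id _ _ ⟩
      id _                                  ∎
    inv′ : cast (+-assoc m n p) (sym (+-assoc p m n)) (σ (m + n) p) ⨾ f ≈ id _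
    inv′ = begin≈
      cast (+-assoc m n p) (sym (+-assoc p m n)) (σ (m + n) p) ⨾ f  ≋⟨ ≋-⨾ lhs≋ f≋ ⟩
      σ (m + n) p ⨾ σ p (m + n)             ≈⟨ σ-involutive (m + n) p ⟩
      id ((m + n) + p)                      ≋⟨ id-≋ (+-assoc m n p) ⟩
      id (m + (n + p))                      ∎
      where
      lhs≋ : cast (+-assoc m n p) (sym (+-assoc p m n)) (σ (m + n) p) ≋ σ (m + n) p
      lhs≋ = cast-≋ _ _ _

  -- Permutation terms

  -- Carries the first wire to position `j` by adjacent transpositions and keeps the order of the
  -- other wires.
  ins : ∀ {n} → Fin (suc n) → Term (suc n) (suc n)
  ins zero            = id _
  ins {suc n} (suc j) = (σ 1 1 ⊗ id n) ⨾ (id 1 ⊗ ins j)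

  ⌜_⌝ : ∀ {n} → Lehmer n → Term n n
  ⌜ [] ⌝    = id 0
  ⌜ j ∷ p ⌝ = (id 1 ⊗ ⌜ p ⌝) ⨾ ins j

  σ₁₁-natural : ∀ {m n} (f : Term m n) →
                (σ 1 1 ⊗ id m) ⨾ (id 1 ⊗ (id 1 ⊗ f)) ≈ (id 1 ⊗ (id 1 ⊗ f)) ⨾ (σ 1 1 ⊗ id n)
  σ₁₁-natural f = ≈-trans (⨾⟨ ≈-sym (≋⇒≈ (id⊗id⊗ 1 1 f)))
    (≈-trans (⊗-exchange (σ 1 1) f) (≋⇒≈ (id⊗id⊗ 1 1 f) ⟩⨾))

  -- On three wires, two consecutive crossings make `σ 1 2` by the hexagon, and naturality of
  -- `σ 1 2` with respect to `σ 1 1` is the braid relation. The remaining `n` wires are tensored on.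
  yang-baxter : ∀ n → (σ 1 1 ⊗ id (suc n)) ⨾ (id 1 ⊗ (σ 1 1 ⊗ id n)) ⨾ (σ 1 1 ⊗ id (suc n))
                    ≈ (id 1 ⊗ (σ 1 1 ⊗ id n)) ⨾ (σ 1 1 ⊗ id (suc n)) ⨾ (id 1 ⊗ (σ 1 1 ⊗ id n))
  yang-baxter n = begin≈
    A n ⨾ B n ⨾ A n                             ≈⟨ ⨾-cong (⨾-cong (A-⊗ n) (B-⊗ n)) (A-⊗ n) ⟩
    (A 0 ⊗ id n) ⨾ (B 0 ⊗ id n) ⨾ (A 0 ⊗ id n)  ≈⟨ join (A 0) (B 0) (A 0) ⟩
    (A 0 ⨾ B 0 ⨾ A 0) ⊗ id n                    ≈⟨ ⊗-cong three ≈-refl ⟩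
    (B 0 ⨾ A 0 ⨾ B 0) ⊗ id n                    ≈⟨ ≈-sym (join (B 0) (A 0) (B 0)) ⟩
    (B 0 ⊗ id n) ⨾ (A 0 ⊗ id n) ⨾ (B 0 ⊗ id n)
      ≈⟨ ≈-sym (⨾-cong (⨾-cong (B-⊗ n) (A-⊗ n)) (B-⊗ n)) ⟩
    B n ⨾ A n ⨾ B n ∎
    where
    A B : ∀ k → Term (3 + k) (3 + k)
    A k = σ 1 1 ⊗ id (suc k)
    B k = id 1 ⊗ (σ 1 1 ⊗ id k)
    σσ : (σ 1 1 ⊗ id 1) ⨾ (id 1 ⊗ σ 1 1) ≈ σ 1 2
    σσ = ≋⇒≈ (hexagon 1 1 1 ≋-refl)
    B0 : B 0 ≈ id 1 ⊗ σ 1 1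
    B0 = ⊗-cong ≈-refl (⊗-identityʳ (σ 1 1))
    A-⊗ : ∀ k → A k ≈ A 0 ⊗ id k
    A-⊗ k = ≋⇒≈ (≋-sym (⊗id⊗id 1 k (σ 1 1)))
    B-⊗ : ∀ k → B k ≈ B 0 ⊗ id k
    B-⊗ k = begin≈
      id 1 ⊗ (σ 1 1 ⊗ id k)        ≋⟨ ≋-sym (⊗-assoc≋ _ _ _) ⟩
      (id 1 ⊗ σ 1 1) ⊗ id k        ≈⟨ ⊗-cong (≈-sym B0) ≈-refl ⟩
      B 0 ⊗ id k                   ∎
    join : ∀ (f g h : Term 3 3) → (f ⊗ id n) ⨾ (g ⊗ id n) ⨾ (h ⊗ id n) ≈ (f ⨾ g ⨾ h) ⊗ id n
    join f g h = ≈-sym (≈-trans (⨾-⊗id n _ _) (⨾-⊗id n _ _ ⟩⨾))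
    three : A 0 ⨾ B 0 ⨾ A 0 ≈ B 0 ⨾ A 0 ⨾ B 0
    three = begin≈
      A 0 ⨾ B 0 ⨾ A 0                                   ≈⟨ ≈-trans (⨾⟨ B0) σσ ⟩⨾ ⟩
      σ 1 2 ⨾ (σ 1 1 ⊗ id 1)                            ≈⟨ ≈-sym (σ-natural (id 1) (σ 1 1)) ⟩
      (id 1 ⊗ σ 1 1) ⨾ σ 1 2                            ≈⟨ ⨾-cong (≈-sym B0) (≈-sym σσ) ⟩
      B 0 ⨾ (A 0 ⨾ (id 1 ⊗ σ 1 1))                      ≈⟨ ⨾⟨ ⨾⟨ ≈-sym B0 ⟩
      B 0 ⨾ (A 0 ⨾ B 0)                                 ≈⟨ ≈-sym (⨾-assoc _ _ _) ⟩
      B 0 ⨾ A 0 ⨾ B 0                                   ∎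

  -- Crossing two wires before inserting them amounts to inserting them in the other order, at
  -- adjusted positions. If both positions are positive, the braid relation moves the crossing one
  -- wire further in, where the induction hypothesis applies; otherwise one insertion is trivial or
  -- two crossings cancel.
  ins-ins : ∀ {n} (a : Fin (suc n)) (b : Fin (suc (suc n))) →
            ∃ λ a′ → ∃ λ b′ → (σ 1 1 ⊗ id n) ⨾ (id 1 ⊗ ins a) ⨾ ins b ≈ (id 1 ⊗ ins a′) ⨾ ins b′
  ins-ins a zero = zero , suc a ,
    ≈-trans (⨾-identityʳ _) (≈-sym (≈-trans (⊗-id 1 _ ⟩⨾) (⨾-identityˡ _)))
  ins-ins {n} zero (suc b) = b , zero , (begin≈
    (σ 1 1 ⊗ id n) ⨾ (id 1 ⊗ id _) ⨾ ((σ 1 1 ⊗ id n) ⨾ (id 1 ⊗ ins b))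
      ≈⟨ ≈-trans (⨾⟨ ⊗-id 1 _) (⨾-identityʳ _) ⟩⨾ ⟩
    (σ 1 1 ⊗ id n) ⨾ ((σ 1 1 ⊗ id n) ⨾ (id 1 ⊗ ins b))   ≈⟨ ≈-sym (⨾-assoc _ _ _) ⟩
    (σ 1 1 ⊗ id n) ⨾ (σ 1 1 ⊗ id n) ⨾ (id 1 ⊗ ins b)     ≈⟨ ≈-sym (⨾-⊗id n _ _) ⟩⨾ ⟩
    ((σ 1 1 ⨾ σ 1 1) ⊗ id n) ⨾ (id 1 ⊗ ins b)
      ≈⟨ ≈-trans (⊗-cong (σ-involutive 1 1) ≈-refl) (⊗-id 2 n) ⟩⨾ ⟩
    id _ ⨾ (id 1 ⊗ ins b)                                 ≈⟨ ⨾-identityˡ _ ⟩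
    id 1 ⊗ ins b                                          ≈⟨ ≈-sym (⨾-identityʳ _) ⟩
    (id 1 ⊗ ins b) ⨾ id _                                 ∎)
  ins-ins {suc n} (suc a) (suc b) with ins-ins a b
  ... | a′ , b′ , eq = suc a′ , suc b′ , (begin≈
    A ⨾ (id 1 ⊗ (A′ ⨾ (id 1 ⊗ ins a))) ⨾ (A ⨾ (id 1 ⊗ ins b))
      ≈⟨ ⨾-cong (⨾⟨ id⊗-⨾ 1 _ _) ≈-refl ⟩
    A ⨾ (B ⨾ I a) ⨾ (A ⨾ (id 1 ⊗ ins b))
      ≈⟨ ≈-trans (≈-sym (⨾-assoc _ _ _)) (≈-sym (⨾-assoc _ _ _) ⟩⨾ ⟩⨾) ⟩
    A ⨾ B ⨾ I a ⨾ A ⨾ (id 1 ⊗ ins b)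
      ≈⟨ last² (≈-sym (σ₁₁-natural (ins a))) ⟩⨾ ⟩
    A ⨾ B ⨾ A ⨾ I a ⨾ (id 1 ⊗ ins b)
      ≈⟨ yang-baxter n ⟩⨾ ⟩⨾ ⟩
    B ⨾ A ⨾ B ⨾ I a ⨾ (id 1 ⊗ ins b)
      ≈⟨ ≈-trans (⨾-assoc _ _ _) (≈-trans (⨾-assoc _ _ _) (⨾⟨ ≈-sym (⨾-assoc _ _ _))) ⟩
    B ⨾ A ⨾ (B ⨾ I a ⨾ (id 1 ⊗ ins b))
      ≈⟨ ⨾⟨ ≈-sym (≈-trans (id⊗-⨾ 1 _ _) (id⊗-⨾ 1 _ _ ⟩⨾)) ⟩
    B ⨾ A ⨾ (id 1 ⊗ (A′ ⨾ (id 1 ⊗ ins a) ⨾ ins b))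
      ≈⟨ ⨾⟨ ⊗-cong ≈-refl eq ⟩
    B ⨾ A ⨾ (id 1 ⊗ ((id 1 ⊗ ins a′) ⨾ ins b′))
      ≈⟨ ⨾⟨ id⊗-⨾ 1 _ _ ⟩
    B ⨾ A ⨾ (I a′ ⨾ (id 1 ⊗ ins b′))
      ≈⟨ ≈-sym (⨾-assoc _ _ _) ⟩
    B ⨾ A ⨾ I a′ ⨾ (id 1 ⊗ ins b′)
      ≈⟨ last² (σ₁₁-natural (ins a′)) ⟩⨾ ⟩
    B ⨾ I a′ ⨾ A ⨾ (id 1 ⊗ ins b′)
      ≈⟨ ⨾-assoc _ _ _ ⟩
    B ⨾ I a′ ⨾ (A ⨾ (id 1 ⊗ ins b′))
      ≈⟨ ≈-sym (id⊗-⨾ 1 _ _) ⟩⨾ ⟩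
    (id 1 ⊗ (A′ ⨾ (id 1 ⊗ ins a′))) ⨾ (A ⨾ (id 1 ⊗ ins b′)) ∎)
    where
    A = σ 1 1 ⊗ id (suc n)
    A′ = σ 1 1 ⊗ id n
    B = id 1 ⊗ A′
    I : Fin (suc n) → Term (3 + n) (3 + n)
    I a = id 1 ⊗ (id 1 ⊗ ins a)

  -- The first crossing of `ins (suc j)` passes the code of the remaining wires by naturality and is
  -- then absorbed by `ins-ins`.
  ins-⌜⌝ : ∀ {n} (j : Fin (suc n)) (q : Lehmer (suc n)) →
           ∃ λ q′ → ins j ⨾ ⌜ q ⌝ ≈ ⌜ q′ ⌝
  ins-⌜⌝ zero q = q , ⨾-identityˡ _
  ins-⌜⌝ {suc n} (suc j) (b ∷ q) with ins-⌜⌝ j q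
  ... | a ∷ q₁ , eq with ins-ins a b
  ... | a′ , b′ , eq′ = b′ ∷ (a′ ∷ q₁) , (begin≈
    A ⨾ (id 1 ⊗ ins j) ⨾ ((id 1 ⊗ ⌜ q ⌝) ⨾ ins b)   ≈⟨ ≈-sym (⨾-assoc _ _ _) ⟩
    A ⨾ (id 1 ⊗ ins j) ⨾ (id 1 ⊗ ⌜ q ⌝) ⨾ ins b     ≈⟨ ⨾-assoc _ _ _ ⟩⨾ ⟩
    A ⨾ ((id 1 ⊗ ins j) ⨾ (id 1 ⊗ ⌜ q ⌝)) ⨾ ins b
      ≈⟨ ⨾⟨ ≈-trans (≈-sym (id⊗-⨾ 1 _ _)) (≈-trans (⊗-cong ≈-refl eq) (id⊗-⨾ 1 _ _)) ⟩⨾ ⟩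
    A ⨾ (Q ⨾ (id 1 ⊗ ins a)) ⨾ ins b                ≈⟨ ≈-sym (⨾-assoc _ _ _) ⟩⨾ ⟩
    A ⨾ Q ⨾ (id 1 ⊗ ins a) ⨾ ins b                  ≈⟨ σ₁₁-natural ⌜ q₁ ⌝ ⟩⨾ ⟩⨾ ⟩
    Q ⨾ A ⨾ (id 1 ⊗ ins a) ⨾ ins b                  ≈⟨ ≈-trans (⨾-assoc _ _ _ ⟩⨾) (⨾-assoc _ _ _) ⟩
    Q ⨾ (A ⨾ (id 1 ⊗ ins a) ⨾ ins b)                ≈⟨ ⨾⟨ eq′ ⟩
    Q ⨾ ((id 1 ⊗ ins a′) ⨾ ins b′)                  ≈⟨ ≈-sym (⨾-assoc _ _ _) ⟩
    Q ⨾ (id 1 ⊗ ins a′) ⨾ ins b′                    ≈⟨ ≈-sym (id⊗-⨾ 1 _ _) ⟩⨾ ⟩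
    ⌜ b′ ∷ (a′ ∷ q₁) ⌝                              ∎)
    where
    A = σ 1 1 ⊗ id n
    Q = id 1 ⊗ (id 1 ⊗ ⌜ q₁ ⌝)

  ⌜⌝-⨾ : ∀ {n} (p q : Lehmer n) → ∃ λ r → ⌜ p ⌝ ⨾ ⌜ q ⌝ ≈ ⌜ r ⌝
  ⌜⌝-⨾ [] q = q , ⨾-identityˡ _
  ⌜⌝-⨾ (j ∷ p) q with ins-⌜⌝ j q
  ... | b ∷ q′ , eq with ⌜⌝-⨾ p q′
  ... | r , eq′ = b ∷ r , (begin≈
    (id 1 ⊗ ⌜ p ⌝) ⨾ ins j ⨾ ⌜ q ⌝                 ≈⟨ ≈-trans (⨾-assoc _ _ _) (⨾⟨ eq) ⟩
    (id 1 ⊗ ⌜ p ⌝) ⨾ ((id 1 ⊗ ⌜ q′ ⌝) ⨾ ins b)     ≈⟨ ≈-sym (⨾-assoc _ _ _) ⟩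
    (id 1 ⊗ ⌜ p ⌝) ⨾ (id 1 ⊗ ⌜ q′ ⌝) ⨾ ins b       ≈⟨ ≈-sym (id⊗-⨾ 1 _ _) ⟩⨾ ⟩
    (id 1 ⊗ (⌜ p ⌝ ⨾ ⌜ q′ ⌝)) ⨾ ins b              ≈⟨ ⊗-cong ≈-refl eq′ ⟩⨾ ⟩
    ⌜ b ∷ r ⌝                                      ∎)

  ins-⊗ : ∀ {n} (j : Fin (suc n)) k → ins j ⊗ id k ≈ ins (j ↑ˡ k)
  ins-⊗ zero k = ⊗-id _ k
  ins-⊗ {suc n} (suc j) k = begin≈
    ((σ 1 1 ⊗ id n) ⨾ (id 1 ⊗ ins j)) ⊗ id k             ≈⟨ ⨾-⊗id k _ _ ⟩
    ((σ 1 1 ⊗ id n) ⊗ id k) ⨾ ((id 1 ⊗ ins j) ⊗ id k)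
      ≋⟨ ≋-⨾ (⊗id⊗id n k (σ 1 1)) (⊗-assoc≋ _ _ _) ⟩
    (σ 1 1 ⊗ id (n + k)) ⨾ (id 1 ⊗ (ins j ⊗ id k))       ≈⟨ ⨾⟨ ⊗-cong ≈-refl (ins-⊗ j k) ⟩
    ins (suc (j ↑ˡ k))                                   ∎

  ⌜⌝-⊗ : ∀ {m n} (p : Lehmer m) (q : Lehmer n) → ∃ λ r → ⌜ p ⌝ ⊗ ⌜ q ⌝ ≈ ⌜ r ⌝
  ⌜⌝-⊗ [] q = q , ⊗-identityˡ _
  ⌜⌝-⊗ {suc m} {n} (j ∷ p) q with ⌜⌝-⊗ p q
  ... | r , eq = (j ↑ˡ n) ∷ r , (begin≈
    ((id 1 ⊗ ⌜ p ⌝) ⨾ ins j) ⊗ ⌜ q ⌝                  ≈⟨ ⊗-cong ≈-refl (≈-sym (⨾-identityʳ _)) ⟩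
    ((id 1 ⊗ ⌜ p ⌝) ⨾ ins j) ⊗ (⌜ q ⌝ ⨾ id n)         ≈⟨ ⊗-⨾ _ _ _ _ ⟩
    ((id 1 ⊗ ⌜ p ⌝) ⊗ ⌜ q ⌝) ⨾ (ins j ⊗ id n)
      ≋⟨ ≋-⨾ (⊗-assoc≋ _ _ _) (≈⇒≋ (ins-⊗ j n)) ⟩
    (id 1 ⊗ (⌜ p ⌝ ⊗ ⌜ q ⌝)) ⨾ ins (j ↑ˡ n)           ≈⟨ ⊗-cong ≈-refl eq ⟩⨾ ⟩
    ⌜ (j ↑ˡ n) ∷ r ⌝                                  ∎)

  -- The code lives on a number `k` of its own, since the two arities of a permutation such as
  -- `σ m n` agree only propositionally.
  IsPerm : ∀ {m n} → Term m n → Set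
  IsPerm t = ∃ λ k → Σ[ p ∈ Lehmer k ] t ≋ ⌜ p ⌝

  IsPerm-≋ : ∀ {m n m′ n′} {f : Term m n} {g : Term m′ n′} → f ≋ g → IsPerm f → IsPerm g
  IsPerm-≋ e (k , p , eq) = k , p , ≋-trans (≋-sym e) eq

  IsPerm-id : ∀ n → IsPerm (id n)
  IsPerm-id n = n , ids n , ≈⇒≋ (ids≈ n)
    where
    ids : ∀ n → Lehmer n
    ids zero    = []
    ids (suc n) = zero ∷ ids n
    ids≈ : ∀ n → id n ≈ ⌜ ids n ⌝
    ids≈ zero    = ≈-refl
    ids≈ (suc n) = ≈-sym (≈-trans (⨾-identityʳ _)
      (≈-trans (⊗-cong ≈-refl (≈-sym (ids≈ n))) (⊗-id 1 n)))

  IsPerm-⨾ : ∀ {m n p} {f : Term m n} {g : Term n p} → IsPerm f → IsPerm g → IsPerm (f ⨾ g)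
  IsPerm-⨾ (_ , p , ≈⇒≋ e) (_ , q , ≈⇒≋ e′) with ⌜⌝-⨾ p q
  ... | r , eq = _ , r , ≈⇒≋ (≈-trans (⨾-cong e e′) eq)

  IsPerm-⊗ : ∀ {m n p q} {f : Term m n} {g : Term p q} → IsPerm f → IsPerm g → IsPerm (f ⊗ g)
  IsPerm-⊗ (_ , p , ≈⇒≋ e) (_ , q , ≈⇒≋ e′) with ⌜⌝-⊗ p q
  ... | r , eq = _ , r , ≈⇒≋ (≈-trans (⊗-cong e e′) eq)

  IsPerm-ins : ∀ {n} (j : Fin (suc n)) → IsPerm (ins j)
  IsPerm-ins {n} j with IsPerm-id n
  ... | _ , p , ≈⇒≋ e = _ , j ∷ p , ≈⇒≋ (≈-sym
    (≈-trans (≈-trans (⊗-cong ≈-refl (≈-sym e)) (⊗-id 1 n) ⟩⨾) (⨾-identityˡ _)))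

  -- The second hexagon takes wires off the left block and the first hexagon off the right block,
  -- down to `σ 1 1`, which is an insertion at position 1.
  IsPerm-σ : ∀ m n → IsPerm (σ m n)
  IsPerm-σ zero n = IsPerm-≋ (≋-sym (σ-0ˡ n)) (IsPerm-id n)
  IsPerm-σ (suc m) n = IsPerm-≋ (hexagonʳ 1 m n (cast-≋ refl (sym (+-assoc 1 n m)) (id 1 ⊗ σ m n)))
    (IsPerm-⨾ (IsPerm-⊗ (IsPerm-id 1) (IsPerm-σ m n)) (IsPerm-⊗ (σ1 n) (IsPerm-id m)))
    where
    σ₁₁ : IsPerm (σ 1 1)
    σ₁₁ = IsPerm-≋ (begin
      ins (suc zero)                  ≈⟨ ≈-trans (⨾⟨ ⊗-id 1 1) (⨾-identityʳ _) ⟩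
      σ 1 1 ⊗ id 0                    ≋⟨ ⊗-id0 _ ⟩
      σ 1 1                           ∎) (IsPerm-ins (suc zero))
    σ1 : ∀ n → IsPerm (σ 1 n)
    σ1 zero    = IsPerm-≋ (≋-sym (σ-0ʳ 1)) (IsPerm-id 1)
    σ1 (suc n) = IsPerm-≋ (hexagon 1 1 n ≋-refl)
      (IsPerm-⨾ (IsPerm-⊗ σ₁₁ (IsPerm-id n)) (IsPerm-⊗ (IsPerm-id 1) (σ1 n)))

  -- Scalars and feedback

  -- A symmetry with no wires on one side is an identity, so naturality of `σ` carries an
  -- endomorphism of 0 to the other side.
  scalar-comm : ∀ {m n} (f : Term m n) (s : Term 0 0) → f ⊗ s ≋ s ⊗ f
  scalar-comm {m} {n} f s = begin
    f ⊗ s                  ≈⟨ ≈-sym (⨾-identityʳ _) ⟩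
    (f ⊗ s) ⨾ id (n + 0)   ≋⟨ ≋-⨾ ≋-refl (≋-trans (id-≋ (+-identityʳ n)) (≋-sym (σ-0ʳ n))) ⟩
    (f ⊗ s) ⨾ σ n 0        ≈⟨ σ-natural f s ⟩
    σ m 0 ⨾ (s ⊗ f)        ≋⟨ ≋-⨾ (σ-0ʳ m) ≋-refl ⟩
    id m ⨾ (s ⊗ f)         ≈⟨ ⨾-identityˡ _ ⟩
    s ⊗ f                  ∎

  superposing≋ : ∀ x {m n p q} {f : Term (x + m) (x + n)} {g : Term p q}
                 {h : Term (x + (m + p)) (x + (n + q))} → h ≋ f ⊗ g → Tr x h ≈ Tr x f ⊗ g
  superposing≋ x {f = f} {g} e =
    ≈-trans (Tr-cong x (≋⇒≈ (≋-trans e (≋-sym (cast-≋ _ _ _))))) (superposing x f g)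

  vanishing≋ : ∀ x y {m n} {f : Term ((x + y) + m) ((x + y) + n)}
               {g : Term (x + (y + m)) (x + (y + n))} → f ≋ g → Tr (x + y) f ≈ Tr y (Tr x g)
  vanishing≋ x y {f = f} e = ≈-trans (vanishing₊ x y f)
    (Tr-cong y (Tr-cong x (≋⇒≈ (≋-trans (cast-≋ _ _ _) e))))

  tightenˡ : ∀ x {m n p} (h : Term m n) (f : Term (x + n) (x + p)) →
             Tr x ((id x ⊗ h) ⨾ f) ≈ h ⨾ Tr x f
  tightenˡ x h f = begin≈
    Tr x ((id x ⊗ h) ⨾ f)                  ≈⟨ Tr-cong x (≈-sym (≈-trans (⨾⟨ ⊗-id x _) (⨾-identityʳ _))) ⟩
    Tr x ((id x ⊗ h) ⨾ f ⨾ (id x ⊗ id _))  ≈⟨ tightening x h f (id _) ⟩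
    h ⨾ Tr x f ⨾ id _                      ≈⟨ ⨾-identityʳ _ ⟩
    h ⨾ Tr x f                             ∎

  tightenʳ : ∀ x {m n p} (f : Term (x + m) (x + n)) (k : Term n p) →
             Tr x (f ⨾ (id x ⊗ k)) ≈ Tr x f ⨾ k
  tightenʳ x f k = begin≈
    Tr x (f ⨾ (id x ⊗ k))                  ≈⟨ Tr-cong x (≈-sym (≈-trans (⊗-id x _ ⟩⨾) (⨾-identityˡ _)) ⟩⨾) ⟩
    Tr x ((id x ⊗ id _) ⨾ f ⨾ (id x ⊗ k))  ≈⟨ tightening x (id _) f k ⟩
    id _ ⨾ Tr x f ⨾ k                      ≈⟨ ⨾-identityˡ _ ⟩⨾ ⟩
    Tr x f ⨾ k                             ∎

  scalar-⨾ˡ : ∀ (s : Term 0 0) {m n p} (f : Term m n) (g : Term n p) → (s ⊗ f) ⨾ g ≈ s ⊗ (f ⨾ g)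
  scalar-⨾ˡ s f g = ≈-sym (≈-trans (⊗-cong (≈-sym (⨾-identityʳ s)) ≈-refl)
    (≈-trans (⊗-⨾ _ _ _ _) (⨾⟨ ⊗-identityˡ g)))

  scalar-⨾ʳ : ∀ (s : Term 0 0) {m n p} (f : Term m n) (g : Term n p) → f ⨾ (s ⊗ g) ≈ s ⊗ (f ⨾ g)
  scalar-⨾ʳ s f g = ≈-sym (≈-trans (⊗-cong (≈-sym (⨾-identityˡ s)) ≈-refl)
    (≈-trans (⊗-⨾ _ _ _ _) (⊗-identityˡ f ⟩⨾)))

  scalar-Tr : ∀ x (s : Term 0 0) {m n} (f : Term (x + m) (x + n)) → Tr x (s ⊗ f) ≈ s ⊗ Tr x f
  scalar-Tr x s {m} {n} f = begin≈
    Tr x (s ⊗ f)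
      ≋⟨ ≋-Tr x (sym (+-identityʳ m)) (sym (+-identityʳ n)) (≋-sym (≋-trans (cast-≋ _ _ _) (scalar-comm f s))) ⟩
    Tr x (cast (+-assoc x m 0) (+-assoc x n 0) (f ⊗ s))   ≈⟨ superposing x f s ⟩
    Tr x f ⊗ s                                           ≋⟨ scalar-comm _ s ⟩
    s ⊗ Tr x f                                           ∎

  -- Nested traces are one trace over `x + y`, and sliding a symmetry around it exchanges the two
  -- blocks. Here `F′` is `F` rebracketed.
  swapTr : ∀ x y {m n} (F : Term (x + (y + m)) (x + (y + n))) (G : Term (y + (x + m)) (y + (x + n)))
           (F′ : Term ((x + y) + m) ((x + y) + n)) → F′ ≋ F →
           G ≋ (σ y x ⊗ id m) ⨾ F′ ⨾ (σ x y ⊗ id n) →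
           Tr y (Tr x F) ≈ Tr x (Tr y G)
  swapTr x y {m} {n} F G F′ e e′ = begin≈
    Tr y (Tr x F)                 ≈⟨ ≈-sym (vanishing≋ x y e) ⟩
    Tr (x + y) F′                 ≈⟨ Tr-cong (x + y) (≈-sym (⨾-identityʳ F′)) ⟩
    Tr (x + y) (F′ ⨾ id _)
      ≈⟨ Tr-cong (x + y) (⨾⟨ ≈-sym (≈-trans (⊗-cong (σ-involutive x y) ≈-refl) (⊗-id _ _))) ⟩
    Tr (x + y) (F′ ⨾ ((σ x y ⨾ σ y x) ⊗ id n))
      ≈⟨ Tr-cong (x + y) (≈-trans (⨾⟨ ⨾-⊗id n _ _) (≈-sym (⨾-assoc _ _ _))) ⟩
    Tr (x + y) (F′ ⨾ (σ x y ⊗ id n) ⨾ (σ y x ⊗ id n))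
      ≈⟨ sliding (x + y) (y + x) _ (σ y x) ⟩
    Tr (y + x) ((σ y x ⊗ id m) ⨾ (F′ ⨾ (σ x y ⊗ id n)))
      ≈⟨ vanishing≋ y x (≋-sym (≋-trans e′ (≈⇒≋ (⨾-assoc _ _ _)))) ⟩
    Tr x (Tr y G)                 ∎

  -- `f` is the context of one occurrence of `b`: it receives the outputs of `b` and supplies its
  -- inputs. At `b = id x` this is the trace itself, so one interchange law serves generators and
  -- traces alike.
  feed : ∀ {x y} → Term x y → ∀ {m n} → Term (y + m) (x + n) → Term m n
  feed {x} b {m} f = Tr x ((b ⊗ id m) ⨾ f)

  feed-cong : ∀ {x y} (b : Term x y) {m n} {f g : Term (y + m) (x + n)} → f ≈ g → feed b f ≈ feed b g
  feed-cong b p = Tr-cong _ (⨾⟨ p)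

  feed-id : ∀ x {m n} (f : Term (x + m) (x + n)) → feed (id x) f ≈ Tr x f
  feed-id x f = Tr-cong x (≈-trans (⊗-id x _ ⟩⨾) (⨾-identityˡ _))

  feed-⨾ : ∀ {x y} (b : Term x y) {m n p} (f : Term (y + m) (x + n)) (k : Term n p) →
           feed b f ⨾ k ≈ feed b (f ⨾ (id x ⊗ k))
  feed-⨾ {x} b f k = ≈-trans (≈-sym (tightenʳ x _ k)) (Tr-cong x (⨾-assoc _ _ _))

  ⨾-feed : ∀ {x y} (b : Term x y) {m n p} (h : Term m n) (f : Term (y + n) (x + p)) →
           h ⨾ feed b f ≈ feed b ((id y ⊗ h) ⨾ f)
  ⨾-feed {x} b h f = ≈-trans (≈-sym (tightenˡ x h _)) (Tr-cong x
    (≈-trans (≈-sym (⨾-assoc _ _ _)) (≈-trans (≈-sym (⊗-exchange b h) ⟩⨾) (⨾-assoc _ _ _))))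

  feed-⊗ : ∀ {x y} (b : Term x y) {m n p q} (f : Term (y + m) (x + n)) (u : Term p q)
           {h : Term (y + (m + p)) (x + (n + q))} → h ≋ f ⊗ u → feed b f ⊗ u ≈ feed b h
  feed-⊗ {x} {y} b {m} {n} {p} f u {h} e = ≈-sym (superposing≋ x (begin
    (b ⊗ id (m + p)) ⨾ h                  ≋⟨ ≋-⨾ (≋-sym (⊗id⊗id m p b)) e ⟩
    ((b ⊗ id m) ⊗ id p) ⨾ (f ⊗ u)         ≈⟨ ≈-sym (⊗-⨾ _ _ _ _) ⟩
    ((b ⊗ id m) ⨾ f) ⊗ (id p ⨾ u)         ≈⟨ ⊗-cong ≈-refl (⨾-identityˡ u) ⟩
    ((b ⊗ id m) ⨾ f) ⊗ u                  ∎))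

  scalar-feed : ∀ {x y} (b : Term x y) (s : Term 0 0) {m n} (f : Term (y + m) (x + n)) →
                feed b (s ⊗ f) ≈ s ⊗ feed b f
  scalar-feed b s f = ≈-trans (Tr-cong _ (scalar-⨾ʳ s _ f)) (scalar-Tr _ s _)

  -- The context of a lone generator is a symmetry, by yanking.
  feed-σ : ∀ {x y} (b : Term x y) → feed b (σ y x) ≈ b
  feed-σ {x} b = begin≈
    Tr x ((b ⊗ id x) ⨾ σ _ x)    ≈⟨ Tr-cong x (σ-natural b (id x)) ⟩
    Tr x (σ x x ⨾ (id x ⊗ b))    ≈⟨ tightenʳ x _ b ⟩
    Tr x (σ x x) ⨾ b             ≈⟨ yanking x ⟩⨾ ⟩
    id x ⨾ b                     ≈⟨ ⨾-identityˡ b ⟩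
    b                            ∎

  -- Reduces composition to tensor and trace, so that normal forms need only be closed under these
  -- two and under permutations.
  ⨾-as-Tr : ∀ {m n p} (f : Term m n) (g : Term n p) → Tr n (σ n m ⨾ (f ⊗ g)) ≈ f ⨾ g
  ⨾-as-Tr {m} {n} f g = begin≈
    Tr n (σ n m ⨾ (f ⊗ g))                     ≈⟨ Tr-cong n (⨾⟨ ≈-sym (⊗-left-first f g)) ⟩
    Tr n (σ n m ⨾ ((f ⊗ id n) ⨾ (id n ⊗ g)))   ≈⟨ Tr-cong n (≈-sym (⨾-assoc _ _ _)) ⟩
    Tr n (σ n m ⨾ (f ⊗ id n) ⨾ (id n ⊗ g))     ≈⟨ Tr-cong n (≈-sym (σ-natural (id n) f) ⟩⨾) ⟩
    Tr n ((id n ⊗ f) ⨾ σ n n ⨾ (id n ⊗ g))     ≈⟨ tightening n f (σ n n) g ⟩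
    f ⨾ Tr n (σ n n) ⨾ g                       ≈⟨ ≈-trans (⨾⟨ yanking n) (⨾-identityʳ f) ⟩⨾ ⟩
    f ⨾ g                                      ∎

  sw : ∀ a b m → Term (a + (b + m)) (b + (a + m))
  sw a b m = cast (+-assoc a b m) (+-assoc b a m) (σ a b ⊗ id m)

  IsPerm-sw : ∀ a b m → IsPerm (sw a b m)
  IsPerm-sw a b m = IsPerm-≋ (≋-sym (cast-≋ _ _ _)) (IsPerm-⊗ (IsPerm-σ a b) (IsPerm-id m))

  -- Either side is a double trace of `b` and `c`, side by side, followed by `h`; `swapTr` exchanges
  -- the two traces and naturality of the symmetry exchanges `b` with `c`.
  feed-feed : ∀ {x x′ y y′} (b : Term x x′) (c : Term y y′) {m n} (h : Term (x′ + (y′ + m)) (x + (y + n))) →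
              feed c (feed b h) ≈ feed b (feed c (sw y′ x′ m ⨾ h ⨾ sw x y n))
  feed-feed {x} {x′} {y} {y′} b c {m} {n} h = begin≈
    Tr y ((c ⊗ id m) ⨾ Tr x ((b ⊗ id (y′ + m)) ⨾ h))
      ≈⟨ Tr-cong y (≈-sym (tightenˡ x _ _)) ⟩
    Tr y (Tr x ((id x ⊗ (c ⊗ id m)) ⨾ ((b ⊗ id (y′ + m)) ⨾ h)))
      ≈⟨ Tr-cong y (Tr-cong x (≈-trans (≈-sym (⨾-assoc _ _ _)) (⊗-right-first b _ ⟩⨾))) ⟩
    Tr y (Tr x ((b ⊗ (c ⊗ id m)) ⨾ h))
      ≈⟨ swapTr x y _ ((c ⊗ (b ⊗ id m)) ⨾ h′) (((b ⊗ c) ⊗ id m) ⨾ h″)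
          (≋-⨾ (⊗-assoc≋ _ _ _) h″≋) G≋ ⟩
    Tr x (Tr y ((c ⊗ (b ⊗ id m)) ⨾ h′))
      ≈⟨ Tr-cong x (Tr-cong y (≈-trans (≈-sym (⊗-right-first c _) ⟩⨾) (⨾-assoc _ _ _))) ⟩
    Tr x (Tr y ((id y ⊗ (b ⊗ id m)) ⨾ ((c ⊗ id (x′ + m)) ⨾ h′)))
      ≈⟨ Tr-cong x (tightenˡ y _ _) ⟩
    Tr x ((b ⊗ id m) ⨾ Tr y ((c ⊗ id (x′ + m)) ⨾ h′)) ∎
    where
    h′ : Term (y′ + (x′ + m)) (y + (x + n))
    h′ = sw y′ x′ m ⨾ h ⨾ sw x y n
    h″ : Term ((x′ + y′) + m) ((x + y) + n)
    h″ = cast (sym (+-assoc x′ y′ m)) (sym (+-assoc x y n)) h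
    h″≋ : h″ ≋ h
    h″≋ = cast-≋ _ _ _
    G≋ : (c ⊗ (b ⊗ id m)) ⨾ h′ ≋ (σ y x ⊗ id m) ⨾ (((b ⊗ c) ⊗ id m) ⨾ h″) ⨾ (σ x y ⊗ id n)
    G≋ = begin
      (c ⊗ (b ⊗ id m)) ⨾ h′
        ≋⟨ ≋-⨾ (≋-sym (⊗-assoc≋ _ _ _)) (≋-⨾ (≋-⨾ (cast-≋ _ _ _) (≋-sym h″≋)) (cast-≋ _ _ _)) ⟩
      ((c ⊗ b) ⊗ id m) ⨾ ((σ y′ x′ ⊗ id m) ⨾ h″ ⨾ (σ x y ⊗ id n))
        ≈⟨ ≈-trans (≈-sym (⨾-assoc _ _ _)) (≈-sym (⨾-assoc _ _ _) ⟩⨾) ⟩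
      ((c ⊗ b) ⊗ id m) ⨾ (σ y′ x′ ⊗ id m) ⨾ h″ ⨾ (σ x y ⊗ id n)
        ≈⟨ ≈-trans (≈-sym (⨾-⊗id m _ _)) (≈-trans (⊗-cong (σ-natural c b) ≈-refl) (⨾-⊗id m _ _)) ⟩⨾ ⟩⨾ ⟩
      (σ y x ⊗ id m) ⨾ ((b ⊗ c) ⊗ id m) ⨾ h″ ⨾ (σ x y ⊗ id n)
        ≈⟨ ⨾-assoc _ _ _ ⟩⨾ ⟩
      (σ y x ⊗ id m) ⨾ (((b ⊗ c) ⊗ id m) ⨾ h″) ⨾ (σ x y ⊗ id n) ∎

  -- Normal forms

  data Core : ℕ → ℕ → Set where
    perm : ∀ {n} → Lehmer n → Core n n
    box  : ∀ g {m n} → Core (cod g + m) (dom g + n) → Core m n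

  term : ∀ {m n} → Core m n → Term m n
  term (perm p)  = ⌜ p ⌝
  term (box g c) = feed (gen g) (term c)

  loop : Term 0 0
  loop = Tr 1 (id 1)

  loops : ℕ → Term 0 0
  loops zero    = id 0
  loops (suc k) = loop ⊗ loops k

  loops-+ : ∀ j k → loops (j + k) ≈ loops j ⊗ loops k
  loops-+ zero k    = ≈-sym (⊗-identityˡ _)
  loops-+ (suc j) k = ≈-trans (⊗-cong ≈-refl (loops-+ j k)) (≈-sym (≋⇒≈ (⊗-assoc≋ _ _ _)))

  IsCore : ∀ {m n} → Term m n → Set
  IsCore {m} {n} t = Σ[ c ∈ Core m n ] t ≈ term c

  IsCore-≈ : ∀ {m n} {t u : Term m n} → t ≈ u → IsCore t → IsCore u
  IsCore-≈ e (c , eq) = c , ≈-trans (≈-sym e) eq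

  IsCore-≋ : ∀ {m n m′ n′} {t : Term m n} {u : Term m′ n′} → t ≋ u → IsCore t → IsCore u
  IsCore-≋ (≈⇒≋ e) = IsCore-≈ e

  IsCore-perm : ∀ {m n} {t : Term m n} → IsPerm t → IsCore t
  IsCore-perm (_ , p , ≈⇒≋ e) = perm p , e

  IsCore-feed : ∀ g {m n} {t : Term (cod g + m) (dom g + n)} → IsCore t → IsCore (feed (gen g) t)
  IsCore-feed g (c , e) = box g c , feed-cong (gen g) e

  -- Outer permutations enter a feed on the wires that are not fed back, and are finally absorbed by
  -- the innermost permutation.
  IsCore-conj : ∀ {m n p q} {h : Term m n} {k : Term p q} → IsPerm h → IsPerm k →
                (c : Core n p) → IsCore (h ⨾ term c ⨾ k)
  IsCore-conj hp kp (perm p) = IsCore-perm (IsPerm-⨾ (IsPerm-⨾ hp (_ , p , ≋-refl)) kp)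
  IsCore-conj {h = h} {k} hp kp (box g c) = IsCore-≈
    (≈-sym (≈-trans (⨾-feed (gen g) h _ ⟩⨾) (feed-⨾ (gen g) _ k)))
    (IsCore-feed g (IsCore-conj (IsPerm-⊗ (IsPerm-id _) hp) (IsPerm-⊗ (IsPerm-id _) kp) c))

  -- Superposing brings out the feeds of the left factor only. Once the left factor is a
  -- permutation, a symmetry exchanges the factors, and the feeds of the other one come out in the
  -- same way.
  IsCore-⊗ : ∀ {m n p q} (c : Core m n) (d : Core p q) → IsCore (term c ⊗ term d)
  IsCore-⊗ {p = p} {q} c d = ⊗-right c (λ r → base r)
    where
    ⊗-right : ∀ {m n p q} (c : Core m n) {u : Term p q} →
              (∀ {k} (r : Lehmer k) → IsCore (⌜ r ⌝ ⊗ u)) → IsCore (term c ⊗ u)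
    ⊗-right (perm r) h = h r
    ⊗-right (box g c) {u} h = IsCore-≈ (≈-sym (feed-⊗ (gen g) (term c) u (cast-≋ _ _ _)))
      (IsCore-feed g (IsCore-≋ (≋-sym (cast-≋ (+-assoc (cod g) _ _) (+-assoc (dom g) _ _) _)) (⊗-right c h)))

    base : ∀ {k} (r : Lehmer k) → IsCore (⌜ r ⌝ ⊗ term d)
    base {k} r with ⊗-right d {⌜ r ⌝} (λ s → IsCore-perm (IsPerm-⊗ (_ , s , ≋-refl) (_ , r , ≋-refl)))
    ... | c′ , e = IsCore-≈ (begin≈
      σ k p ⨾ term c′ ⨾ σ q k               ≈⟨ ⨾⟨ ≈-sym e ⟩⨾ ⟩
      σ k p ⨾ (term d ⊗ ⌜ r ⌝) ⨾ σ q k      ≈⟨ ≈-sym (σ-natural ⌜ r ⌝ (term d)) ⟩⨾ ⟩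
      (⌜ r ⌝ ⊗ term d) ⨾ σ k q ⨾ σ q k      ≈⟨ ≈-trans (⨾-assoc _ _ _) (⨾⟨ σ-involutive k q) ⟩
      (⌜ r ⌝ ⊗ term d) ⨾ id _               ≈⟨ ⨾-identityʳ _ ⟩
      ⌜ r ⌝ ⊗ term d                        ∎)
      (IsCore-conj (IsPerm-σ k p) (IsPerm-σ q k) c′)

  Normal : ∀ {m n} → Term m n → Set
  Normal {m} {n} t = Σ[ k ∈ ℕ ] Σ[ c ∈ Core m n ] t ≈ loops k ⊗ term c

  Normal-≈ : ∀ {m n} {t u : Term m n} → t ≈ u → Normal t → Normal u
  Normal-≈ e (k , c , eq) = k , c , ≈-trans (≈-sym e) eq

  Normal-core : ∀ {m n} {t : Term m n} → IsCore t → Normal t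
  Normal-core (c , e) = 0 , c , ≈-trans e (≈-sym (⊗-identityˡ _))

  Normal-loops : ∀ {m n} k {t : Term m n} → Normal t → Normal (loops k ⊗ t)
  Normal-loops k (j , c , e) = k + j , c , ≈-trans (⊗-cong ≈-refl e)
    (≈-trans (≈-sym (≋⇒≈ (⊗-assoc≋ _ _ _))) (⊗-cong (≈-sym (loops-+ k j)) ≈-refl))

  Normal-⊗ : ∀ {m n p q} {t : Term m n} {u : Term p q} → Normal t → Normal u → Normal (t ⊗ u)
  Normal-⊗ {t = t} {u} (j , c , e) (k , d , e′) = Normal-≈ (begin≈
    loops j ⊗ (loops k ⊗ (term c ⊗ term d))   ≋⟨ ≋-⊗ ≋-refl (≋-sym (⊗-assoc≋ _ _ _)) ⟩
    loops j ⊗ ((loops k ⊗ term c) ⊗ term d)   ≋⟨ ≋-⊗ ≋-refl (≋-⊗ (≋-sym (scalar-comm _ _)) ≋-refl) ⟩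
    loops j ⊗ ((term c ⊗ loops k) ⊗ term d)   ≋⟨ ≋-⊗ ≋-refl (⊗-assoc≋ _ _ _) ⟩
    loops j ⊗ (term c ⊗ (loops k ⊗ term d))   ≋⟨ ≋-sym (⊗-assoc≋ _ _ _) ⟩
    (loops j ⊗ term c) ⊗ (loops k ⊗ term d)   ≈⟨ ≈-sym (⊗-cong e e′) ⟩
    t ⊗ u                                     ∎)
    (Normal-loops j (Normal-loops k (Normal-core (IsCore-⊗ c d))))

  Normal-conj : ∀ {m n p q} {h : Term m n} {t : Term n p} {k : Term p q} →
                IsPerm h → IsPerm k → Normal t → Normal (h ⨾ t ⨾ k)
  Normal-conj {h = h} {t} {k} hp kp (j , c , e) = Normal-≈
    (≈-sym (≈-trans (≈-trans (⨾⟨ e) (scalar-⨾ʳ _ _ _) ⟩⨾) (scalar-⨾ˡ _ _ _)))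
    (Normal-loops j (Normal-core (IsCore-conj hp kp c)))

  -- The source of loops: a first wire that returns to position 0 is closed to a circle. In every
  -- other case it meets exactly one crossing before `ins j`, and yanking straightens it.
  Normal-Tr₁-perm : ∀ {n} (p : Lehmer (suc n)) → Normal (Tr 1 ⌜ p ⌝)
  Normal-Tr₁-perm (zero ∷ p) = 1 , perm p , (begin≈
    Tr 1 ((id 1 ⊗ ⌜ p ⌝) ⨾ id _)    ≈⟨ Tr-cong 1 (⨾-identityʳ _) ⟩
    Tr 1 (id 1 ⊗ ⌜ p ⌝)             ≈⟨ superposing 1 {0} {0} (id 1) ⌜ p ⌝ ⟩
    loop ⊗ ⌜ p ⌝                    ≈⟨ ⊗-cong (≈-sym (⊗-identityʳ loop)) ≈-refl ⟩
    (loop ⊗ id 0) ⊗ ⌜ p ⌝           ∎)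
  Normal-Tr₁-perm {suc n} (suc j ∷ p) = Normal-≈ (begin≈
    ⌜ p ⌝ ⨾ ins j
      ≈⟨ ≈-sym (⨾-identityʳ _) ⟩⨾ ⟩
    ⌜ p ⌝ ⨾ id _ ⨾ ins j
      ≈⟨ ⨾⟨ ≈-sym (≈-trans (superposing 1 {1} {1} (σ 1 1) (id n)) (≈-trans (⊗-cong (yanking 1) ≈-refl) (⊗-id 1 n))) ⟩⨾ ⟩
    ⌜ p ⌝ ⨾ Tr 1 (σ 1 1 ⊗ id n) ⨾ ins j
      ≈⟨ ≈-sym (tightening 1 ⌜ p ⌝ (σ 1 1 ⊗ id n) (ins j)) ⟩
    Tr 1 ((id 1 ⊗ ⌜ p ⌝) ⨾ (σ 1 1 ⊗ id n) ⨾ (id 1 ⊗ ins j))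
      ≈⟨ Tr-cong 1 (⨾-assoc _ _ _) ⟩
    Tr 1 ((id 1 ⊗ ⌜ p ⌝) ⨾ ins (suc j)) ∎)
    (Normal-core (IsCore-perm (IsPerm-⨾ (_ , p , ≋-refl) (IsPerm-ins j))))

  -- The trace is moved inside a box as the instance `id 1` of `feed-feed`. This leaves a symmetry
  -- on each side, hence the permutations `h` and `k` in the induction.
  Normal-Tr₁-conj : ∀ {m n p q} {h : Term (suc m) p} {k : Term q (suc n)} → IsPerm h → IsPerm k →
                    (c : Core p q) → Normal (Tr 1 (h ⨾ term c ⨾ k))
  Normal-Tr₁-conj hp kp (perm p) with IsPerm-⨾ (IsPerm-⨾ hp (_ , p , ≋-refl)) kp
  ... | _ , r , e = go r e
    where
    go : ∀ {m n k} {t : Term (suc m) (suc n)} (r : Lehmer k) → t ≋ ⌜ r ⌝ → Normal (Tr 1 t)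
    go r (≈⇒≋ e) = Normal-≈ (Tr-cong 1 (≈-sym e)) (Normal-Tr₁-perm r)
  Normal-Tr₁-conj {m} {n} {h = h} {k} hp kp (box g c) = Normal-≈ (begin≈
    feed (gen g) (Tr 1 (S ⨾ H ⨾ term c ⨾ (K ⨾ S′)))
      ≈⟨ feed-cong (gen g) (Tr-cong 1 (≈-trans (≈-sym (⨾-assoc _ _ _))
          (≈-trans (⨾-assoc _ _ _) (⨾-assoc _ _ _) ⟩⨾))) ⟩
    feed (gen g) (Tr 1 (S ⨾ (H ⨾ (term c ⨾ K)) ⨾ S′))
      ≈⟨ feed-cong (gen g) (≈-sym (feed-id 1 _)) ⟩
    feed (gen g) (feed (id 1) (S ⨾ (H ⨾ (term c ⨾ K)) ⨾ S′))
      ≈⟨ ≈-sym (feed-feed (gen g) (id 1) _) ⟩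
    feed (id 1) (feed (gen g) (H ⨾ (term c ⨾ K)))
      ≈⟨ feed-id 1 _ ⟩
    Tr 1 (feed (gen g) (H ⨾ (term c ⨾ K)))
      ≈⟨ Tr-cong 1 (≈-sym (≈-trans (⨾-feed (gen g) h _ ⟩⨾)
          (≈-trans (feed-⨾ (gen g) _ k) (feed-cong (gen g) (⨾-assoc _ _ _))))) ⟩
    Tr 1 (h ⨾ feed (gen g) (term c) ⨾ k) ∎)
    (feedN (Normal-Tr₁-conj (IsPerm-⨾ (IsPerm-sw 1 (cod g) m) (IsPerm-⊗ (IsPerm-id _) hp))
                     (IsPerm-⨾ (IsPerm-⊗ (IsPerm-id _) kp) (IsPerm-sw (dom g) 1 n)) c))
    where
    S = sw 1 (cod g) m
    S′ = sw (dom g) 1 n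
    H = id (cod g) ⊗ h
    K = id (dom g) ⊗ k
    feedN : ∀ {t} → Normal t → Normal (feed (gen g) t)
    feedN (j , c , e) = Normal-≈ (≈-sym (≈-trans (feed-cong (gen g) e) (scalar-feed (gen g) (loops j) _)))
      (Normal-loops j (Normal-core (box g c , ≈-refl)))

  Normal-Tr : ∀ x {m n} {t : Term (x + m) (x + n)} → Normal t → Normal (Tr x t)
  Normal-Tr zero N = Normal-≈ (≈-sym (vanishing₀ _)) N
  Normal-Tr (suc x) {t = t} (k , c , e) = Normal-≈ (≈-sym (vanishing₊ 1 x t))
    (Normal-Tr x (Normal-≈ (≈-sym (≈-trans (Tr-cong 1 e) (scalar-Tr 1 (loops k) (term c))))
      (Normal-loops k (Normal-≈ (Tr-cong 1 (≈-trans (⨾-identityʳ _) (⨾-identityˡ _)))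
        (Normal-Tr₁-conj (IsPerm-id _) (IsPerm-id _) c)))))

  normalise : ∀ {m n} (t : Term m n) → Normal t
  normalise (gen g) = Normal-core (IsCore-≈ (feed-σ (gen g)) (IsCore-feed g (IsCore-perm (IsPerm-σ _ _))))
  normalise (id m)  = Normal-core (IsCore-perm (IsPerm-id m))
  normalise (_⨾_ {m} {n} t u) = Normal-≈ (⨾-as-Tr t u) (Normal-Tr n (Normal-≈ (⨾-identityʳ _)
    (Normal-conj (IsPerm-σ n m) (IsPerm-id _) (Normal-⊗ (normalise t) (normalise u)))))
  normalise (t ⊗ u) = Normal-⊗ (normalise t) (normalise u)
  normalise (σ m n) = Normal-core (IsCore-perm (IsPerm-σ m n))
  normalise (Tr x t) = Normal-Tr x (normalise t)

-- Blocks of finite index sets, and the operations of a PROP apart from its homs.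

copair-elim : ∀ {A B : Set} m {n} (a : Fin m → A) (b : Fin n → A) (h : A → B) (k : Fin (m + n) → B) →
              (∀ i → h (a i) ≡ k (i ↑ˡ n)) → (∀ j → h (b j) ≡ k (m ↑ʳ j)) →
              ∀ i → h (copair m a b i) ≡ k i
copair-elim m a b h k p q = split-elim m _
  (λ i → trans (cong h (copair-ˡ a b i)) (p i)) (λ j → trans (cong h (copair-ʳ a b j)) (q j))

module _ (a b c : ℕ) where
  uncast-ˡ : ∀ i → Fin.cast (sym (+-assoc a b c)) (i ↑ˡ (b + c)) ≡ (i ↑ˡ b) ↑ˡ c
  uncast-ˡ i = toℕ-injective (trans (toℕ-cast (sym (+-assoc a b c)) _)
    (trans (toℕ-↑ˡ i (b + c)) (sym (trans (toℕ-↑ˡ (i ↑ˡ b) c) (toℕ-↑ˡ i b)))))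

  uncast-ᵐ : ∀ j → Fin.cast (sym (+-assoc a b c)) (a ↑ʳ (j ↑ˡ c)) ≡ (a ↑ʳ j) ↑ˡ c
  uncast-ᵐ j = toℕ-injective (trans (toℕ-cast (sym (+-assoc a b c)) _)
    (trans (trans (toℕ-↑ʳ a (j ↑ˡ c)) (cong (a +_) (toℕ-↑ˡ j c)))
      (sym (trans (toℕ-↑ˡ (a ↑ʳ j) c) (toℕ-↑ʳ a j)))))

  uncast-ʳ : ∀ k → Fin.cast (sym (+-assoc a b c)) (a ↑ʳ (b ↑ʳ k)) ≡ (a + b) ↑ʳ k
  uncast-ʳ k = toℕ-injective (trans (toℕ-cast (sym (+-assoc a b c)) _)
    (trans (trans (toℕ-↑ʳ a (b ↑ʳ k)) (cong (a +_) (toℕ-↑ʳ b k)))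
      (sym (trans (toℕ-↑ʳ (a + b) k) (+-assoc a b _)))))

data SingleEdge (a b : ℕ) : ℕ → ℕ → Set where
  single : SingleEdge a b a b

-- The homs and their equality are parameters, so that the operations can be made opaque while the
-- homs remain definitionally cospans.
record PROPStructure {a ℓ} (Hom : ℕ → ℕ → Set a) (_≈_ : ∀ {m n} → Rel (Hom m n) ℓ) : Set (a ⊔ ℓ) where
  infixl 6 _⨾_
  infixl 7 _⊗_
  private
    infix 4 _≈′_
    _≈′_ : ∀ {m n} → Rel (Hom m n) ℓ
    _≈′_ = _≈_
  field
    id  : ∀ m → Hom m m
    _⨾_ : ∀ {m n p} → Hom m n → Hom n p → Hom m p
    _⊗_ : ∀ {m n p q} → Hom m n → Hom p q → Hom (m + p) (n + q)
    σ   : ∀ m n → Hom (m + n) (n + m)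

  cast : ∀ {m m′ n n′} → m ≡ m′ → n ≡ n′ → Hom m n → Hom m′ n′
  cast = subst₂ Hom

  field
    isEquivalence : ∀ {m n} → IsEquivalence (_≈_ {m} {n})

    ⨾-cong      : ∀ {m n p} {f f′ : Hom m n} {g g′ : Hom n p} →
                  f ≈′ f′ → g ≈′ g′ → f ⨾ g ≈′ f′ ⨾ g′
    ⨾-identityˡ : ∀ {m n} (f : Hom m n) → id m ⨾ f ≈′ f
    ⨾-identityʳ : ∀ {m n} (f : Hom m n) → f ⨾ id n ≈′ f
    ⨾-assoc     : ∀ {m n p q} (f : Hom m n) (g : Hom n p) (h : Hom p q) →
                  (f ⨾ g) ⨾ h ≈′ f ⨾ (g ⨾ h)

    ⊗-cong      : ∀ {m n p q} {f f′ : Hom m n} {g g′ : Hom p q} →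
                  f ≈′ f′ → g ≈′ g′ → f ⊗ g ≈′ f′ ⊗ g′
    ⊗-id        : ∀ m n → id m ⊗ id n ≈′ id (m + n)
    ⊗-⨾         : ∀ {m n p m′ n′ p′} (f : Hom m n) (g : Hom n p)
                  (h : Hom m′ n′) (k : Hom n′ p′) →
                  (f ⨾ g) ⊗ (h ⨾ k) ≈′ (f ⊗ h) ⨾ (g ⊗ k)
    ⊗-identityˡ : ∀ {m n} (f : Hom m n) → id 0 ⊗ f ≈′ f
    ⊗-identityʳ : ∀ {m n} (f : Hom m n) →
                  cast (+-identityʳ m) (+-identityʳ n) (f ⊗ id 0) ≈′ f
    ⊗-assoc     : ∀ {m n p q r s} (f : Hom m n) (g : Hom p q) (h : Hom r s) →
                  cast (+-assoc m p r) (+-assoc n q s) ((f ⊗ g) ⊗ h) ≈′ f ⊗ (g ⊗ h)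

    σ-natural   : ∀ {m n p q} (f : Hom m n) (g : Hom p q) →
                  (f ⊗ g) ⨾ σ n q ≈′ σ m p ⨾ (g ⊗ f)
    σ-involutive : ∀ m n → σ m n ⨾ σ n m ≈′ id (m + n)
    σ-hexagon   : ∀ m n p →
                  cast (+-assoc m n p) (sym (+-assoc n p m))
                    ((σ m n ⊗ id p) ⨾ cast (sym (+-assoc n m p)) refl (id n ⊗ σ m p))
                  ≈′ σ m (n + p)

structure : ∀ {a ℓ} (P : PROP a ℓ) → PROPStructure (PROP.Hom P) (PROP._≈_ P)
structure P = record { PROP P }

fromStructure : ∀ {a ℓ} {Hom : ℕ → ℕ → Set a} {_≈_ : ∀ {m n} → Rel (Hom m n) ℓ} →
                PROPStructure Hom _≈_ → PROP a ℓ
fromStructure {Hom = Hom} {_≈_} S = record { Hom = Hom ; _≈_ = _≈_ ; PROPStructure S }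

-- The trace on cospans, and presentations of glued cospans.

module Trace (𝓢 : Generators) where
  open Generators 𝓢
  open Labelled 𝓢
  module C = Cospans 𝓢
  open C using (Cospan; _≈_; Iso; mkIso; unIso; ≈-sym; identity; symmetry; swapFin-↑ˡ; swapFin-↑ʳ)
  open Cospan

  -- Opaque, because comparing unfolded composites is prohibitively slow.
  opaque
    cspStructure : PROPStructure Cospan _≈_
    cspStructure = structure (Csp 𝓢)

  open PROPStructure cspStructure using (id; _⨾_; _⊗_; σ; cast)

  opaque
    unfolding cspStructure

    id≡ : ∀ m → id m ≡ identity m
    id≡ m = refl

    ⨾≡ : ∀ {m n p} (X : Cospan m n) (Y : Cospan n p) → X ⨾ Y ≡ X C.⨾ Y
    ⨾≡ X Y = refl

    ⊗≡ : ∀ {m n p q} (X : Cospan m n) (Y : Cospan p q) → X ⊗ Y ≡ X C.⊗ Y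
    ⊗≡ X Y = refl

    σ≡ : ∀ m n → σ m n ≡ symmetry m n
    σ≡ m n = refl

  module Closure x {m n} (X : Cospan (x + m) (x + n)) = Quotient
    (quotient (finite⇒≟ (proj₁ (finite X))) (λ i → leftV X (i ↑ˡ m)) (λ i → rightV X (i ↑ˡ n)))

  opaque
    Tr : ∀ x {m n} → Cospan (x + m) (x + n) → Cospan m n
    Tr x {m} {n} X = record
      { apex = F
      ; finite = finite-quotient (proj₁ (finite X)) (λ i → leftV X (i ↑ˡ m)) (λ i → rightV X (i ↑ˡ n)) ,
                 proj₂ (finite X)
      ; left = vertices F (λ i → ⟦ leftV X (x ↑ʳ i) ⟧)
      ; right = vertices F (λ i → ⟦ rightV X (x ↑ʳ i) ⟧) }
      where
      open Closure x X
      F : LHyp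
      F = record
        { graph = record { V = Class ; E = E X ; s = λ e i → ⟦ s X e i ⟧ ; t = λ e j → ⟦ t X e j ⟧ }
        ; label = record { onV = λ _ → tt ; onE = labelE X ; on-s = λ _ _ → refl ; on-t = λ _ _ → refl } }

  -- A cospan before gluing. `A` holds the vertices still to be identified, and the identifications
  -- are given through the maps that respect them, so that nested gluings become a conjunction of
  -- conditions on one map.
  record Shape (m n : ℕ) : Set₁ where
    field
      A      : Set
      Resp   : ∀ {B : Set} → (A → B) → Set
      left′  : Fin m → A
      right′ : Fin n → A
      E′     : ℕ → ℕ → Set
      s′     : ∀ {k l} → E′ k l → Fin k → A
      t′     : ∀ {k l} → E′ k l → Fin l → A
      label′ : ∀ {k l} → E′ k l → SignatureEdge 𝓢 k l
  open Shape

  -- The vertices of X as the universal recipient of a map from A satisfying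
  -- Resp, with lifts to A of the legs and tentacles.
  record Pres {m n} (X : Cospan m n) (S : Shape m n) : Set₁ where
    field
      Resp-∘ : ∀ {B C : Set} (g : B → C) {h : A S → B} → Resp S h → Resp S (g ∘ h)
      q      : A S → V X
      q-resp : Resp S q
      rep    : V X → A S
      q-rep  : ∀ v → q (rep v) ≡ v
      rep-q  : ∀ {B : Set} (h : A S → B) → Resp S h → ∀ a → h (rep (q a)) ≡ h a
      q-left  : ∀ i → q (left′ S i) ≡ leftV X i
      q-right : ∀ i → q (right′ S i) ≡ rightV X i
      edges   : ∀ {k l} → E′ S k l ↔ E X k l
    onE : ∀ {k l} → E′ S k l → E X k l
    onE = Inverse.to edges
    onE⁻¹ : ∀ {k l} → E X k l → E′ S k l
    onE⁻¹ = Inverse.from edges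
    onE-onE⁻¹ : ∀ {k l} (e : E X k l) → onE (onE⁻¹ e) ≡ e
    onE-onE⁻¹ = Inverse.strictlyInverseˡ edges
    onE⁻¹-onE : ∀ {k l} (e : E′ S k l) → onE⁻¹ (onE e) ≡ e
    onE⁻¹-onE = Inverse.strictlyInverseʳ edges
    field
      q-s     : ∀ {k l} (e : E′ S k l) i → q (s′ S e i) ≡ s X (onE e) i
      q-t     : ∀ {k l} (e : E′ S k l) j → q (t′ S e j) ≡ t X (onE e) j
      q-label : ∀ {k l} (e : E′ S k l) → labelE X (onE e) ≡ label′ S e
  open Pres

  shape : ∀ {m n} {X : Cospan m n} {S : Shape m n} → Pres X S → Shape m n
  shape {S = S} _ = S

  selfˢ : ∀ {m n} (X : Cospan m n) → Shape m n
  selfˢ X = record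
    { A = V X ; Resp = λ _ → ⊤ ; left′ = leftV X ; right′ = rightV X ; E′ = E X ; s′ = s X ; t′ = t X ; label′ = labelE X }

  self : ∀ {m n} (X : Cospan m n) → Pres X (selfˢ X)
  self X = record
    { Resp-∘ = λ _ _ → tt ; q = λ v → v ; q-resp = tt
    ; rep = λ v → v ; q-rep = λ _ → refl ; rep-q = λ _ _ _ → refl
    ; q-left = λ _ → refl ; q-right = λ _ → refl ; edges = ↔-id _
    ; q-s = λ _ _ → refl ; q-t = λ _ _ → refl ; q-label = λ _ → refl }

  infixl 6 _⨾ˢ_ _⨾ᵖ_
  infixl 7 _⊗ˢ_ _⊗ᵖ_

  _⨾ˢ_ : ∀ {m n p} → Shape m n → Shape n p → Shape m p
  S ⨾ˢ T = record
    { A = A S ⊎ A T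
    ; Resp = λ h → Resp S (h ∘ inj₁) × Resp T (h ∘ inj₂) × (∀ i → h (inj₁ (right′ S i)) ≡ h (inj₂ (left′ T i)))
    ; left′ = inj₁ ∘ left′ S ; right′ = inj₂ ∘ right′ T
    ; E′ = λ k l → E′ S k l ⊎ E′ T k l
    ; s′ = λ { (inj₁ e) → inj₁ ∘ s′ S e ; (inj₂ e) → inj₂ ∘ s′ T e }
    ; t′ = λ { (inj₁ e) → inj₁ ∘ t′ S e ; (inj₂ e) → inj₂ ∘ t′ T e }
    ; label′ = [ label′ S , label′ T ]′ }

  _⊗ˢ_ : ∀ {m n p r} → Shape m n → Shape p r → Shape (m + p) (n + r)
  _⊗ˢ_ {m} {n} S T = record
    { A = A S ⊎ A T
    ; Resp = λ h → Resp S (h ∘ inj₁) × Resp T (h ∘ inj₂)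
    ; left′ = copair m (inj₁ ∘ left′ S) (inj₂ ∘ left′ T)
    ; right′ = copair n (inj₁ ∘ right′ S) (inj₂ ∘ right′ T)
    ; E′ = λ k l → E′ S k l ⊎ E′ T k l
    ; s′ = λ { (inj₁ e) → inj₁ ∘ s′ S e ; (inj₂ e) → inj₂ ∘ s′ T e }
    ; t′ = λ { (inj₁ e) → inj₁ ∘ t′ S e ; (inj₂ e) → inj₂ ∘ t′ T e }
    ; label′ = [ label′ S , label′ T ]′ }

  Trˢ : ∀ x {m n} → Shape (x + m) (x + n) → Shape m n
  Trˢ x {m} {n} S = record
    { A = A S
    ; Resp = λ h → Resp S h × (∀ i → h (left′ S (i ↑ˡ m)) ≡ h (right′ S (i ↑ˡ n)))
    ; left′ = λ i → left′ S (x ↑ʳ i) ; right′ = λ i → right′ S (x ↑ʳ i)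
    ; E′ = E′ S ; s′ = s′ S ; t′ = t′ S ; label′ = label′ S }

  castˢ : ∀ {m m′ n n′} → m ≡ m′ → n ≡ n′ → Shape m n → Shape m′ n′
  castˢ p r S = record
    { A = A S ; Resp = Resp S ; left′ = left′ S ∘ Fin.cast (sym p) ; right′ = right′ S ∘ Fin.cast (sym r)
    ; E′ = E′ S ; s′ = s′ S ; t′ = t′ S ; label′ = label′ S }

  module _ {m n p r} (S : Shape m n) (T : Shape p r) where
    leftˡ : ∀ i → left′ (S ⊗ˢ T) (i ↑ˡ p) ≡ inj₁ (left′ S i)
    leftˡ i = copair-ˡ {m = m} {p} (inj₁ ∘ left′ S) (inj₂ ∘ left′ T) i

    leftʳ : ∀ j → left′ (S ⊗ˢ T) (m ↑ʳ j) ≡ inj₂ (left′ T j)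
    leftʳ j = copair-ʳ {m = m} {p} (inj₁ ∘ left′ S) (inj₂ ∘ left′ T) j

    rightˡ : ∀ i → right′ (S ⊗ˢ T) (i ↑ˡ r) ≡ inj₁ (right′ S i)
    rightˡ i = copair-ˡ {m = n} {r} (inj₁ ∘ right′ S) (inj₂ ∘ right′ T) i

    rightʳ : ∀ j → right′ (S ⊗ˢ T) (n ↑ʳ j) ≡ inj₂ (right′ T j)
    rightʳ j = copair-ʳ {m = n} {r} (inj₁ ∘ right′ S) (inj₂ ∘ right′ T) j

    module _ {B : Set} (h : A S ⊎ A T → B) where
      left-elim : (k : Fin (m + p) → B) → (∀ i → h (inj₁ (left′ S i)) ≡ k (i ↑ˡ p)) →
                  (∀ j → h (inj₂ (left′ T j)) ≡ k (m ↑ʳ j)) → ∀ i → h (left′ (S ⊗ˢ T) i) ≡ k i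
      left-elim k = copair-elim m (inj₁ ∘ left′ S) (inj₂ ∘ left′ T) h k

      right-elim : (k : Fin (n + r) → B) → (∀ i → h (inj₁ (right′ S i)) ≡ k (i ↑ˡ r)) →
                   (∀ j → h (inj₂ (right′ T j)) ≡ k (n ↑ʳ j)) → ∀ i → h (right′ (S ⊗ˢ T) i) ≡ k i
      right-elim k = copair-elim n (inj₁ ∘ right′ S) (inj₂ ∘ right′ T) h k

  opaque
    unfolding Tr

    -- Presentations are stable under composition, tensor and trace. An iterated composite is thus
    -- presented by the disjoint union of the raw vertices of its parts, however the quotients are
    -- nested.
    _⨾ᵖ_ : ∀ {m n p} {X : Cospan m n} {Y : Cospan n p} {S : Shape m n} {T : Shape n p} →
           Pres X S → Pres Y T → Pres (X ⨾ Y) (S ⨾ˢ T)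
    _⨾ᵖ_ {n = n} {X = X} {Y} {S} {T} P Q = subst (λ Z → Pres Z (S ⨾ˢ T)) (sym (⨾≡ X Y)) record
      { Resp-∘ = λ { g (a , b , c) → Resp-∘ P g a , Resp-∘ Q g b , λ i → cong g (c i) }
      ; q = qq
      ; q-resp = Resp-∘ P Q.in₁ (q-resp P) , Resp-∘ Q Q.in₂ (q-resp Q) ,
          λ i → trans (cong Q.in₁ (q-right P i)) (trans (Q.⟦⟧-glue i) (cong Q.in₂ (sym (q-left Q i))))
      ; rep = λ c → rr (Q.rep c)
      ; q-rep = λ c → trans (qq-rr (Q.rep c)) (Q.⟦rep⟧ c)
      ; rep-q = λ { h (a , b , c) z → trans (back h (a , b , c) z) (rr-q h (a , b) z) }
      ; q-left = λ i → cong Q.in₁ (q-left P i) ; q-right = λ i → cong Q.in₂ (q-right Q i)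
      ; edges = edges P ⊎-↔ edges Q
      ; q-s = λ { (inj₁ e) i → cong Q.in₁ (q-s P e i) ; (inj₂ e) i → cong Q.in₂ (q-s Q e i) }
      ; q-t = λ { (inj₁ e) i → cong Q.in₁ (q-t P e i) ; (inj₂ e) i → cong Q.in₂ (q-t Q e i) }
      ; q-label = λ { (inj₁ e) → q-label P e ; (inj₂ e) → q-label Q e } }
      where
      module Q = C.Composite X Y
      qq : A S ⊎ A T → Q.Class
      qq = [ Q.in₁ ∘ q P , Q.in₂ ∘ q Q ]′
      rr : V X ⊎ V Y → A S ⊎ A T
      rr = Sum.map (rep P) (rep Q)
      qq-rr : ∀ z → qq (rr z) ≡ Q.⟦ z ⟧
      qq-rr (inj₁ x) = cong Q.in₁ (q-rep P x)
      qq-rr (inj₂ y) = cong Q.in₂ (q-rep Q y)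
      rr-q : ∀ {B : Set} (h : A S ⊎ A T → B) → Resp S (h ∘ inj₁) × Resp T (h ∘ inj₂) →
             ∀ z → h (rr (Sum.map (q P) (q Q) z)) ≡ h z
      rr-q h (a , b) (inj₁ x) = rep-q P (h ∘ inj₁) a x
      rr-q h (a , b) (inj₂ y) = rep-q Q (h ∘ inj₂) b y
      back : ∀ {B : Set} (h : A S ⊎ A T → B) → Resp (S ⨾ˢ T) h →
             ∀ z → h (rr (Q.rep (qq z))) ≡ h (rr (Sum.map (q P) (q Q) z))
      back h (a , b , c) z = go z
        where
        β : ∀ z → h (rr (Q.rep Q.⟦ z ⟧)) ≡ h (rr z)
        β = Q.rec-β (h ∘ rr) λ i →
          trans (cong (h ∘ inj₁ ∘ rep P) (sym (q-right P i))) (trans (rep-q P (h ∘ inj₁) a (right′ S i))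
          (trans (c i) (trans (sym (rep-q Q (h ∘ inj₂) b (left′ T i))) (cong (h ∘ inj₂ ∘ rep Q) (q-left Q i)))))
        go : ∀ z → h (rr (Q.rep (qq z))) ≡ h (rr (Sum.map (q P) (q Q) z))
        go (inj₁ x) = β (inj₁ (q P x))
        go (inj₂ y) = β (inj₂ (q Q y))

    _⊗ᵖ_ : ∀ {m n p r} {X : Cospan m n} {Y : Cospan p r} {S : Shape m n} {T : Shape p r} →
           Pres X S → Pres Y T → Pres (X ⊗ Y) (S ⊗ˢ T)
    _⊗ᵖ_ {m} {n} {X = X} {Y} {S} {T} P Q = subst (λ Z → Pres Z (S ⊗ˢ T)) (sym (⊗≡ X Y)) record
      { Resp-∘ = λ { g (a , b) → Resp-∘ P g a , Resp-∘ Q g b }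
      ; q = Sum.map (q P) (q Q)
      ; q-resp = Resp-∘ P inj₁ (q-resp P) , Resp-∘ Q inj₂ (q-resp Q)
      ; rep = Sum.map (rep P) (rep Q)
      ; q-rep = λ { (inj₁ x) → cong inj₁ (q-rep P x) ; (inj₂ y) → cong inj₂ (q-rep Q y) }
      ; rep-q = λ { h (a , b) (inj₁ x) → rep-q P (h ∘ inj₁) a x ; h (a , b) (inj₂ y) → rep-q Q (h ∘ inj₂) b y }
      ; q-left = copair-elim m (inj₁ ∘ left′ S) (inj₂ ∘ left′ T) (Sum.map (q P) (q Q)) (leftV (X C.⊗ Y))
          (λ i → trans (cong inj₁ (q-left P i)) (sym (copair-ˡ (inj₁ ∘ leftV X) (inj₂ ∘ leftV Y) i)))
          (λ j → trans (cong inj₂ (q-left Q j)) (sym (copair-ʳ (inj₁ ∘ leftV X) (inj₂ ∘ leftV Y) j)))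
      ; q-right = copair-elim n (inj₁ ∘ right′ S) (inj₂ ∘ right′ T) (Sum.map (q P) (q Q)) (rightV (X C.⊗ Y))
          (λ i → trans (cong inj₁ (q-right P i)) (sym (copair-ˡ (inj₁ ∘ rightV X) (inj₂ ∘ rightV Y) i)))
          (λ j → trans (cong inj₂ (q-right Q j)) (sym (copair-ʳ (inj₁ ∘ rightV X) (inj₂ ∘ rightV Y) j)))
      ; edges = edges P ⊎-↔ edges Q
      ; q-s = λ { (inj₁ e) i → cong inj₁ (q-s P e i) ; (inj₂ e) i → cong inj₂ (q-s Q e i) }
      ; q-t = λ { (inj₁ e) i → cong inj₁ (q-t P e i) ; (inj₂ e) i → cong inj₂ (q-t Q e i) }
      ; q-label = λ { (inj₁ e) → q-label P e ; (inj₂ e) → q-label Q e } }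

    Trᵖ : ∀ x {m n} {X : Cospan (x + m) (x + n)} {S : Shape (x + m) (x + n)} → Pres X S → Pres (Tr x X) (Trˢ x S)
    Trᵖ x {m} {n} {X} {S} P = record
      { Resp-∘ = λ { g (a , b) → Resp-∘ P g a , λ i → cong g (b i) }
      ; q = λ a → Q.⟦ q P a ⟧
      ; q-resp = Resp-∘ P Q.⟦_⟧ (q-resp P) , λ i →
          trans (cong Q.⟦_⟧ (q-left P (i ↑ˡ m))) (trans (Q.⟦⟧-glue i) (cong Q.⟦_⟧ (sym (q-right P (i ↑ˡ n)))))
      ; rep = λ c → rep P (Q.rep c)
      ; q-rep = λ c → trans (cong Q.⟦_⟧ (q-rep P _)) (Q.⟦rep⟧ c)
      ; rep-q = λ { h (a , b) z → trans (Q.rec-β (h ∘ rep P) (λ i →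
            trans (cong (h ∘ rep P) (sym (q-left P (i ↑ˡ m)))) (trans (rep-q P h a _)
            (trans (b i) (trans (sym (rep-q P h a _)) (cong (h ∘ rep P) (q-right P (i ↑ˡ n)))))))
          (q P z)) (rep-q P h a z) }
      ; q-left = λ i → cong Q.⟦_⟧ (q-left P (x ↑ʳ i)) ; q-right = λ i → cong Q.⟦_⟧ (q-right P (x ↑ʳ i))
      ; edges = edges P
      ; q-s = λ e i → cong Q.⟦_⟧ (q-s P e i) ; q-t = λ e j → cong Q.⟦_⟧ (q-t P e j) ; q-label = q-label P }
      where module Q = Closure x X

  idᵖ : ∀ m → Pres (id m) (selfˢ (identity m))
  idᵖ m = subst (λ Z → Pres Z (selfˢ (identity m))) (sym (id≡ m)) (self (identity m))

  σᵖ : ∀ m n → Pres (σ m n) (selfˢ (symmetry m n))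
  σᵖ m n = subst (λ Z → Pres Z (selfˢ (symmetry m n))) (sym (σ≡ m n)) (self (symmetry m n))

  castᵖ : ∀ {m m′ n n′} (p : m ≡ m′) (r : n ≡ n′) {X : Cospan m n} {S : Shape m n} →
          Pres X S → Pres (cast p r X) (castˢ p r S)
  castᵖ refl refl {X} {S} P = record
    { Resp-∘ = Resp-∘ P ; q = q P ; q-resp = q-resp P ; rep = rep P ; q-rep = q-rep P ; rep-q = rep-q P
    ; q-left = λ i → trans (cong (q P ∘ left′ S) (cast-is-id refl i)) (q-left P i)
    ; q-right = λ i → trans (cong (q P ∘ right′ S) (cast-is-id refl i)) (q-right P i)
    ; edges = edges P ; q-s = q-s P ; q-t = q-t P ; q-label = q-label P }

  -- Maps between raw vertices, whose equations are required only after `q`. An isomorphism of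
  -- quotients can then be given on representatives that are not in bijection.
  record PresIso {m n} {X Y : Cospan m n} {S T : Shape m n} (P : Pres X S) (Q : Pres Y T) : Set where
    field
      to      : A S → A T
      from    : A T → A S
      to-resp   : Resp S (q Q ∘ to)
      from-resp : Resp T (q P ∘ from)
      to-from : ∀ a → q Q (to (from a)) ≡ q Q a
      from-to : ∀ a → q P (from (to a)) ≡ q P a
      eTo     : ∀ {k l} → E′ S k l → E′ T k l
      eFrom   : ∀ {k l} → E′ T k l → E′ S k l
      e-tf    : ∀ {k l} (e : E′ T k l) → eTo (eFrom e) ≡ e
      e-ft    : ∀ {k l} (e : E′ S k l) → eFrom (eTo e) ≡ e
      to-l    : ∀ {k l} (e : E′ S k l) → label′ T (eTo e) ≡ label′ S e
      to-s    : ∀ {k l} (e : E′ S k l) i → q Q (to (s′ S e i)) ≡ q Q (s′ T (eTo e) i)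
      to-t    : ∀ {k l} (e : E′ S k l) j → q Q (to (t′ S e j)) ≡ q Q (t′ T (eTo e) j)
      to-left  : ∀ i → q Q (to (left′ S i)) ≡ q Q (left′ T i)
      to-right : ∀ i → q Q (to (right′ S i)) ≡ q Q (right′ T i)

  pres⇒iso : ∀ {m n} {X Y : Cospan m n} {S T : Shape m n} {P : Pres X S} {Q : Pres Y T} → PresIso P Q → Iso X Y
  pres⇒iso {X = X} {Y} {S} {T} {P} {Q} I = record
    { vTo = vTo ; vFrom = vFrom
    ; v-tf = λ y → trans (cong (λ y → vTo (vFrom y)) (sym (q-rep Q y)))
        (trans (cong vTo (vFrom-q (rep Q y))) (trans (vTo-q _) (trans (to-from _) (q-rep Q y))))
    ; v-ft = λ x → trans (cong (λ x → vFrom (vTo x)) (sym (q-rep P x)))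
        (trans (cong vFrom (vTo-q (rep P x))) (trans (vFrom-q _) (trans (from-to _) (q-rep P x))))
    ; eTo = onE Q ∘ eTo ∘ onE⁻¹ P ; eFrom = onE P ∘ eFrom ∘ onE⁻¹ Q
    ; e-tf = λ e → trans (cong (onE Q ∘ eTo) (onE⁻¹-onE P _)) (trans (cong (onE Q) (e-tf _)) (onE-onE⁻¹ Q e))
    ; e-ft = λ e → trans (cong (onE P ∘ eFrom) (onE⁻¹-onE Q _)) (trans (cong (onE P) (e-ft _)) (onE-onE⁻¹ P e))
    ; to-s = λ e i → via (s′ S (onE⁻¹ P e) i) (trans (q-s P _ i) (cong (λ e → s X e i) (onE-onE⁻¹ P e)))
        (trans (to-s _ i) (q-s Q _ i))
    ; to-t = λ e j → via (t′ S (onE⁻¹ P e) j) (trans (q-t P _ j) (cong (λ e → t X e j) (onE-onE⁻¹ P e)))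
        (trans (to-t _ j) (q-t Q _ j))
    ; to-l = λ e → trans (q-label Q _) (trans (to-l _) (trans (sym (q-label P _)) (cong (labelE X) (onE-onE⁻¹ P e))))
    ; to-left = λ i → via (left′ S i) (q-left P i) (trans (to-left i) (q-left Q i))
    ; to-right = λ i → via (right′ S i) (q-right P i) (trans (to-right i) (q-right Q i)) }
    where
    open PresIso I
    vTo : V X → V Y
    vTo v = q Q (to (rep P v))
    vFrom : V Y → V X
    vFrom v = q P (from (rep Q v))
    vTo-q : ∀ a → vTo (q P a) ≡ q Q (to a)
    vTo-q = rep-q P (q Q ∘ to) to-resp
    vFrom-q : ∀ a → vFrom (q Q a) ≡ q P (from a)
    vFrom-q = rep-q Q (q P ∘ from) from-resp
    via : ∀ {x y} a → q P a ≡ x → q Q (to a) ≡ y → vTo x ≡ y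
    via a refl p = trans (vTo-q a) p

  pres≈ : ∀ {m n} {X Y : Cospan m n} {S T : Shape m n} {P : Pres X S} {Q : Pres Y T} → PresIso P Q → X ≈ Y
  pres≈ I = mkIso (pres⇒iso I)

  Tr-cong : ∀ x {m n} {X Y : Cospan (x + m) (x + n)} → X ≈ Y → Tr x X ≈ Tr x Y
  Tr-cong x {m} {n} {X} {Y} p = pres≈ {P = P} {Q} record
    { to = I.vTo ; from = I.vFrom
    ; to-resp = tt , λ i → trans (cong (q Q) (I.to-left (i ↑ˡ m)))
        (trans (proj₂ (q-resp Q) i) (cong (q Q) (sym (I.to-right (i ↑ˡ n)))))
    ; from-resp = tt , λ i → trans (cong (q P) (J.to-left (i ↑ˡ m)))
        (trans (proj₂ (q-resp P) i) (cong (q P) (sym (J.to-right (i ↑ˡ n)))))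
    ; to-from = λ a → cong (q Q) (I.v-tf a) ; from-to = λ a → cong (q P) (I.v-ft a)
    ; eTo = I.eTo ; eFrom = I.eFrom ; e-tf = I.e-tf ; e-ft = I.e-ft ; to-l = I.to-l
    ; to-s = λ e i → cong (q Q) (I.to-s e i) ; to-t = λ e i → cong (q Q) (I.to-t e i)
    ; to-left = λ i → cong (q Q) (I.to-left (x ↑ʳ i))
    ; to-right = λ i → cong (q Q) (I.to-right (x ↑ʳ i)) }
    where
    module I = Iso (unIso p)
    module J = Iso (unIso (≈-sym p))
    P = Trᵖ x (self X)
    Q = Trᵖ x (self Y)

  vanishing₀ : ∀ {m n} (X : Cospan m n) → Tr 0 X ≈ X
  vanishing₀ X = pres≈ {P = Trᵖ 0 (self X)} {self X} record
    { to = λ v → v ; from = λ v → v ; to-resp = tt , (λ ()) ; from-resp = tt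
    ; to-from = λ _ → refl ; from-to = λ _ → refl
    ; eTo = λ e → e ; eFrom = λ e → e ; e-tf = λ _ → refl ; e-ft = λ _ → refl ; to-l = λ _ → refl
    ; to-s = λ _ _ → refl ; to-t = λ _ _ → refl ; to-left = λ _ → refl ; to-right = λ _ → refl }

  -- Closing the first block glues each of its wires to the wire of the second block with the same
  -- index, so the two blocks fold onto one.
  yanking : ∀ x → Tr x (σ x x) ≈ id x
  yanking x = pres≈ {P = P} {idᵖ x} record
    { to = fold ; from = x ↑ʳ_
    ; to-resp = tt , λ i → cong (q (idᵖ x)) (trans (foldˡ i) (sym (trans (cong fold (swapFin-↑ˡ x x i)) (foldʳ i))))
    ; from-resp = tt
    ; to-from = λ i → cong (q (idᵖ x)) (foldʳ i)
    ; from-to = copair-elim x (λ i → i) (λ i → i) (λ i → q P (x ↑ʳ i)) (q P)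
        (λ i → sym (trans (proj₂ (q-resp P) i) (cong (q P) (swapFin-↑ˡ x x i)))) (λ _ → refl)
    ; eTo = λ e → e ; eFrom = λ e → e ; e-tf = λ _ → refl ; e-ft = λ _ → refl ; to-l = λ _ → refl
    ; to-s = λ () ; to-t = λ ()
    ; to-left = λ i → cong (q (idᵖ x)) (foldʳ i)
    ; to-right = λ i → cong (q (idᵖ x)) (trans (cong fold (swapFin-↑ʳ x x i)) (foldˡ i)) }
    where
    P = Trᵖ x (σᵖ x x)
    fold : Fin (x + x) → Fin x
    fold = copair x (λ i → i) (λ i → i)
    foldˡ : ∀ i → fold (i ↑ˡ x) ≡ i
    foldˡ = copair-ˡ {n = x} (λ i → i) (λ i → i)
    foldʳ : ∀ i → fold (x ↑ʳ i) ≡ i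
    foldʳ = copair-ʳ {m = x} (λ i → i) (λ i → i)

  vanishing₊ : ∀ x y {m n} (X : Cospan ((x + y) + m) ((x + y) + n)) →
               Tr (x + y) X ≈ Tr y (Tr x (cast (+-assoc x y m) (+-assoc x y n) X))
  vanishing₊ x y {m} {n} X = pres≈ {P = P} {Q} record
    { to = λ v → v ; from = λ v → v
    ; to-resp = tt , split-elim x _
        (λ i → trans (cong (q Q ∘ leftV X) (sym (uncast-ˡ x y m i))) (trans (proj₂ (proj₁ (q-resp Q)) i)
          (cong (q Q ∘ rightV X) (uncast-ˡ x y n i))))
        (λ j → trans (cong (q Q ∘ leftV X) (sym (uncast-ᵐ x y m j))) (trans (proj₂ (q-resp Q) j)
          (cong (q Q ∘ rightV X) (uncast-ᵐ x y n j))))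
    ; from-resp = (tt , λ i → trans (cong (q P ∘ leftV X) (uncast-ˡ x y m i)) (trans (proj₂ (q-resp P) (i ↑ˡ y))
          (cong (q P ∘ rightV X) (sym (uncast-ˡ x y n i))))) ,
        λ j → trans (cong (q P ∘ leftV X) (uncast-ᵐ x y m j)) (trans (proj₂ (q-resp P) (x ↑ʳ j))
          (cong (q P ∘ rightV X) (sym (uncast-ᵐ x y n j))))
    ; to-from = λ _ → refl ; from-to = λ _ → refl
    ; eTo = λ e → e ; eFrom = λ e → e ; e-tf = λ _ → refl ; e-ft = λ _ → refl ; to-l = λ _ → refl
    ; to-s = λ _ _ → refl ; to-t = λ _ _ → refl
    ; to-left = λ i → cong (q Q ∘ leftV X) (sym (uncast-ʳ x y m i))
    ; to-right = λ i → cong (q Q ∘ rightV X) (sym (uncast-ʳ x y n i)) }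
    where
    P = Trᵖ (x + y) (self X)
    Q = Trᵖ y {m} {n} (Trᵖ x (castᵖ (+-assoc x y m) (+-assoc x y n) (self X)))

  superposing : ∀ x {m n p r} (X : Cospan (x + m) (x + n)) (Y : Cospan p r) →
                Tr x (cast (+-assoc x m p) (+-assoc x n r) (X ⊗ Y)) ≈ Tr x X ⊗ Y
  superposing x {m} {n} {p} {r} X Y = pres≈ {P = P} {Q} record
    { to = λ v → v ; from = λ v → v
    ; to-resp = (tt , tt) , λ i → trans (cong (q Q) (lˡ i)) (trans (proj₂ (proj₁ (q-resp Q)) i) (cong (q Q) (sym (rˡ i))))
    ; from-resp = (tt , λ i → trans (cong (q P) (sym (lˡ i))) (trans (proj₂ (q-resp P) i) (cong (q P) (rˡ i)))) , tt
    ; to-from = λ _ → refl ; from-to = λ _ → refl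
    ; eTo = λ e → e ; eFrom = λ e → e ; e-tf = λ _ → refl ; e-ft = λ _ → refl
    ; to-l = λ { (inj₁ _) → refl ; (inj₂ _) → refl }
    ; to-s = λ { (inj₁ _) _ → refl ; (inj₂ _) _ → refl } ; to-t = λ { (inj₁ _) _ → refl ; (inj₂ _) _ → refl }
    ; to-left = split-elim m _
        (λ i → cong (q Q) (trans (cong L (uncast-ᵐ x m p i)) (trans (leftˡ S T (x ↑ʳ i))
          (sym (leftˡ (Trˢ x S) T i)))))
        (λ j → cong (q Q) (trans (cong L (uncast-ʳ x m p j)) (trans (leftʳ S T j)
          (sym (leftʳ (Trˢ x S) T j)))))
    ; to-right = split-elim n _
        (λ i → cong (q Q) (trans (cong R (uncast-ᵐ x n r i)) (trans (rightˡ S T (x ↑ʳ i))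
          (sym (rightˡ (Trˢ x S) T i)))))
        (λ j → cong (q Q) (trans (cong R (uncast-ʳ x n r j)) (trans (rightʳ S T j)
          (sym (rightʳ (Trˢ x S) T j))))) }
    where
    P = Trᵖ x (castᵖ (+-assoc x m p) (+-assoc x n r) (self X ⊗ᵖ self Y))
    Q = Trᵖ x (self X) ⊗ᵖ self Y
    S = selfˢ X
    T = selfˢ Y
    L : Fin ((x + m) + p) → V X ⊎ V Y
    L = left′ (S ⊗ˢ T)
    R : Fin ((x + n) + r) → V X ⊎ V Y
    R = right′ (S ⊗ˢ T)
    lˡ : ∀ i → L (Fin.cast (sym (+-assoc x m p)) (i ↑ˡ (m + p))) ≡ inj₁ (leftV X (i ↑ˡ m))
    lˡ i = trans (cong L (uncast-ˡ x m p i)) (leftˡ S T (i ↑ˡ m))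
    rˡ : ∀ i → R (Fin.cast (sym (+-assoc x n r)) (i ↑ˡ (n + r))) ≡ inj₁ (rightV X (i ↑ˡ n))
    rˡ i = trans (cong R (uncast-ˡ x n r i)) (rightˡ S T (i ↑ˡ n))

  -- The wires of the two identities are glued to legs of `Y`, and `to` sends them there; every
  -- other vertex and hyperedge occurs on both sides.
  tightening : ∀ x {m n p r} (X : Cospan m n) (Y : Cospan (x + n) (x + p)) (Z : Cospan p r) →
               Tr x ((id x ⊗ X) ⨾ Y ⨾ (id x ⊗ Z)) ≈ X ⨾ Tr x Y ⨾ Z
  tightening x {m} {n} {p} {r} X Y Z = pres≈ {P = P} {Q} record
    { to = to ; from = from
    ; to-resp = (((tt , tt) , tt , right-elim Iₓ (selfˢ X) (λ v → q Q (to (inj₁ (inj₁ v)))) (λ i → q Q (to (inj₁ (inj₂ (leftV Y i)))))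
            (λ _ → refl) glue₁)
          , (tt , tt) , λ i → sym (left-elim Iₓ (selfˢ Z) (λ v → q Q (to (inj₂ v))) (λ i → q Q (to (inj₁ (inj₂ (rightV Y i)))))
            (λ _ → refl) (λ j → sym (glue₂ j)) i))
        , λ i → trans (cong (λ v → q Q (to (inj₁ (inj₁ v)))) (leftˡ Iₓ (selfˢ X) i))
            (trans (glueT i) (cong (λ v → q Q (to (inj₂ v))) (sym (rightˡ Iₓ (selfˢ Z) i))))
    ; from-resp = (tt , (tt , λ i → trans (sym (trans (sym (cong (λ v → q P (inj₁ (inj₁ v))) (rightˡ Iₓ (selfˢ X) i))) (glueX (i ↑ˡ n))))
            (trans (trans (cong (λ v → q P (inj₁ (inj₁ v))) (sym (leftˡ Iₓ (selfˢ X) i))) (trans (closeP i)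
              (cong (λ v → q P (inj₂ v)) (rightˡ Iₓ (selfˢ Z) i))))
            (sym (trans (glueZ (i ↑ˡ p)) (cong (λ v → q P (inj₂ v)) (leftˡ Iₓ (selfˢ Z) i))))))
          , λ i → trans (cong (λ v → q P (inj₁ (inj₁ v))) (sym (rightʳ Iₓ (selfˢ X) i))) (glueX (x ↑ʳ i)))
        , tt , λ i → trans (glueZ (x ↑ʳ i)) (cong (λ v → q P (inj₂ v)) (leftʳ Iₓ (selfˢ Z) i))
    ; to-from = λ { (inj₁ (inj₁ _)) → refl ; (inj₁ (inj₂ _)) → refl ; (inj₂ _) → refl }
    ; from-to = λ
        { (inj₁ (inj₁ (inj₁ i))) → trans (sym (glueX (i ↑ˡ n))) (cong (λ v → q P (inj₁ (inj₁ v))) (rightˡ Iₓ (selfˢ X) i))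
        ; (inj₁ (inj₁ (inj₂ _))) → refl ; (inj₁ (inj₂ _)) → refl
        ; (inj₂ (inj₁ i)) → trans (glueZ (i ↑ˡ p)) (cong (λ v → q P (inj₂ v)) (leftˡ Iₓ (selfˢ Z) i))
        ; (inj₂ (inj₂ _)) → refl }
    ; eTo = λ { (inj₁ (inj₁ (inj₂ e))) → inj₁ (inj₁ e) ; (inj₁ (inj₂ e)) → inj₁ (inj₂ e) ; (inj₂ (inj₂ e)) → inj₂ e }
    ; eFrom = λ { (inj₁ (inj₁ e)) → inj₁ (inj₁ (inj₂ e)) ; (inj₁ (inj₂ e)) → inj₁ (inj₂ e) ; (inj₂ e) → inj₂ (inj₂ e) }
    ; e-tf = λ { (inj₁ (inj₁ e)) → refl ; (inj₁ (inj₂ e)) → refl ; (inj₂ e) → refl }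
    ; e-ft = λ { (inj₁ (inj₁ (inj₂ e))) → refl ; (inj₁ (inj₂ e)) → refl ; (inj₂ (inj₂ e)) → refl }
    ; to-l = λ { (inj₁ (inj₁ (inj₂ e))) → refl ; (inj₁ (inj₂ e)) → refl ; (inj₂ (inj₂ e)) → refl }
    ; to-s = λ { (inj₁ (inj₁ (inj₂ e))) _ → refl ; (inj₁ (inj₂ e)) _ → refl ; (inj₂ (inj₂ e)) _ → refl }
    ; to-t = λ { (inj₁ (inj₁ (inj₂ e))) _ → refl ; (inj₁ (inj₂ e)) _ → refl ; (inj₂ (inj₂ e)) _ → refl }
    ; to-left = λ i → cong (λ v → q Q (to (inj₁ (inj₁ v)))) (leftʳ Iₓ (selfˢ X) i)
    ; to-right = λ i → cong (λ v → q Q (to (inj₂ v))) (rightʳ Iₓ (selfˢ Z) i) }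
    where
    Iₓ = selfˢ (identity x)
    P = Trᵖ x ((idᵖ x ⊗ᵖ self X) ⨾ᵖ self Y ⨾ᵖ (idᵖ x ⊗ᵖ self Z))
    Q = self X ⨾ᵖ Trᵖ x (self Y) ⨾ᵖ self Z
    to : A (shape P) → A (shape Q)
    to (inj₁ (inj₁ (inj₁ i))) = inj₁ (inj₂ (leftV Y (i ↑ˡ n)))
    to (inj₁ (inj₁ (inj₂ v))) = inj₁ (inj₁ v)
    to (inj₁ (inj₂ v))        = inj₁ (inj₂ v)
    to (inj₂ (inj₁ i))        = inj₁ (inj₂ (rightV Y (i ↑ˡ p)))
    to (inj₂ (inj₂ v))        = inj₂ v
    from : A (shape Q) → A (shape P)
    from (inj₁ (inj₁ v)) = inj₁ (inj₁ (inj₂ v))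
    from (inj₁ (inj₂ v)) = inj₁ (inj₂ v)
    from (inj₂ v)        = inj₂ (inj₂ v)
    glue₁ : ∀ i → q Q (inj₁ (inj₁ (rightV X i))) ≡ q Q (inj₁ (inj₂ (leftV Y (x ↑ʳ i))))
    glue₁ = proj₂ (proj₂ (proj₁ (q-resp Q)))
    glue₂ : ∀ i → q Q (inj₁ (inj₂ (rightV Y (x ↑ʳ i)))) ≡ q Q (inj₂ (leftV Z i))
    glue₂ = proj₂ (proj₂ (q-resp Q))
    glueT : ∀ i → q Q (inj₁ (inj₂ (leftV Y (i ↑ˡ n)))) ≡ q Q (inj₁ (inj₂ (rightV Y (i ↑ˡ p))))
    glueT = proj₂ (proj₁ (proj₂ (proj₁ (q-resp Q))))
    glueX : ∀ i → q P (inj₁ (inj₁ (right′ (Iₓ ⊗ˢ selfˢ X) i))) ≡ q P (inj₁ (inj₂ (leftV Y i)))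
    glueX = proj₂ (proj₂ (proj₁ (proj₁ (q-resp P))))
    glueZ : ∀ i → q P (inj₁ (inj₂ (rightV Y i))) ≡ q P (inj₂ (left′ (Iₓ ⊗ˢ selfˢ Z) i))
    glueZ = proj₂ (proj₂ (proj₁ (q-resp P)))
    closeP : ∀ i → q P (inj₁ (inj₁ (left′ (Iₓ ⊗ˢ selfˢ X) (i ↑ˡ m)))) ≡ q P (inj₂ (right′ (Iₓ ⊗ˢ selfˢ Z) (i ↑ˡ r)))
    closeP = proj₂ (q-resp P)

  -- Both sides glue the same legs of `X` and `Y`. The wires of `id n` and `id m` exist on one side
  -- only and are sent to the legs of `X` to which they are glued.
  sliding : ∀ x y {m n} (X : Cospan (x + m) (y + n)) (Y : Cospan y x) →
            Tr x (X ⨾ (Y ⊗ id n)) ≈ Tr y ((Y ⊗ id m) ⨾ X)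
  sliding x y {m} {n} X Y = pres≈ {P = P} {Q} record
    { to = to ; from = from
    ; to-resp = (tt , (tt , tt) , λ i → sym (left-elim (selfˢ Y) (selfˢ (identity n)) (λ v → q Q (to (inj₂ v))) (λ i → q Q (inj₂ (rightV X i)))
          (λ i → trans (cong (q Q ∘ inj₁) (sym (leftˡ (selfˢ Y) (selfˢ (identity m)) i))) (proj₂ (q-resp Q) i)) (λ _ → refl) i)) ,
        λ i → sym (trans (cong (λ v → q Q (to (inj₂ v))) (rightˡ (selfˢ Y) (selfˢ (identity n)) i))
          (trans (cong (q Q ∘ inj₁) (sym (rightˡ (selfˢ Y) (selfˢ (identity m)) i))) (glueQ (i ↑ˡ m))))
    ; from-resp = ((tt , tt) , tt , right-elim (selfˢ Y) (selfˢ (identity m)) (λ v → q P (from (inj₁ v))) (λ i → q P (inj₁ (leftV X i)))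
          (λ i → trans (cong (q P ∘ inj₂) (sym (rightˡ (selfˢ Y) (selfˢ (identity n)) i))) (sym (proj₂ (q-resp P) i))) (λ _ → refl)) ,
        λ i → trans (cong (λ v → q P (from (inj₁ v))) (leftˡ (selfˢ Y) (selfˢ (identity m)) i))
          (trans (cong (q P ∘ inj₂) (sym (leftˡ (selfˢ Y) (selfˢ (identity n)) i))) (sym (glueP (i ↑ˡ n))))
    ; to-from = λ { (inj₁ (inj₁ _)) → refl
                  ; (inj₁ (inj₂ j)) → trans (sym (glueQ (x ↑ʳ j))) (cong (q Q ∘ inj₁) (rightʳ (selfˢ Y) (selfˢ (identity m)) j))
                  ; (inj₂ _) → refl }
    ; from-to = λ { (inj₁ _) → refl ; (inj₂ (inj₁ _)) → refl
                  ; (inj₂ (inj₂ j)) → trans (glueP (y ↑ʳ j)) (cong (q P ∘ inj₂) (leftʳ (selfˢ Y) (selfˢ (identity n)) j)) }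
    ; eTo = λ { (inj₁ e) → inj₂ e ; (inj₂ (inj₁ e)) → inj₁ (inj₁ e) }
    ; eFrom = λ { (inj₂ e) → inj₁ e ; (inj₁ (inj₁ e)) → inj₂ (inj₁ e) }
    ; e-tf = λ { (inj₂ e) → refl ; (inj₁ (inj₁ e)) → refl }
    ; e-ft = λ { (inj₁ e) → refl ; (inj₂ (inj₁ e)) → refl }
    ; to-l = λ { (inj₁ e) → refl ; (inj₂ (inj₁ e)) → refl }
    ; to-s = λ { (inj₁ e) _ → refl ; (inj₂ (inj₁ e)) _ → refl }
    ; to-t = λ { (inj₁ e) _ → refl ; (inj₂ (inj₁ e)) _ → refl }
    ; to-left = λ i → trans (sym (glueQ (x ↑ʳ i))) (cong (q Q ∘ inj₁)
          (trans (rightʳ (selfˢ Y) (selfˢ (identity m)) i) (sym (leftʳ (selfˢ Y) (selfˢ (identity m)) i))))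
    ; to-right = λ i → cong (λ v → q Q (to (inj₂ v))) (rightʳ (selfˢ Y) (selfˢ (identity n)) i) }
    where
    P = Trᵖ x (self X ⨾ᵖ (self Y ⊗ᵖ idᵖ n))
    Q = Trᵖ y ((self Y ⊗ᵖ idᵖ m) ⨾ᵖ self X)
    to : A (shape P) → A (shape Q)
    to (inj₁ v)        = inj₂ v
    to (inj₂ (inj₁ v)) = inj₁ (inj₁ v)
    to (inj₂ (inj₂ j)) = inj₂ (rightV X (y ↑ʳ j))
    from : A (shape Q) → A (shape P)
    from (inj₁ (inj₁ v)) = inj₂ (inj₁ v)
    from (inj₁ (inj₂ j)) = inj₁ (leftV X (x ↑ʳ j))
    from (inj₂ v)        = inj₁ v
    glueQ : ∀ i → q Q (inj₁ (right′ (selfˢ Y ⊗ˢ selfˢ (identity m)) i)) ≡ q Q (inj₂ (leftV X i))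
    glueQ = proj₂ (proj₂ (proj₁ (q-resp Q)))
    glueP : ∀ i → q P (inj₁ (rightV X i)) ≡ q P (inj₂ (left′ (selfˢ Y ⊗ˢ selfˢ (identity n)) i))
    glueP = proj₂ (proj₂ (proj₁ (q-resp P)))

  tracedCsp : TracedPROP (lsuc 0ℓ) 0ℓ
  tracedCsp = record
    { prop = fromStructure cspStructure ; Tr = Tr ; Tr-cong = Tr-cong ; tightening = tightening ; sliding = sliding
    ; vanishing₀ = vanishing₀ ; vanishing₊ = vanishing₊ ; superposing = superposing ; yanking = yanking }

-- The bijections of finite sets given by Lehmer codes and block exchanges.

swap₀₁ : ∀ {n} → Fin (suc (suc n)) → Fin (suc (suc n))
swap₀₁ zero          = suc zero
swap₀₁ (suc zero)    = zero
swap₀₁ (suc (suc i)) = suc (suc i)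

lift₁ : ∀ {m n} → (Fin m → Fin n) → Fin (suc m) → Fin (suc n)
lift₁ f zero    = zero
lift₁ f (suc i) = suc (f i)

-- The right leg of the interpretation of `ins j`, from outputs to inputs, by the recursion of the
-- term. Its inverse `insˡ` has a closed form.
insʳ : ∀ {n} → Fin (suc n) → Fin (suc n) → Fin (suc n)
insʳ zero i                    = i
insʳ {suc n} (suc j) zero      = suc zero
insʳ {suc n} (suc j) (suc i)   = swap₀₁ (suc (insʳ j i))

insʳ-self : ∀ {n} (j : Fin (suc n)) → insʳ j j ≡ zero
insʳ-self zero            = refl
insʳ-self {suc n} (suc j) = cong (swap₀₁ ∘ suc) (insʳ-self j)

insʳ-punchIn : ∀ {n} (j : Fin (suc n)) x → insʳ j (punchIn j x) ≡ suc x
insʳ-punchIn zero x                  = refl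
insʳ-punchIn {suc n} (suc j) zero    = refl
insʳ-punchIn {suc n} (suc j) (suc x) = cong (swap₀₁ ∘ suc) (insʳ-punchIn j x)

insˡ : ∀ {n} → Fin (suc n) → Fin (suc n) → Fin (suc n)
insˡ j zero    = j
insˡ j (suc x) = punchIn j x

insˡ-insʳ : ∀ {n} (j i : Fin (suc n)) → insˡ j (insʳ j i) ≡ i
insˡ-insʳ zero zero    = refl
insˡ-insʳ zero (suc i) = refl
insˡ-insʳ {suc n} (suc j) zero = refl
insˡ-insʳ {suc n} (suc j) (suc i) = trans (go (insʳ j i)) (cong suc (insˡ-insʳ j i))
  where
  go : ∀ k → insˡ (suc j) (swap₀₁ (suc k)) ≡ suc (insˡ j k)
  go zero    = refl
  go (suc k) = refl

insʳ-insˡ : ∀ {n} (j i : Fin (suc n)) → insʳ j (insˡ j i) ≡ i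
insʳ-insˡ j zero    = insʳ-self j
insʳ-insˡ j (suc x) = insʳ-punchIn j x

-- The input that ⌜ p ⌝ connects to a given output.
source : ∀ {n} → Lehmer n → Fin n → Fin n
source (j ∷ p) i = lift₁ (source p) (insʳ j i)

target : ∀ {n} → Lehmer n → Fin n → Fin n
target (j ∷ p) i = insˡ j (lift₁ (target p) i)

lift₁-inverse : ∀ {n} {f g : Fin n → Fin n} → (∀ i → f (g i) ≡ i) → ∀ i → lift₁ f (lift₁ g i) ≡ i
lift₁-inverse p zero    = refl
lift₁-inverse p (suc i) = cong suc (p i)

source-target : ∀ {n} (p : Lehmer n) i → source p (target p i) ≡ i
source-target (j ∷ p) i = trans (cong (lift₁ (source p)) (insʳ-insˡ j (lift₁ (target p) i)))
  (lift₁-inverse {f = source p} {target p} (source-target p) i)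

target-source : ∀ {n} (p : Lehmer n) i → target p (source p i) ≡ i
target-source (j ∷ p) i =
  trans (cong (insˡ j) (lift₁-inverse {f = target p} {source p} (target-source p) (insʳ j i))) (insˡ-insʳ j i)

-- A code can be read off its bijection: the head is the output connected to input 0, and punching
-- it out leaves the bijection of the tail.
source-injective : ∀ {n} (p q : Lehmer n) → (∀ i → source p i ≡ source q i) → p ≡ q
source-injective [] [] _ = refl
source-injective (j ∷ p) (k ∷ q) eq with j≡k
  where
  j≡k : j ≡ k
  j≡k = trans (sym (target-source (k ∷ q) j)) (cong (insˡ k ∘ lift₁ (target q))
    (trans (sym (eq j)) (cong (lift₁ (source p)) (insʳ-self j))))
... | refl = cong (j ∷_) (source-injective p q λ x → Finₚ.suc-injective
  (trans (sym (cong (lift₁ (source p)) (insʳ-punchIn j x)))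
  (trans (eq (punchIn j x)) (cong (lift₁ (source q)) (insʳ-punchIn j x)))))

exchange : ∀ a b m → Fin (a + (b + m)) → Fin (b + (a + m))
exchange a b m = copair a (λ i → b ↑ʳ (i ↑ˡ m)) (copair b (λ j → j ↑ˡ (a + m)) (λ k → b ↑ʳ (a ↑ʳ k)))

module _ (a b m : ℕ) where
  private
    rest : Fin (b + m) → Fin (b + (a + m))
    rest = copair b (λ j → j ↑ˡ (a + m)) (λ k → b ↑ʳ (a ↑ʳ k))

  exchange₁ : ∀ i → exchange a b m (i ↑ˡ (b + m)) ≡ b ↑ʳ (i ↑ˡ m)
  exchange₁ = copair-ˡ (λ i → b ↑ʳ (i ↑ˡ m)) rest

  exchange₂ : ∀ j → exchange a b m (a ↑ʳ (j ↑ˡ m)) ≡ j ↑ˡ (a + m)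
  exchange₂ j = trans (copair-ʳ (λ i → b ↑ʳ (i ↑ˡ m)) rest (j ↑ˡ m)) (copair-ˡ (λ j → j ↑ˡ (a + m)) _ j)

  exchange₃ : ∀ k → exchange a b m (a ↑ʳ (b ↑ʳ k)) ≡ b ↑ʳ (a ↑ʳ k)
  exchange₃ k = trans (copair-ʳ (λ i → b ↑ʳ (i ↑ˡ m)) rest (b ↑ʳ k)) (copair-ʳ {m = b} (λ j → j ↑ˡ (a + m)) _ k)

exchange-involutive : ∀ a b m i → exchange b a m (exchange a b m i) ≡ i
exchange-involutive a b m = split-elim a _
  (λ i → trans (cong (exchange b a m) (exchange₁ a b m i)) (exchange₂ b a m i))
  (split-elim b _
    (λ j → trans (cong (exchange b a m) (exchange₂ a b m j)) (exchange₁ b a m j))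
    (λ k → trans (cong (exchange b a m) (exchange₃ a b m k)) (exchange₃ b a m k)))

-- The interpretation of terms and of normal forms as cospans.

module Interpretation (𝓢 : Generators) where
  open Generators 𝓢
  open Labelled 𝓢
  open Trace 𝓢
  open C using (Cospan; _≈_; Iso; mkIso; unIso; ≈-refl; ≈-trans; withLegs; identity)
  open Cospan
  open Shape
  open Pres
  open PROPStructure cspStructure using (id; _⨾_; _⊗_; σ; cast; ⨾-cong; ⊗-cong)
  open Terms 𝓢 using (Core; perm; box; ins; ⌜_⌝; term; loop; loops; sw)
  private module T = Free 𝓢

  singleLabel : ∀ g {k l} → SingleEdge (dom g) (cod g) k l → SignatureEdge 𝓢 k l
  singleLabel g single = edge g

  finite-single : ∀ {a b} → Finite (Σ[ k ∈ ℕ ] Σ[ l ∈ ℕ ] SingleEdge a b k l)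
  finite-single = record { size = 1 ; enum = mk↔ₛ′ (λ _ → zero) (λ _ → _ , _ , single)
    (λ { zero → refl }) (λ { (_ , _ , single) → refl }) }

  generator : ∀ g → Cospan (dom g) (cod g)
  generator g = record
    { apex = F ; finite = finite-⊎ (finite-Fin _) (finite-Fin _) , finite-single
    ; left = vertices F inj₁ ; right = vertices F inj₂ }
    where
    F : LHyp
    F = record
      { graph = record
          { V = Fin (dom g) ⊎ Fin (cod g) ; E = SingleEdge (dom g) (cod g)
          ; s = λ { single i → inj₁ i } ; t = λ { single j → inj₂ j } }
      ; label = record
          { onV = λ _ → tt ; onE = singleLabel g ; on-s = λ _ _ → refl ; on-t = λ _ _ → refl } }

  open Freeness 𝓢 tracedCsp public using () renaming (fold to foldTerm; fold-cong to foldTerm-cong)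

  ⟦_⟧ : ∀ {m n} → T.Term m n → Cospan m n
  ⟦_⟧ = foldTerm generator

  ⟦⟧-cong : ∀ {m n} {t u : T.Term m n} → t T.≈ u → ⟦ t ⟧ ≈ ⟦ u ⟧
  ⟦⟧-cong = foldTerm-cong generator

  -- The effect of feeding a generator, free of quotients: the vertices are those of `Y`, and the
  -- fed-back outputs and inputs become the sources and targets of a new hyperedge.
  attach : ∀ g {m n} → Cospan (cod g + m) (dom g + n) → Cospan m n
  attach g {m} {n} Y = record
    { apex = F
    ; finite = proj₁ (finite Y) , proj₂ (finite-+ₗ {apex Y} {apex (generator g)} (finite Y) (finite (generator g)))
    ; left = vertices F (λ i → leftV Y (cod g ↑ʳ i))
    ; right = vertices F (λ i → rightV Y (dom g ↑ʳ i)) }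
    where
    F : LHyp
    F = record
      { graph = record
          { V = V Y ; E = λ k l → E Y k l ⊎ SingleEdge (dom g) (cod g) k l
          ; s = λ { (inj₁ e) i → s Y e i ; (inj₂ single) i → rightV Y (i ↑ˡ n) }
          ; t = λ { (inj₁ e) j → t Y e j ; (inj₂ single) j → leftV Y (j ↑ˡ m) } }
      ; label = record
          { onV = λ _ → tt ; onE = [ labelE Y , singleLabel g ]′
          ; on-s = λ _ _ → refl ; on-t = λ _ _ → refl } }

  attach-iso : ∀ g {m n} {X Y : Cospan (cod g + m) (dom g + n)} → Iso X Y → Iso (attach g X) (attach g Y)
  attach-iso g {m} {n} I = record
    { vTo = vTo ; vFrom = vFrom ; v-tf = v-tf ; v-ft = v-ft
    ; eTo = Sum.map eTo (λ e → e) ; eFrom = Sum.map eFrom (λ e → e)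
    ; e-tf = λ { (inj₁ e) → cong inj₁ (e-tf e) ; (inj₂ e) → refl }
    ; e-ft = λ { (inj₁ e) → cong inj₁ (e-ft e) ; (inj₂ e) → refl }
    ; to-s = λ { (inj₁ e) i → to-s e i ; (inj₂ single) i → to-right (i ↑ˡ n) }
    ; to-t = λ { (inj₁ e) j → to-t e j ; (inj₂ single) j → to-left (j ↑ˡ m) }
    ; to-l = λ { (inj₁ e) → to-l e ; (inj₂ e) → refl }
    ; to-left = λ i → to-left (cod g ↑ʳ i) ; to-right = λ i → to-right (dom g ↑ʳ i) }
    where open Iso I

  attach-cong : ∀ g {m n} {X Y : Cospan (cod g + m) (dom g + n)} → X ≈ Y → attach g X ≈ attach g Y
  attach-cong g p = mkIso (attach-iso g (unIso p))

  -- Every vertex of the generator and every wire of `id m` is glued to a leg of `X`, and no two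
  -- vertices of `X` become identified, so the quotient is again `V X`.
  feed-attach : ∀ g {m n} (X : Cospan (cod g + m) (dom g + n)) →
                Tr (dom g) ((generator g ⊗ id m) ⨾ X) ≈ attach g X
  feed-attach g {m} {n} X = pres≈ {P = P} {self (attach g X)} record
    { to = to ; from = inj₂
    ; to-resp = ((tt , tt) , tt , right-elim G I (to ∘ inj₁) (leftV X) (λ _ → refl) (λ _ → refl)) ,
        λ i → cong (to ∘ inj₁) (leftˡ G I i)
    ; from-resp = tt
    ; to-from = λ _ → refl
    ; from-to = λ
        { (inj₁ (inj₁ (inj₁ i))) → trans (sym (proj₂ (q-resp P) i)) (cong (q P ∘ inj₁) (leftˡ G I i))
        ; (inj₁ (inj₁ (inj₂ j))) → trans (sym (glueI (j ↑ˡ m))) (cong (q P ∘ inj₁) (rightˡ G I j))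
        ; (inj₁ (inj₂ j)) → trans (sym (glueI (cod g ↑ʳ j))) (cong (q P ∘ inj₁) (rightʳ G I j))
        ; (inj₂ v) → refl }
    ; eTo = λ { (inj₁ (inj₁ e)) → inj₂ e ; (inj₂ e) → inj₁ e }
    ; eFrom = λ { (inj₁ e) → inj₂ e ; (inj₂ e) → inj₁ (inj₁ e) }
    ; e-tf = λ { (inj₁ e) → refl ; (inj₂ e) → refl }
    ; e-ft = λ { (inj₁ (inj₁ e)) → refl ; (inj₂ e) → refl }
    ; to-l = λ { (inj₁ (inj₁ e)) → refl ; (inj₂ e) → refl }
    ; to-s = λ { (inj₁ (inj₁ single)) _ → refl ; (inj₂ e) _ → refl }
    ; to-t = λ { (inj₁ (inj₁ single)) _ → refl ; (inj₂ e) _ → refl }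
    ; to-left = λ i → cong (to ∘ inj₁) (leftʳ G I i)
    ; to-right = λ _ → refl }
    where
    G = selfˢ (generator g)
    I = selfˢ (identity m)
    P = Trᵖ (dom g) ((self (generator g) ⊗ᵖ idᵖ m) ⨾ᵖ self X)
    to : A (shape P) → V X
    to (inj₁ (inj₁ (inj₁ i))) = rightV X (i ↑ˡ n)
    to (inj₁ (inj₁ (inj₂ j))) = leftV X (j ↑ˡ m)
    to (inj₁ (inj₂ j))        = leftV X (cod g ↑ʳ j)
    to (inj₂ v)               = v
    glueI : ∀ i → q P (inj₁ (right′ (G ⊗ˢ I) i)) ≡ q P (inj₂ (leftV X i))
    glueI = proj₂ (proj₂ (proj₁ (q-resp P)))

  wire : ∀ {m n} → (Fin n → Fin m) → Cospan m n
  wire {m} f = C.perm (vertices (D m) f)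

  wire-cong : ∀ {m n} {f f′ : Fin n → Fin m} → (∀ i → f i ≡ f′ i) → wire f ≈ wire f′
  wire-cong p = C.perm-cong p

  id-wire : ∀ m → id m ≈ wire (λ i → i)
  id-wire m = subst (_≈ wire (λ i → i)) (sym (id≡ m))
    (C.perm-cong {r = idₗ} {vertices (D m) (λ i → i)} (λ _ → refl))

  σ-wire : ∀ m n → σ m n ≈ wire (λ i → swapFin n m i)
  σ-wire m n = subst (_≈ wire (swapFin n m)) (sym (σ≡ m n)) ≈-refl

  ⨾-wire : ∀ {m n p} (X : Cospan m n) (f : Fin p → Fin n) →
           X ⨾ wire f ≈ withLegs X (left X) (vertices (apex X) (rightV X ∘ f))
  ⨾-wire X f = subst (_≈ withLegs X (left X) (vertices (apex X) (rightV X ∘ f))) (sym (⨾≡ X (wire f)))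
    (≈-trans (C.reindexʳ X (vertices (D _) f)) (C.legs≈ X (λ _ → refl) (λ _ → refl)))

  wire-⨾ : ∀ {m n p} (f : Fin n → Fin m) (f⁻¹ : Fin m → Fin n) → (∀ i → f (f⁻¹ i) ≡ i) → (∀ i → f⁻¹ (f i) ≡ i) →
           (X : Cospan n p) → wire f ⨾ X ≈ withLegs X (vertices (apex X) (leftV X ∘ f⁻¹)) (right X)
  wire-⨾ f f⁻¹ p r X = subst (_≈ withLegs X (vertices (apex X) (leftV X ∘ f⁻¹)) (right X)) (sym (⨾≡ (wire f) X))
    (≈-trans (C.reindexˡ (vertices (D _) f) (vertices (D _) f⁻¹) p r X) (C.legs≈ X (λ _ → refl) (λ _ → refl)))

  wire-⊗ : ∀ {m n m′ n′} (f : Fin n → Fin m) (f′ : Fin n′ → Fin m′) →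
           wire f ⊗ wire f′ ≈ wire (copair n ((_↑ˡ m′) ∘ f) ((m ↑ʳ_) ∘ f′))
  wire-⊗ {m} {n} {m′} f f′ = subst (_≈ wire (copair n ((_↑ˡ m′) ∘ f) ((m ↑ʳ_) ∘ f′))) (sym (⊗≡ (wire f) (wire f′)))
    (C.perm-⊗ (vertices (D m) f) (vertices (D m′) f′))

  wire-wire : ∀ {m n p} (f : Fin n → Fin m) (g : Fin p → Fin n) → wire f ⨾ wire g ≈ wire (f ∘ g)
  wire-wire f g = ⨾-wire (wire f) g

  id₁⊗wire : ∀ {m n} {X : Cospan m n} {f : Fin n → Fin m} → X ≈ wire f → id 1 ⊗ X ≈ wire (lift₁ f)
  id₁⊗wire {f = f} p = ≈-trans (⊗-cong (id-wire 1) p) (≈-trans (wire-⊗ {1} (λ i → i) f)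
    (wire-cong λ { zero → refl ; (suc i) → refl }))

  ⟦ins⟧ : ∀ {n} (j : Fin (suc n)) → ⟦ ins j ⟧ ≈ wire (insʳ j)
  ⟦ins⟧ zero            = ≈-trans (id-wire _) (wire-cong (λ _ → refl))
  ⟦ins⟧ {suc n} (suc j) = ≈-trans
    (⨾-cong (≈-trans (⊗-cong (σ-wire 1 1) (id-wire n)) (≈-trans (wire-⊗ {2} (λ i → swapFin 1 1 i) (λ i → i))
        (wire-cong {f′ = swap₀₁} λ { zero → refl ; (suc zero) → refl ; (suc (suc i)) → refl })))
      (id₁⊗wire (⟦ins⟧ j)))
    (≈-trans (wire-wire swap₀₁ (lift₁ (insʳ j))) (wire-cong λ { zero → refl ; (suc i) → refl }))

  ⟦⌜⌝⟧ : ∀ {n} (p : Lehmer n) → ⟦ ⌜ p ⌝ ⟧ ≈ wire (source p)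
  ⟦⌜⌝⟧ []      = ≈-trans (id-wire 0) (wire-cong (λ ()))
  ⟦⌜⌝⟧ (j ∷ p) = ≈-trans (⨾-cong (id₁⊗wire (⟦⌜⌝⟧ p)) (⟦ins⟧ j)) (wire-wire (lift₁ (source p)) (insʳ j))

  ⟪_⟫ : ∀ {m n} → Core m n → Cospan m n
  ⟪ perm p ⟫  = wire (source p)
  ⟪ box g c ⟫ = attach g ⟪ c ⟫

  ⟦term⟧ : ∀ {m n} (c : Core m n) → ⟦ term c ⟧ ≈ ⟪ c ⟫
  ⟦term⟧ (perm p)  = ⟦⌜⌝⟧ p
  ⟦term⟧ (box g c) = ≈-trans (feed-attach g ⟦ term c ⟧) (attach-cong g (⟦term⟧ c))

  ⟦cast⟧ : ∀ {m m′ n n′} (p : m ≡ m′) (r : n ≡ n′) (t : T.Term m n) → ⟦ T.cast p r t ⟧ ≡ cast p r ⟦ t ⟧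
  ⟦cast⟧ refl refl t = refl

  ⟦sw⟧ : ∀ a b m → ⟦ sw a b m ⟧ ≈ wire (exchange b a m)
  ⟦sw⟧ a b m = subst (_≈ wire (exchange b a m)) (sym (⟦cast⟧ (+-assoc a b m) (+-assoc b a m) (T.σ a b T.⊗ T.id m)))
    (pres≈ {P = P} {self (wire (exchange b a m))} record
    { to = to ; from = from
    ; to-resp = tt , tt ; from-resp = tt
    ; to-from = split-elim a _
        (λ i → trans (cong to (from₁ i)) (to₁ i))
        (split-elim b _
          (λ j → trans (cong to (from₂ j)) (to₂ j))
          (λ k → cong to (from₃ k)))
    ; from-to = λ
        { (inj₁ x) → split-elim a (λ x → q P (from (to (inj₁ x))) ≡ q P (inj₁ x))
            (λ i → cong (q P) (trans (cong from (to₁ i)) (from₁ i)))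
            (λ j → cong (q P) (trans (cong from (to₂ j)) (from₂ j))) x
        ; (inj₂ k) → cong (q P) (from₃ k) }
    ; eTo = λ { (inj₁ ()) ; (inj₂ ()) } ; eFrom = λ () ; e-tf = λ () ; e-ft = λ { (inj₁ ()) ; (inj₂ ()) }
    ; to-l = λ { (inj₁ ()) ; (inj₂ ()) } ; to-s = λ { (inj₁ ()) ; (inj₂ ()) } ; to-t = λ { (inj₁ ()) ; (inj₂ ()) }
    ; to-left = split-elim a _
        (λ i → trans (cong to (trans (cong (left′ S⊗I) (uncast-ˡ a b m i)) (leftˡ S I (i ↑ˡ b))))
          (to₁ i))
        (split-elim b _
          (λ j → trans (cong to (trans (cong (left′ S⊗I) (uncast-ᵐ a b m j)) (leftˡ S I (a ↑ʳ j))))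
            (to₂ j))
          (λ k → cong to (trans (cong (left′ S⊗I) (uncast-ʳ a b m k)) (leftʳ S I k))))
    ; to-right = split-elim b _
        (λ j → trans (cong to (trans (cong (right′ S⊗I) (uncast-ˡ b a m j)) (trans (rightˡ S I (j ↑ˡ a)) (cong inj₁ (C.swapFin-↑ˡ b a j)))))
          (trans (to₂ j) (sym (exchange₁ b a m j))))
        (split-elim a _
          (λ i → trans (cong to (trans (cong (right′ S⊗I) (uncast-ᵐ b a m i)) (trans (rightˡ S I (b ↑ʳ i)) (cong inj₁ (C.swapFin-↑ʳ b a i)))))
            (trans (to₁ i) (sym (exchange₂ b a m i))))
          (λ k → trans (cong to (trans (cong (right′ S⊗I) (uncast-ʳ b a m k)) (rightʳ S I k)))
            (sym (exchange₃ b a m k)))) })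
    where
    S = selfˢ (C.symmetry a b)
    I = selfˢ (identity m)
    S⊗I = S ⊗ˢ I
    P = castᵖ (+-assoc a b m) (+-assoc b a m) (σᵖ a b ⊗ᵖ idᵖ m)
    to : Fin (a + b) ⊎ Fin m → Fin (a + (b + m))
    to (inj₁ x) = copair a (_↑ˡ (b + m)) (λ j → a ↑ʳ (j ↑ˡ m)) x
    to (inj₂ k) = a ↑ʳ (b ↑ʳ k)
    to₁ : ∀ i → to (inj₁ (i ↑ˡ b)) ≡ i ↑ˡ (b + m)
    to₁ = copair-ˡ {m = a} {b} (_↑ˡ (b + m)) (λ j → a ↑ʳ (j ↑ˡ m))
    to₂ : ∀ j → to (inj₁ (a ↑ʳ j)) ≡ a ↑ʳ (j ↑ˡ m)
    to₂ = copair-ʳ {m = a} {b} (_↑ˡ (b + m)) (λ j → a ↑ʳ (j ↑ˡ m))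
    from′ : Fin (b + m) → Fin (a + b) ⊎ Fin m
    from′ = copair b (λ j → inj₁ (a ↑ʳ j)) inj₂
    from : Fin (a + (b + m)) → Fin (a + b) ⊎ Fin m
    from = copair a (λ i → inj₁ (i ↑ˡ b)) from′
    from₁ : ∀ i → from (i ↑ˡ (b + m)) ≡ inj₁ (i ↑ˡ b)
    from₁ = copair-ˡ (λ i → inj₁ (i ↑ˡ b)) from′
    from₂ : ∀ j → from (a ↑ʳ (j ↑ˡ m)) ≡ inj₁ (a ↑ʳ j)
    from₂ j = trans (copair-ʳ (λ i → inj₁ (i ↑ˡ b)) from′ (j ↑ˡ m)) (copair-ˡ (λ j → inj₁ (a ↑ʳ j)) inj₂ j)
    from₃ : ∀ k → from (a ↑ʳ (b ↑ʳ k)) ≡ inj₂ k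
    from₃ k = trans (copair-ʳ (λ i → inj₁ (i ↑ˡ b)) from′ (b ↑ʳ k)) (copair-ʳ {m = b} (λ j → inj₁ (a ↑ʳ j)) inj₂ k)

  isolate : ℕ → ∀ {m n} → Cospan m n → Cospan m n
  isolate k X = record
    { apex = F ; finite = finite-⊎ (finite-Fin k) (proj₁ (finite X)) , proj₂ (finite X)
    ; left = vertices F (inj₂ ∘ leftV X) ; right = vertices F (inj₂ ∘ rightV X) }
    where
    F : LHyp
    F = record
      { graph = record { V = Fin k ⊎ V X ; E = E X ; s = λ e → inj₂ ∘ s X e ; t = λ e → inj₂ ∘ t X e }
      ; label = record { onV = λ _ → tt ; onE = labelE X ; on-s = λ _ _ → refl ; on-t = λ _ _ → refl } }

  isolate-cong : ∀ k {m n} {X Y : Cospan m n} → X ≈ Y → isolate k X ≈ isolate k Y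
  isolate-cong k p = mkIso record
    { vTo = Sum.map (λ i → i) vTo ; vFrom = Sum.map (λ i → i) vFrom
    ; v-tf = λ { (inj₁ i) → refl ; (inj₂ v) → cong inj₂ (v-tf v) }
    ; v-ft = λ { (inj₁ i) → refl ; (inj₂ v) → cong inj₂ (v-ft v) }
    ; eTo = eTo ; eFrom = eFrom ; e-tf = e-tf ; e-ft = e-ft
    ; to-s = λ e i → cong inj₂ (to-s e i) ; to-t = λ e j → cong inj₂ (to-t e j) ; to-l = to-l
    ; to-left = λ i → cong inj₂ (to-left i) ; to-right = λ i → cong inj₂ (to-right i) }
    where open Iso (unIso p)

  Tr-id-⊗ : ∀ {m n} (X : Cospan m n) → Tr 1 (id 1) ⊗ X ≈ isolate 1 X
  Tr-id-⊗ X = pres≈ {P = P} {self (isolate 1 X)} record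
    { to = λ v → v ; from = λ v → v ; to-resp = (tt , λ _ → refl) , tt ; from-resp = tt
    ; to-from = λ _ → refl ; from-to = λ _ → refl
    ; eTo = λ { (inj₂ e) → e } ; eFrom = inj₂ ; e-tf = λ _ → refl ; e-ft = λ { (inj₂ e) → refl }
    ; to-s = λ { (inj₂ e) _ → refl } ; to-t = λ { (inj₂ e) _ → refl } ; to-l = λ { (inj₂ e) → refl }
    ; to-left = λ _ → refl ; to-right = λ _ → refl }
    where P = Trᵖ 1 (idᵖ 1) ⊗ᵖ self X

  isolate-+ : ∀ j k {m n} (X : Cospan m n) → isolate j (isolate k X) ≈ isolate (j + k) X
  isolate-+ j k X = mkIso record
    { vTo = to ; vFrom = from
    ; v-tf = λ { (inj₁ i) → trans (to-from (Fin.splitAt j i)) (cong inj₁ (join-splitAt j k i)) ; (inj₂ v) → refl }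
    ; v-ft = λ { (inj₁ i) → cong from′ (splitAt-join j k (inj₁ i))
               ; (inj₂ (inj₁ i)) → cong from′ (splitAt-join j k (inj₂ i)) ; (inj₂ (inj₂ v)) → refl }
    ; eTo = λ e → e ; eFrom = λ e → e ; e-tf = λ _ → refl ; e-ft = λ _ → refl
    ; to-s = λ _ _ → refl ; to-t = λ _ _ → refl ; to-l = λ _ → refl
    ; to-left = λ _ → refl ; to-right = λ _ → refl }
    where
    to : Fin j ⊎ Fin k ⊎ V X → Fin (j + k) ⊎ V X
    to (inj₁ i)        = inj₁ (i ↑ˡ k)
    to (inj₂ (inj₁ i)) = inj₁ (j ↑ʳ i)
    to (inj₂ (inj₂ v)) = inj₂ v
    from′ : Fin j ⊎ Fin k → Fin j ⊎ Fin k ⊎ V X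
    from′ = Sum.map (λ i → i) inj₁
    from : Fin (j + k) ⊎ V X → Fin j ⊎ Fin k ⊎ V X
    from (inj₁ i) = from′ (Fin.splitAt j i)
    from (inj₂ v) = inj₂ (inj₂ v)
    to-from : ∀ x → to (from′ x) ≡ inj₁ (Fin.join j k x)
    to-from (inj₁ _) = refl
    to-from (inj₂ _) = refl

  ⟦loops⊗⟧ : ∀ k {m n} (t : T.Term m n) → ⟦ loops k T.⊗ t ⟧ ≈ isolate k ⟦ t ⟧
  ⟦loops⊗⟧ zero t = ≈-trans (⟦⟧-cong (T.⊗-identityˡ t)) (mkIso record
    { vTo = inj₂ ; vFrom = λ { (inj₂ v) → v } ; v-tf = λ { (inj₂ v) → refl } ; v-ft = λ _ → refl
    ; eTo = λ e → e ; eFrom = λ e → e ; e-tf = λ _ → refl ; e-ft = λ _ → refl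
    ; to-s = λ _ _ → refl ; to-t = λ _ _ → refl ; to-l = λ _ → refl
    ; to-left = λ _ → refl ; to-right = λ _ → refl })
  ⟦loops⊗⟧ (suc k) t = ≈-trans (⟦⟧-cong (Terms.≋⇒≈ 𝓢 (Terms.⊗-assoc≋ 𝓢 loop (loops k) t)))
    (≈-trans (Tr-id-⊗ ⟦ loops k T.⊗ t ⟧) (≈-trans (isolate-cong 1 (⟦loops⊗⟧ k t)) (isolate-+ 1 k ⟦ t ⟧)))

  ⟦loops⊗term⟧ : ∀ k {m n} (c : Core m n) → ⟦ loops k T.⊗ term c ⟧ ≈ isolate k ⟪ c ⟫
  ⟦loops⊗term⟧ k c = ≈-trans (⟦loops⊗⟧ k (term c)) (isolate-cong k (⟦term⟧ c))

-- Faithfulness: comparing normal forms with isomorphic interpretations.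

module Faithfulness (𝓢 : Generators) where
  open Generators 𝓢
  open Labelled 𝓢
  open Trace 𝓢
  open C using (Cospan; _≈_; Iso; mkIso; unIso; ≈-refl; ≈-sym; ≈-trans; withLegs)
  open Cospan
  open PROPStructure cspStructure using (_⨾_; ⨾-cong)
  open Terms 𝓢 using (Core; perm; box; ⌜_⌝; term; feed; feed-cong; feed-feed; sw;
    IsPerm-sw; IsCore-conj; normalise)
  open Interpretation 𝓢
  private module T = Free 𝓢

  infixl 5 _∙_
  _∙_ : ∀ {m n} {X Y Z : Cospan m n} → Iso X Y → Iso Y Z → Iso X Z
  I ∙ J = unIso (≈-trans (mkIso I) (mkIso J))

  _⁻¹ : ∀ {m n} {X Y : Cospan m n} → Iso X Y → Iso Y X
  I ⁻¹ = unIso (≈-sym (mkIso I))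

  module Swap {x x′ y y′ m n} (Y : Cospan (x′ + (y′ + m)) (x + (y + n))) where
    swapped : Cospan (y′ + (x′ + m)) (y + (x + n))
    swapped = withLegs Y (vertices (apex Y) (leftV Y ∘ exchange y′ x′ m))
                         (vertices (apex Y) (rightV Y ∘ exchange y x n))

    ⟦sw⟧-conj : ⟦ sw y′ x′ m ⟧ ⨾ Y ⨾ ⟦ sw x y n ⟧ ≈ swapped
    ⟦sw⟧-conj = ≈-trans
      (⨾-cong (≈-trans (⨾-cong (⟦sw⟧ y′ x′ m) ≈-refl)
        (wire-⨾ (exchange x′ y′ m) (exchange y′ x′ m) (exchange-involutive y′ x′ m) (exchange-involutive x′ y′ m) Y))
        (⟦sw⟧ x y n))
      (⨾-wire _ (exchange y x n))

  -- The counterpart of `feed-feed` on cospans. The vertices stay the same; the two hyperedges trade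
  -- places and the legs are reindexed.
  attach-attach : ∀ g h {m n} (Y : Cospan (cod g + (cod h + m)) (dom g + (dom h + n))) →
                  Iso (attach h (attach g Y)) (attach g (attach h (Swap.swapped {dom g} {cod g} {dom h} {cod h} Y)))
  attach-attach g h {m} {n} Y = record
    { vTo = λ v → v ; vFrom = λ v → v ; v-tf = λ _ → refl ; v-ft = λ _ → refl
    ; eTo = λ { (inj₁ (inj₁ e)) → inj₁ (inj₁ e) ; (inj₁ (inj₂ e)) → inj₂ e ; (inj₂ e) → inj₁ (inj₂ e) }
    ; eFrom = λ { (inj₁ (inj₁ e)) → inj₁ (inj₁ e) ; (inj₁ (inj₂ e)) → inj₂ e ; (inj₂ e) → inj₁ (inj₂ e) }
    ; e-tf = λ { (inj₁ (inj₁ e)) → refl ; (inj₁ (inj₂ e)) → refl ; (inj₂ e) → refl }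
    ; e-ft = λ { (inj₁ (inj₁ e)) → refl ; (inj₁ (inj₂ e)) → refl ; (inj₂ e) → refl }
    ; to-s = λ { (inj₁ (inj₁ e)) _ → refl
               ; (inj₁ (inj₂ single)) i → cong (rightV Y) (sym (exchange₂ (dom h) (dom g) n i))
               ; (inj₂ single) i → cong (rightV Y) (sym (exchange₁ (dom h) (dom g) n i)) }
    ; to-t = λ { (inj₁ (inj₁ e)) _ → refl
               ; (inj₁ (inj₂ single)) i → cong (leftV Y) (sym (exchange₂ (cod h) (cod g) m i))
               ; (inj₂ single) i → cong (leftV Y) (sym (exchange₁ (cod h) (cod g) m i)) }
    ; to-l = λ { (inj₁ (inj₁ e)) → refl ; (inj₁ (inj₂ e)) → refl ; (inj₂ e) → refl }
    ; to-left = λ i → cong (leftV Y) (sym (exchange₃ (cod h) (cod g) m i))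
    ; to-right = λ i → cong (rightV Y) (sym (exchange₃ (dom h) (dom g) n i)) }

  -- The label is an argument of its own so that matching on `edge g` fixes the arities of the
  -- hyperedge. The isomorphism is kept next to the equation between terms because only it records
  -- which hyperedge became the last one.
  Extracted : ∀ {m n} (c : Core m n) {k l} → SignatureEdge 𝓢 k l → E ⟪ c ⟫ k l → Set
  Extracted {m} {n} c (edge g) e = Σ[ d ∈ Core (cod g + m) (dom g + n) ]
    (term c T.≈ feed (T.gen g) (term d)) ×
    (Σ[ I ∈ Iso ⟪ c ⟫ (attach g ⟪ d ⟫) ] Iso.eTo I e ≡ inj₂ single)

  -- A hyperedge below the outermost box is extracted from the core beneath; `feed-feed` then
  -- exchanges the two boxes, and `IsCore-conj` absorbs the symmetries that appear. Soundness of the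
  -- interpretation turns this last equation into an isomorphism.
  extract : ∀ {m n} (c : Core m n) {k l} (e : E ⟪ c ⟫ k l) → Extracted c (labelE ⟪ c ⟫ e) e
  extract (box g c) (inj₂ single) = c , T.≈-refl , unIso ≈-refl , refl
  extract (box h {m} {n} c) (inj₁ e) = step (labelE ⟪ c ⟫ e) (extract c e)
    where
    step : ∀ {k l} (λe : SignatureEdge 𝓢 k l) {e : E ⟪ c ⟫ k l} → Extracted c λe e → Extracted (box h c) λe (inj₁ e)
    step (edge g) (d , eq , I , eTo≡)
      with IsCore-conj (IsPerm-sw (cod h) (cod g) m) (IsPerm-sw (dom g) (dom h) n) d
    ... | d′ , eq′ = box h d′ ,
      T.≈-trans (feed-cong (T.gen h) eq)
        (T.≈-trans (feed-feed (T.gen g) (T.gen h) (term d)) (feed-cong (T.gen g) (feed-cong (T.gen h) eq′))) ,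
      attach-iso h I ∙ attach-attach g h ⟪ d ⟫ ∙ attach-iso g (attach-iso h (unIso d′-iso)) ,
      cong (λ z → Sum.map (Sum.map (Iso.eTo (unIso d′-iso)) (λ e → e)) (λ e → e)
             (Iso.eTo (attach-attach g h ⟪ d ⟫) (inj₁ z))) eTo≡
      where
      module W = Swap {dom g} {cod g} {dom h} {cod h} {m} {n} ⟪ d ⟫
      d′-iso : W.swapped ≈ ⟪ d′ ⟫
      d′-iso = ≈-trans (≈-sym W.⟦sw⟧-conj)
        (≈-trans (⨾-cong (⨾-cong ≈-refl (≈-sym (⟦term⟧ d))) ≈-refl)
        (≈-trans (⟦⟧-cong eq′) (⟦term⟧ d′)))

  -- The fed-back legs survive as tentacles of the last hyperedge, so an isomorphism that preserves
  -- this hyperedge respects those legs too. By injectivity it carries the old hyperedges to old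
  -- ones.
  attach-reflects : ∀ g {m n} {X Y : Cospan (cod g + m) (dom g + n)} (I : Iso (attach g X) (attach g Y)) →
                    Iso.eTo I (inj₂ single) ≡ inj₂ single → X ≈ Y
  attach-reflects g {m} {n} {X} {Y} I eTo≡ = mkIso record
    { vTo = vTo ; vFrom = vFrom ; v-tf = v-tf ; v-ft = v-ft
    ; eTo = λ e → proj₁ (old e) ; eFrom = λ e → proj₁ (oldFrom e)
    ; e-tf = λ e → Sumₚ.inj₁-injective (trans (sym (proj₂ (old _)))
        (trans (cong eTo (sym (proj₂ (oldFrom e)))) (e-tf (inj₁ e))))
    ; e-ft = λ e → Sumₚ.inj₁-injective (trans (sym (proj₂ (oldFrom _)))
        (trans (cong eFrom (sym (proj₂ (old e)))) (e-ft (inj₁ e))))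
    ; to-s = λ e i → trans (to-s (inj₁ e) i) (cong (λ z → s (attach g Y) z i) (proj₂ (old e)))
    ; to-t = λ e j → trans (to-t (inj₁ e) j) (cong (λ z → t (attach g Y) z j) (proj₂ (old e)))
    ; to-l = λ e → trans (cong (labelE (attach g Y)) (sym (proj₂ (old e)))) (to-l (inj₁ e))
    ; to-left = split-elim (cod g) _
        (λ j → trans (to-t (inj₂ single) j) (cong (λ z → t (attach g Y) z j) eTo≡)) to-left
    ; to-right = split-elim (dom g) _
        (λ j → trans (to-s (inj₂ single) j) (cong (λ z → s (attach g Y) z j) eTo≡)) to-right }
    where
    open Iso I
    eFrom≡ : eFrom (inj₂ single) ≡ inj₂ single
    eFrom≡ = trans (cong eFrom (sym eTo≡)) (e-ft (inj₂ single))
    old : ∀ {k l} (e : E X k l) → Σ[ e′ ∈ E Y k l ] eTo (inj₁ e) ≡ inj₁ e′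
    old e = go (eTo (inj₁ e)) refl
      where
      go : ∀ z → eTo (inj₁ e) ≡ z → Σ[ e′ ∈ _ ] z ≡ inj₁ e′
      go (inj₁ e′) _ = e′ , refl
      go (inj₂ single) eq with trans (sym (e-ft (inj₁ e))) (trans (cong eFrom eq) eFrom≡)
      ... | ()
    oldFrom : ∀ {k l} (e : E Y k l) → Σ[ e′ ∈ E X k l ] eFrom (inj₁ e) ≡ inj₁ e′
    oldFrom e = go (eFrom (inj₁ e)) refl
      where
      go : ∀ z → eFrom (inj₁ e) ≡ z → Σ[ e′ ∈ _ ] z ≡ inj₁ e′
      go (inj₁ e′) _ = e′ , refl
      go (inj₂ single) eq with trans (sym (e-tf (inj₁ e))) (trans (cong eTo eq) eTo≡)
      ... | ()

  core-faithful : ∀ {m n} (c d : Core m n) → ⟪ c ⟫ ≈ ⟪ d ⟫ → term c T.≈ term d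
  core-faithful (perm p) (perm q) eq = ≡⇒≈ (source-injective p q λ i →
    trans (sym (to-left (source p i))) (to-right i))
    where
    open Iso (unIso eq)
    ≡⇒≈ : p ≡ q → ⌜ p ⌝ T.≈ ⌜ q ⌝
    ≡⇒≈ refl = T.≈-refl
  core-faithful (perm p) (box g d) eq with Iso.eFrom (unIso eq) (inj₂ single)
  ... | ()
  -- Isomorphisms preserve labels, so the image of the outermost hyperedge is again labelled by `g`
  -- and can be extracted from `d` as a box for the same generator.
  core-faithful (box g c) d eq with subst (λ l → Extracted d l (Iso.eTo I (inj₂ single))) (Iso.to-l I (inj₂ single))
                                      (extract d (Iso.eTo I (inj₂ single)))
    where
    I : Iso (attach g ⟪ c ⟫) ⟪ d ⟫
    I = unIso eq
  ... | d′ , eq′ , J , new = T.≈-trans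
    (feed-cong (T.gen g) (core-faithful c d′ (attach-reflects g (unIso eq ∙ J) new))) (T.≈-sym eq′)

  -- Tells the core from the loops: every vertex of a core is an input or a target, a loop vertex is
  -- neither, and isomorphisms preserve the distinction.
  Covered : ∀ {m n} → Cospan m n → Set
  Covered X = ∀ v → (∃ λ i → leftV X i ≡ v) ⊎
    (Σ[ k ∈ ℕ ] Σ[ l ∈ ℕ ] Σ[ e ∈ E X k l ] Σ[ j ∈ Fin l ] t X e j ≡ v)

  core-covered : ∀ {m n} (c : Core m n) → Covered ⟪ c ⟫
  core-covered (perm p) v = inj₁ (v , refl)
  core-covered (box g {m} c) v with core-covered c v
  ... | inj₁ (i , eq) = split-elim (cod g) (λ i → leftV ⟪ c ⟫ i ≡ v → _)
    (λ j eq → inj₂ (_ , _ , inj₂ single , j , eq)) (λ i eq → inj₁ (i , eq)) i eq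
  ... | inj₂ (k , l , e , j , eq) = inj₂ (k , l , inj₁ e , j , eq)

  covered-to : ∀ {j k m n} {X Y : Cospan m n} → Covered X → (I : Iso (isolate j X) (isolate k Y)) →
               ∀ v → ∃ λ w → Iso.vTo I (inj₂ v) ≡ inj₂ w
  covered-to cov I v with cov v
  ... | inj₁ (i , refl)             = _ , Iso.to-left I i
  ... | inj₂ (_ , _ , e , i , refl) = _ , Iso.to-t I e i

  -- If a loop vertex went to a vertex of `Y`, the inverse, which keeps covered vertices covered,
  -- could not bring it back.
  isolated-to : ∀ {j k m n} {X Y : Cospan m n} → Covered Y → (I : Iso (isolate j X) (isolate k Y)) →
                ∀ i → ∃ λ i′ → Iso.vTo I (inj₁ i) ≡ inj₁ i′
  isolated-to {X = X} {Y} cov I i = go (vTo (inj₁ i)) refl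
    where
    open Iso I
    go : ∀ z → vTo (inj₁ i) ≡ z → ∃ λ i′ → z ≡ inj₁ i′
    go (inj₁ i′) _ = i′ , refl
    go (inj₂ w) eq with trans (sym (v-ft (inj₁ i))) (trans (cong vFrom eq) (proj₂ (covered-to {X = Y} {X} cov (I ⁻¹) w)))
    ... | ()

  isolate-reflects : ∀ {j k m n} {X Y : Cospan m n} → Covered X → Covered Y →
                     isolate j X ≈ isolate k Y → j ≡ k × X ≈ Y
  isolate-reflects {X = X} {Y} cX cY eq =
    Perm.↔⇒≡ (mk↔ₛ′ (proj₁ ∘ f) (proj₁ ∘ f⁻¹)
      (λ i → Sumₚ.inj₁-injective (trans (sym (proj₂ (f _))) (trans (cong vTo (sym (proj₂ (f⁻¹ i)))) (v-tf _))))
      (λ i → Sumₚ.inj₁-injective (trans (sym (proj₂ (f⁻¹ _))) (trans (cong vFrom (sym (proj₂ (f i)))) (v-ft _))))) ,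
    mkIso record
    { vTo = proj₁ ∘ h ; vFrom = proj₁ ∘ h⁻¹
    ; v-tf = λ v → Sumₚ.inj₂-injective (trans (sym (proj₂ (h _))) (trans (cong vTo (sym (proj₂ (h⁻¹ v)))) (v-tf _)))
    ; v-ft = λ v → Sumₚ.inj₂-injective (trans (sym (proj₂ (h⁻¹ _))) (trans (cong vFrom (sym (proj₂ (h v)))) (v-ft _)))
    ; eTo = eTo ; eFrom = eFrom ; e-tf = e-tf ; e-ft = e-ft ; to-l = to-l
    ; to-s = λ e i → Sumₚ.inj₂-injective (trans (sym (proj₂ (h _))) (to-s e i))
    ; to-t = λ e i → Sumₚ.inj₂-injective (trans (sym (proj₂ (h _))) (to-t e i))
    ; to-left = λ i → Sumₚ.inj₂-injective (trans (sym (proj₂ (h _))) (to-left i))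
    ; to-right = λ i → Sumₚ.inj₂-injective (trans (sym (proj₂ (h _))) (to-right i)) }
    where
    I = unIso eq
    open Iso I
    h = covered-to {X = X} {Y} cX I
    h⁻¹ = covered-to {X = Y} {X} cY (I ⁻¹)
    f = isolated-to {X = X} {Y} cY I
    f⁻¹ = isolated-to {X = Y} {X} cX (I ⁻¹)

  faithful : ∀ {m n} (t u : T.Term m n) → ⟦ t ⟧ ≈ ⟦ u ⟧ → t T.≈ u
  faithful t u eq with normalise t | normalise u
  ... | j , c , e | k , d , e′ with isolate-reflects (core-covered c) (core-covered d)
        (≈-trans (≈-sym (⟦loops⊗term⟧ j c)) (≈-trans (≈-sym (⟦⟧-cong e))
          (≈-trans eq (≈-trans (⟦⟧-cong e′) (⟦loops⊗term⟧ k d)))))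
  ... | refl , eq′ = T.≈-trans e (T.≈-trans (T.⊗-cong T.≈-refl (core-faithful c d eq′)) (T.≈-sym e′))

-- From full faithfulness to an isomorphism of PROPs; finite bijections.

module _ {a ℓ b r} {P : PROP a ℓ} {Q : PROP b r} (F : PROPMorphism P Q) where
  private
    module P = PROP P
    module Q = PROP Q
    module Q-eq {m n} = IsEquivalence (Q.isEquivalence {m} {n})
  open PROPMorphism F

  fully-faithful⇒≅ : (∀ {m n} (f : Q.Hom m n) → Σ[ g ∈ P.Hom m n ] ⟪ g ⟫ Q.≈ f) →
                     (∀ {m n} (f g : P.Hom m n) → ⟪ f ⟫ Q.≈ ⟪ g ⟫ → f P.≈ g) → P ≅ Q
  fully-faithful⇒≅ full faithful = record
    { to = F
    ; from = record
        { ⟪_⟫ = inv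
        ; ⟪⟫-cong = λ {_} {_} {f} {g} e → faithful _ _ (Q-eq.trans (inv≈ f) (Q-eq.trans e (Q-eq.sym (inv≈ g))))
        ; ⟪⟫-id = λ m → faithful _ _ (Q-eq.trans (inv≈ _) (Q-eq.sym (⟪⟫-id m)))
        ; ⟪⟫-⨾ = λ f g → faithful _ _ (Q-eq.trans (inv≈ _)
            (Q-eq.sym (Q-eq.trans (⟪⟫-⨾ _ _) (Q.⨾-cong (inv≈ f) (inv≈ g)))))
        ; ⟪⟫-⊗ = λ f g → faithful _ _ (Q-eq.trans (inv≈ _)
            (Q-eq.sym (Q-eq.trans (⟪⟫-⊗ _ _) (Q.⊗-cong (inv≈ f) (inv≈ g)))))
        ; ⟪⟫-σ = λ m n → faithful _ _ (Q-eq.trans (inv≈ _) (Q-eq.sym (⟪⟫-σ m n))) }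
    ; from-to = λ f → faithful _ _ (inv≈ ⟪ f ⟫)
    ; to-from = inv≈ }
    where
    inv : ∀ {m n} → Q.Hom m n → P.Hom m n
    inv f = proj₁ (full f)
    inv≈ : ∀ {m n} (f : Q.Hom m n) → ⟪ inv f ⟫ Q.≈ f
    inv≈ f = proj₂ (full f)

-- The head is the preimage of 0, as `source-injective` dictates; removing it leaves a permutation
-- on one point fewer.
encode : ∀ {n} (π : Perm.Permutation n n) → Σ[ p ∈ Lehmer n ] ∀ i → source p i ≡ Inverse.to π i
encode {zero}  π = [] , λ ()
encode {suc n} π with encode (Perm.remove (Inverse.from π zero) π)
... | p , eq = j ∷ p , λ i → trans (go (insʳ j i)) (cong (Inverse.to π) (insˡ-insʳ j i))
  where
  j : Fin (suc n)
  j = Inverse.from π zero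
  πj : Inverse.to π j ≡ zero
  πj = Inverse.strictlyInverseˡ π zero
  go : ∀ k → lift₁ (source p) k ≡ Inverse.to π (insˡ j k)
  go zero    = sym πj
  go (suc x) = trans (cong suc (eq x)) (trans (cong (λ z → punchIn z (Inverse.to (Perm.remove j π) x)) (sym πj))
    (sym (Perm.punchIn-permute π j x)))

Fin1-irrelevant : ∀ {A : Set} → A ↔ Fin 1 → (a b : A) → a ≡ b
Fin1-irrelevant A↔ a b = trans (sym (strictlyInverseʳ a)) (trans (cong from (one (to a) (to b))) (strictlyInverseʳ b))
  where
  open Inverse A↔
  one : (i j : Fin 1) → i ≡ j
  one zero zero = refl

Fin0-empty : ∀ {A : Set} → A ↔ Fin 0 → ¬ A
Fin0-empty A↔ a with Inverse.to A↔ a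
... | ()

empty↔ : ∀ {A : Set} → ¬ A → A ↔ Fin 0
empty↔ ¬a = mk↔ₛ′ (λ a → ⊥-elim (¬a a)) (λ ()) (λ ()) (λ a → ⊥-elim (¬a a))

unique↔ : ∀ {A : Set} (a : A) → (∀ b → a ≡ b) → A ↔ Fin 1
unique↔ a p = mk↔ₛ′ (λ _ → zero) (λ _ → a) (λ { zero → refl }) p

-- P k l is k for the source and l for the target tentacles of an edge, so that
-- both are treated at once.
Port : (ℕ → ℕ → ℕ) → (ℕ → ℕ → Set) → ℕ → Set
Port P E n = Fin n ⊎ (Σ[ k ∈ ℕ ] Σ[ l ∈ ℕ ] (E k l × Fin (P k l)))

-- Attaching turns the first legs into tentacles of the new hyperedge and keeps the total of legs
-- and tentacles. This is why `Flow` holds before an attachment exactly if it holds after it.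
attach-port : ∀ P {E n} a b →
              Port P (λ k l → E k l ⊎ SingleEdge a b k l) n ↔ Port P E (P a b + n)
attach-port P {E} {n} a b = mk↔ₛ′ to from to-from from-to
  where
  to : Port P (λ k l → E k l ⊎ SingleEdge a b k l) n → Port P E (P a b + n)
  to (inj₁ i)                        = inj₁ (P a b ↑ʳ i)
  to (inj₂ (k , l , inj₁ e , j))     = inj₂ (k , l , e , j)
  to (inj₂ (_ , _ , inj₂ single , j)) = inj₁ (j ↑ˡ n)
  leg : Fin (P a b) ⊎ Fin n → Port P (λ k l → E k l ⊎ SingleEdge a b k l) n
  leg (inj₁ j) = inj₂ (a , b , inj₂ single , j)
  leg (inj₂ i) = inj₁ i
  from : Port P E (P a b + n) → Port P (λ k l → E k l ⊎ SingleEdge a b k l) n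
  from (inj₁ i)               = leg (Fin.splitAt (P a b) i)
  from (inj₂ (k , l , e , j)) = inj₂ (k , l , inj₁ e , j)
  to-leg : ∀ x → to (leg x) ≡ inj₁ (Fin.join (P a b) n x)
  to-leg (inj₁ j) = refl
  to-leg (inj₂ i) = refl
  to-from : ∀ x → to (from x) ≡ x
  to-from (inj₁ i) = trans (to-leg (Fin.splitAt (P a b) i)) (cong inj₁ (join-splitAt (P a b) n i))
  to-from (inj₂ _) = refl
  from-to : ∀ x → from (to x) ≡ x
  from-to (inj₁ i)                        = cong leg (splitAt-↑ʳ (P a b) n i)
  from-to (inj₂ (k , l , inj₁ e , j))     = refl
  from-to (inj₂ (_ , _ , inj₂ single , j)) = cong leg (splitAt-↑ˡ (P a b) j n)

-- Flows, partial monogamy and fullness.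

module Fullness (𝓢 : Generators) where
  open Generators 𝓢
  open Labelled 𝓢
  open Trace 𝓢
  open C using (Cospan; _≈_; Iso; mkIso; unIso; ≈-refl; ≈-sym; ≈-trans)
  open Cospan
  open Terms 𝓢 using (Core; perm; box; ⌜_⌝; term; loops; feed; normalise)
  open Interpretation 𝓢
  open Faithfulness 𝓢 using (faithful)
  private module T = Free 𝓢

  arityˢ arityᵗ : ℕ → ℕ → ℕ
  arityˢ k l = k
  arityᵗ k l = l

  module _ {m n} (X : Cospan m n) where
    In Out : Set
    In  = Port arityᵗ (E X) m
    Out = Port arityˢ (E X) n

    inflow : In → V X
    inflow = [ leftV X , targetOf X ]′

    outflow : Out → V X
    outflow = [ rightV X , sourceOf X ]′

    -- Partial monogamy, without counting: every vertex has at most one inflow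
    -- and at most one outflow, and has the one if and only if it has the other.
    record Flow : Set where
      field
        inflow-inj  : ∀ {x y} → inflow x ≡ inflow y → x ≡ y
        outflow-inj : ∀ {x y} → outflow x ≡ outflow y → x ≡ y
        in⇒out      : ∀ x → ∃ λ y → outflow y ≡ inflow x
        out⇒in      : ∀ y → ∃ λ x → inflow x ≡ outflow y
  open Flow

  -- `h` may fail to be onto. A vertex outside its image has neither inflow nor outflow, which
  -- `Flow` permits; isolated vertices are added in this way.
  record Transfer {m n p q} (X : Cospan m n) (Y : Cospan p q) : Set where
    field
      h       : V X → V Y
      h-inj   : ∀ {v w} → h v ≡ h w → v ≡ w
      ins     : In Y ↔ In X
      outs    : Out Y ↔ Out X
      h-in    : ∀ y → inflow Y y ≡ h (inflow X (Inverse.to ins y))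
      h-out   : ∀ y → outflow Y y ≡ h (outflow X (Inverse.to outs y))

  transfer : ∀ {m n p q} {X : Cospan m n} {Y : Cospan p q} → Transfer X Y → Flow X → Flow Y
  transfer {X = X} {Y} T F = record
    { inflow-inj = λ {x} {y} e → via ins (inflow-inj F (h-inj (trans (sym (h-in x)) (trans e (h-in y)))))
    ; outflow-inj = λ {x} {y} e → via outs (outflow-inj F (h-inj (trans (sym (h-out x)) (trans e (h-out y)))))
    ; in⇒out = λ x → let y , e = in⇒out F (Inverse.to ins x) in
        Inverse.from outs y , trans (h-out _) (trans (cong (h ∘ outflow X) (Inverse.strictlyInverseˡ outs y))
          (trans (cong h e) (sym (h-in x))))
    ; out⇒in = λ y → let x , e = out⇒in F (Inverse.to outs y) in
        Inverse.from ins x , trans (h-in _) (trans (cong (h ∘ inflow X) (Inverse.strictlyInverseˡ ins x))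
          (trans (cong h e) (sym (h-out y)))) }
    where
    open Transfer T
    via : ∀ {A B : Set} (A↔B : A ↔ B) {x y} → Inverse.to A↔B x ≡ Inverse.to A↔B y → x ≡ y
    via A↔B {x} {y} e = trans (sym (Inverse.strictlyInverseʳ A↔B x))
      (trans (cong (Inverse.from A↔B) e) (Inverse.strictlyInverseʳ A↔B y))

  iso-transfer : ∀ {m n} {X Y : Cospan m n} → Iso X Y → Transfer X Y
  iso-transfer {X = X} {Y} I = record
    { h = vTo
    ; h-inj = λ e → trans (sym (v-ft _)) (trans (cong vFrom e) (v-ft _))
    ; ins = ports arityᵗ ; outs = ports arityˢ
    ; h-in = λ { (inj₁ i) → sym (to-left i)
               ; (inj₂ (_ , _ , e , j)) → sym (trans (to-t (eFrom e) j) (cong (λ e → t Y e j) (e-tf e))) }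
    ; h-out = λ { (inj₁ i) → sym (to-right i)
                ; (inj₂ (_ , _ , e , j)) → sym (trans (to-s (eFrom e) j) (cong (λ e → s Y e j) (e-tf e))) } }
    where
    open Iso I
    ports : ∀ P {n} → Port P (E Y) n ↔ Port P (E X) n
    ports P = mk↔ₛ′
      (Sum.map (λ i → i) (λ { (k , l , e , j) → k , l , eFrom e , j }))
      (Sum.map (λ i → i) (λ { (k , l , e , j) → k , l , eTo e , j }))
      (λ { (inj₁ _) → refl ; (inj₂ (k , l , e , j)) → cong (λ e → inj₂ (k , l , e , j)) (e-ft e) })
      (λ { (inj₁ _) → refl ; (inj₂ (k , l , e , j)) → cong (λ e → inj₂ (k , l , e , j)) (e-tf e) })

  attach-transfer : ∀ g {m n} (Y : Cospan (cod g + m) (dom g + n)) → Transfer Y (attach g Y)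
  attach-transfer g Y = record
    { h = λ v → v ; h-inj = λ e → e
    ; ins = attach-port arityᵗ (dom g) (cod g) ; outs = attach-port arityˢ (dom g) (cod g)
    ; h-in = λ { (inj₁ _) → refl ; (inj₂ (_ , _ , inj₁ _ , _)) → refl ; (inj₂ (_ , _ , inj₂ single , _)) → refl }
    ; h-out = λ { (inj₁ _) → refl ; (inj₂ (_ , _ , inj₁ _ , _)) → refl ; (inj₂ (_ , _ , inj₂ single , _)) → refl } }

  detach-transfer : ∀ g {m n} (Y : Cospan (cod g + m) (dom g + n)) → Transfer (attach g Y) Y
  detach-transfer g Y = record
    { h = λ v → v ; h-inj = λ e → e ; ins = ↔-sym ins ; outs = ↔-sym outs
    ; h-in = λ y → trans (cong (inflow Y) (sym (Inverse.strictlyInverseˡ ins y))) (sym (h-in (Inverse.from ins y)))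
    ; h-out = λ y → trans (cong (outflow Y) (sym (Inverse.strictlyInverseˡ outs y))) (sym (h-out (Inverse.from outs y))) }
    where open Transfer (attach-transfer g Y)

  isolate-transfer : ∀ k {m n} (X : Cospan m n) → Transfer X (isolate k X)
  isolate-transfer k X = record
    { h = inj₂ ; h-inj = Sumₚ.inj₂-injective
    ; ins = ↔-id _ ; outs = ↔-id _
    ; h-in = λ { (inj₁ _) → refl ; (inj₂ _) → refl } ; h-out = λ { (inj₁ _) → refl ; (inj₂ _) → refl } }

  core-flow : ∀ {m n} (c : Core m n) → Flow ⟪ c ⟫
  core-flow (perm p) = record
    { inflow-inj = λ { {inj₁ _} {inj₁ _} e → cong inj₁ e ; {inj₂ (_ , _ , () , _)} ; {inj₁ _} {inj₂ (_ , _ , () , _)} }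
    ; outflow-inj = λ { {inj₁ i} {inj₁ j} e → cong inj₁ (trans (sym (target-source p i)) (trans (cong (target p) e) (target-source p j)))
                      ; {inj₂ (_ , _ , () , _)} ; {inj₁ _} {inj₂ (_ , _ , () , _)} }
    ; in⇒out = λ { (inj₁ i) → inj₁ (target p i) , source-target p i ; (inj₂ (_ , _ , () , _)) }
    ; out⇒in = λ { (inj₁ i) → inj₁ (source p i) , refl ; (inj₂ (_ , _ , () , _)) } }
  core-flow (box g c) = transfer (attach-transfer g ⟪ c ⟫) (core-flow c)

  -- The argument follows the normal form, whose steps are permutations, attachments and isolated
  -- vertices, rather than the operations that build `t`.
  flow : ∀ {m n} (t : T.Term m n) → Flow ⟦ t ⟧
  flow t with normalise t
  ... | k , c , e = transfer (iso-transfer (unIso (≈-sym (≈-trans (⟦⟧-cong e) (⟦loops⊗term⟧ k c)))))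
    (transfer (isolate-transfer k ⟪ c ⟫) (core-flow c))

  module _ {m n} (X : Cospan m n) where
    _≟V_ : DecidableEquality (V X)
    _≟V_ = finite⇒≟ (proj₁ (finite X))

    in? : ∀ v → Dec (_∈in X v)
    in? v = any? (λ i → leftV X i ≟V v)

    out? : ∀ v → Dec (_∈out X v)
    out? v = any? (λ i → rightV X i ≟V v)

    TargetFibre SourceFibre : V X → Set
    TargetFibre v = Σ[ x ∈ TargetTentacle X ] targetOf X x ≡ v
    SourceFibre v = Σ[ x ∈ SourceTentacle X ] sourceOf X x ≡ v

    -- Decides between the degrees (0,0) and (1,1) of an internal vertex, by a search through the
    -- finitely many hyperedges and their target positions.
    target? : ∀ v → Dec (TargetFibre v)
    target? v = Dec.map′
      (λ { (i , j , eq) → (_ , _ , proj₂ (proj₂ (from i)) , j) , eq })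
      (λ { ((k , l , e , j) , eq) → to (k , l , e) , subst (λ (_ , _ , e′) → ∃ λ j′ → t X e′ j′ ≡ v)
             (sym (strictlyInverseʳ (k , l , e))) (j , eq) })
      (any? (λ i → any? (λ j → t X (proj₂ (proj₂ (from i))) j ≟V v)))
      where open Inverse (Finite.enum (proj₂ (finite X))) using (to; from; strictlyInverseʳ)

    module _ (F : Flow X) where
      private
        fibre≡ : ∀ {A : Set} {f : A → V X} {v} {x y : Σ[ a ∈ A ] f a ≡ v} → proj₁ x ≡ proj₁ y → x ≡ y
        fibre≡ {x = _ , p} {_ , q} refl = cong (_ ,_) (≡-irrelevant p q)

        target-unique : ∀ {v} (x : TargetFibre v) → TargetFibre v ↔ Fin 1
        target-unique (x , p) = unique↔ (x , p)
          λ { (y , q) → fibre≡ {f = targetOf X} (Sumₚ.inj₂-injective (inflow-inj F (trans p (sym q)))) }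

        source-unique : ∀ {v} (x : SourceFibre v) → SourceFibre v ↔ Fin 1
        source-unique (x , p) = unique↔ (x , p)
          λ { (y , q) → fibre≡ {f = sourceOf X} (Sumₚ.inj₂-injective (outflow-inj F (trans p (sym q)))) }

        in⇒no-target : ∀ {v} → _∈in X v → TargetFibre v ↔ Fin 0
        in⇒no-target (i , p) = empty↔ λ { (x , q) → ⊥-elim (absurd (inflow-inj F {inj₁ i} {inj₂ x} (trans p (sym q)))) }
          where
          absurd : ∀ {A B : Set} {a : A} {b : B} → ¬ (inj₁ a ≡ inj₂ b)
          absurd ()

        out⇒no-source : ∀ {v} → _∈out X v → SourceFibre v ↔ Fin 0
        out⇒no-source (i , p) = empty↔ λ { (x , q) → ⊥-elim (absurd (outflow-inj F {inj₁ i} {inj₂ x} (trans p (sym q)))) }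
          where
          absurd : ∀ {A B : Set} {a : A} {b : B} → ¬ (inj₁ a ≡ inj₂ b)
          absurd ()

        source-at : ∀ {v} x → inflow X x ≡ v → ¬ _∈out X v → SourceFibre v
        source-at x p ∉out with in⇒out F x
        ... | inj₁ j , q = ⊥-elim (∉out (j , trans q p))
        ... | inj₂ y , q = y , trans q p

        target-at : ∀ {v} y → outflow X y ≡ v → ¬ _∈in X v → TargetFibre v
        target-at y p ∉in with out⇒in F y
        ... | inj₁ i , q = ⊥-elim (∉in (i , trans q p))
        ... | inj₂ x , q = x , trans q p

        leg-mono : ∀ {k} (f : D k ⇒ₗ apex X) → (∀ {i j} → mapV f i ≡ mapV f j → i ≡ j) → Mono f
        leg-mono f inj a b p = (λ v → inj (_≈ʰ_.V≡ p v)) , (λ e → ⊥-elim (mapE a e))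

      flow⇒pm : PartialMonogamous X
      flow⇒pm = record
        { left-mono  = leg-mono (left X) (λ e → Sumₚ.inj₁-injective (inflow-inj F e))
        ; right-mono = leg-mono (right X) (λ e → Sumₚ.inj₁-injective (outflow-inj F e))
        ; in-out     = λ i o → in⇒no-target i , out⇒no-source o
        ; in-only    = λ i ∉out → in⇒no-target i , source-unique (source-at (inj₁ (proj₁ i)) (proj₂ i) ∉out)
        ; out-only   = λ ∉in o → target-unique (target-at (inj₁ (proj₁ o)) (proj₂ o) ∉in) , out⇒no-source o
        ; internal   = λ {v} ∉in ∉out → internal′ ∉in ∉out (target? v) }
        where
        internal′ : ∀ {v} → ¬ _∈in X v → ¬ _∈out X v → Dec (TargetFibre v) →
                    HasDegree X v (0 , 0) ⊎ HasDegree X v (1 , 1)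
        internal′ ∉in ∉out (yes (x , p)) =
          inj₂ (target-unique (x , p) , source-unique (source-at (inj₂ x) p ∉out))
        internal′ ∉in ∉out (no ¬x) =
          inj₁ (empty↔ ¬x , empty↔ λ { (y , p) → ¬x (target-at (inj₂ y) p ∉in) })

    -- The clauses of partial monogamy as one case distinction, with the two possible degrees of an
    -- internal vertex kept apart. It is total because membership in the legs is decidable.
    data Role (v : V X) : Set where
      through  : _∈in X v → _∈out X v → HasDegree X v (0 , 0) → Role v
      input    : _∈in X v → ¬ _∈out X v → HasDegree X v (0 , 1) → Role v
      output   : ¬ _∈in X v → _∈out X v → HasDegree X v (1 , 0) → Role v
      isolated : ¬ _∈in X v → ¬ _∈out X v → HasDegree X v (0 , 0) → Role v
      middle   : ¬ _∈in X v → ¬ _∈out X v → HasDegree X v (1 , 1) → Role v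

    module _ (pm : PartialMonogamous X) where
      open PartialMonogamous pm

      private
        role : ∀ v → Role v
        role v with in? v | out? v
        ... | yes i | yes o = through i o (in-out i o)
        ... | yes i | no ¬o = input i ¬o (in-only i ¬o)
        ... | no ¬i | yes o = output ¬i o (out-only ¬i o)
        ... | no ¬i | no ¬o with internal ¬i ¬o
        ... | inj₁ d = isolated ¬i ¬o d
        ... | inj₂ d = middle ¬i ¬o d

        mono-inj : ∀ {k} (f : D k ⇒ₗ apex X) → Mono f → ∀ {i j} → mapV f i ≡ mapV f j → i ≡ j
        mono-inj {k} f mono {i} {j} e = _≈ʰ_.V≡ (mono {D 1} (vertices (D k) (λ _ → i)) (vertices (D k) (λ _ → j))
          ((λ _ → e) , (λ ()))) zero

        not-both-in : ∀ {v} → _∈in X v → ¬ TargetFibre v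
        not-both-in {v} i with role v
        ... | through _ _ d   = Fin0-empty (proj₁ d)
        ... | input _ _ d     = Fin0-empty (proj₁ d)
        ... | output ¬i _ _   = ⊥-elim (¬i i)
        ... | isolated ¬i _ _ = ⊥-elim (¬i i)
        ... | middle ¬i _ _   = ⊥-elim (¬i i)

        not-both-out : ∀ {v} → _∈out X v → ¬ SourceFibre v
        not-both-out {v} o with role v
        ... | through _ _ d   = Fin0-empty (proj₂ d)
        ... | input _ ¬o _    = ⊥-elim (¬o o)
        ... | output _ _ d    = Fin0-empty (proj₂ d)
        ... | isolated _ ¬o _ = ⊥-elim (¬o o)
        ... | middle _ ¬o _   = ⊥-elim (¬o o)

        one-target : ∀ {v} (x y : TargetFibre v) → x ≡ y
        one-target {v} x y with role v
        ... | through _ _ d  = ⊥-elim (Fin0-empty (proj₁ d) x)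
        ... | input _ _ d    = ⊥-elim (Fin0-empty (proj₁ d) x)
        ... | output _ _ d   = Fin1-irrelevant (proj₁ d) x y
        ... | isolated _ _ d = ⊥-elim (Fin0-empty (proj₁ d) x)
        ... | middle _ _ d   = Fin1-irrelevant (proj₁ d) x y

        one-source : ∀ {v} (x y : SourceFibre v) → x ≡ y
        one-source {v} x y with role v
        ... | through _ _ d  = ⊥-elim (Fin0-empty (proj₂ d) x)
        ... | input _ _ d    = Fin1-irrelevant (proj₂ d) x y
        ... | output _ _ d   = ⊥-elim (Fin0-empty (proj₂ d) x)
        ... | isolated _ _ d = ⊥-elim (Fin0-empty (proj₂ d) x)
        ... | middle _ _ d   = Fin1-irrelevant (proj₂ d) x y

        source-of : ∀ {v} → HasDegree X v (0 , 1) ⊎ HasDegree X v (1 , 1) → ∃ λ y → outflow X y ≡ v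
        source-of d with Inverse.from ([ proj₂ , proj₂ ]′ d) zero
        ... | y , e = inj₂ y , e

        target-of : ∀ {v} → HasDegree X v (1 , 0) ⊎ HasDegree X v (1 , 1) → ∃ λ x → inflow X x ≡ v
        target-of d with Inverse.from ([ proj₁ , proj₁ ]′ d) zero
        ... | x , e = inj₂ x , e

        has-in : ∀ x → _∈in X (inflow X x) ⊎ TargetFibre (inflow X x)
        has-in (inj₁ i) = inj₁ (i , refl)
        has-in (inj₂ x) = inj₂ (x , refl)

        has-out : ∀ y → _∈out X (outflow X y) ⊎ SourceFibre (outflow X y)
        has-out (inj₁ i) = inj₁ (i , refl)
        has-out (inj₂ x) = inj₂ (x , refl)

        to-out : ∀ {v} → Role v → _∈in X v ⊎ TargetFibre v → ∃ λ y → outflow X y ≡ v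
        to-out (through _ (j , e) _) _    = inj₁ j , e
        to-out (input _ _ d) _            = source-of (inj₁ d)
        to-out (output _ (j , e) _) _     = inj₁ j , e
        to-out (isolated ¬i _ d) (inj₁ i) = ⊥-elim (¬i i)
        to-out (isolated ¬i _ d) (inj₂ x) = ⊥-elim (Fin0-empty (proj₁ d) x)
        to-out (middle _ _ d) _           = source-of (inj₂ d)

        to-in : ∀ {v} → Role v → _∈out X v ⊎ SourceFibre v → ∃ λ x → inflow X x ≡ v
        to-in (through (i , e) _ _) _    = inj₁ i , e
        to-in (input (i , e) _ _) _      = inj₁ i , e
        to-in (output _ _ d) _           = target-of (inj₁ d)
        to-in (isolated _ ¬o d) (inj₁ o) = ⊥-elim (¬o o)
        to-in (isolated _ ¬o d) (inj₂ x) = ⊥-elim (Fin0-empty (proj₂ d) x)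
        to-in (middle _ _ d) _           = target-of (inj₂ d)

      pm⇒flow : Flow X
      pm⇒flow = record
        { inflow-inj = λ
            { {inj₁ i} {inj₁ j} e → cong inj₁ (mono-inj (left X) left-mono e)
            ; {inj₁ i} {inj₂ x} e → ⊥-elim (not-both-in (i , refl) (x , sym e))
            ; {inj₂ x} {inj₁ i} e → ⊥-elim (not-both-in (i , refl) (x , e))
            ; {inj₂ x} {inj₂ y} e → cong (inj₂ ∘ proj₁) (one-target (x , e) (y , refl)) }
        ; outflow-inj = λ
            { {inj₁ i} {inj₁ j} e → cong inj₁ (mono-inj (right X) right-mono e)
            ; {inj₁ i} {inj₂ x} e → ⊥-elim (not-both-out (i , refl) (x , sym e))
            ; {inj₂ x} {inj₁ i} e → ⊥-elim (not-both-out (i , refl) (x , e))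
            ; {inj₂ x} {inj₂ y} e → cong (inj₂ ∘ proj₁) (one-source (x , e) (y , refl)) }
        ; in⇒out = λ x → to-out (role (inflow X x)) (has-in x)
        ; out⇒in = λ y → to-in (role (outflow X y)) (has-out y) }

  edgeless-full : ∀ {m n} (X : Cospan m n) → (∀ {k l} → ¬ E X k l) → Flow X → Σ[ t ∈ T.Term m n ] ⟦ t ⟧ ≈ X
  -- The bijection between the legs first yields `m ≡ n`. It is computed again after this equation
  -- has been matched, because a code encodes a permutation of a single `Fin m`.
  edgeless-full X ¬E F = go (Perm.↔⇒≡ (↔-sym π)) X ¬E F
    where
    leg-of : ∀ {m n} (X : Cospan m n) → (∀ {k l} → ¬ E X k l) → (F : Flow X) → Fin n ↔ Fin m
    leg-of X ¬E F = mk↔ₛ′ (proj₁ ∘ to) (proj₁ ∘ from)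
      (λ i → Sumₚ.inj₁-injective (inflow-inj F (trans (proj₂ (to _)) (proj₂ (from i)))))
      (λ j → Sumₚ.inj₁-injective (outflow-inj F (trans (proj₂ (from _)) (proj₂ (to j)))))
      where
      to : ∀ j → ∃ λ i → leftV X i ≡ rightV X j
      to j with out⇒in F (inj₁ j)
      ... | inj₁ i , e = i , e
      ... | inj₂ (_ , _ , e , _) , _ = ⊥-elim (¬E e)
      from : ∀ i → ∃ λ j → rightV X j ≡ leftV X i
      from i with in⇒out F (inj₁ i)
      ... | inj₁ j , e = j , e
      ... | inj₂ (_ , _ , e , _) , _ = ⊥-elim (¬E e)

    π = leg-of X ¬E F

    go : ∀ {m n} → m ≡ n → (X : Cospan m n) → (∀ {k l} → ¬ E X k l) → Flow X → Σ[ t ∈ T.Term m n ] ⟦ t ⟧ ≈ X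
    go {m} refl X ¬E F with encode (leg-of X ¬E F)
    ... | p , p≡ = loops size T.⊗ ⌜ p ⌝ , ≈-trans (⟦loops⊗term⟧ size (perm p)) (mkIso record
      { vTo = vTo ; vFrom = λ v → vFrom v (in? X v)
      ; v-tf = λ v → v-tf v (in? X v)
      ; v-ft = λ { (inj₁ l) → v-ft-loop (from l) (in? X _) refl ; (inj₂ i) → v-ft-leg i (in? X _) }
      ; eTo = λ () ; eFrom = ¬E ; e-tf = λ e → ⊥-elim (¬E e) ; e-ft = λ ()
      ; to-s = λ () ; to-t = λ () ; to-l = λ () ; to-left = λ _ → refl
      ; to-right = λ j → trans (cong (leftV X) (p≡ j)) (leg≡ j) })
      where
      Isolated : Set
      -- In the absence of hyperedges every output is an input, so a vertex outside the inputs lies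
      -- on no leg and stands for a loop. Non-membership is irrelevant, so such vertices are equal
      -- once their values are.
      Isolated = Refinement (V X) (λ v → ¬ _∈in X v)
      finite-isolated : Finite Isolated
      finite-isolated = finite-refine (proj₁ (finite X)) (λ v → Dec.¬? (in? X v))
      open Finite finite-isolated using (size; enum)
      open Inverse enum using (to; from; strictlyInverseˡ; strictlyInverseʳ)
      leg≡ : ∀ j → leftV X (Inverse.to (leg-of X ¬E F) j) ≡ rightV X j
      leg≡ j with out⇒in F (inj₁ j)
      ... | inj₁ i , e = e
      ... | inj₂ (_ , _ , e , _) , _ = ⊥-elim (¬E e)
      vTo : Fin size ⊎ Fin m → V X
      vTo (inj₁ l) = value (from l)
      vTo (inj₂ i) = leftV X i
      vFrom : ∀ v → Dec (_∈in X v) → Fin size ⊎ Fin m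
      vFrom v (yes (i , _)) = inj₂ i
      vFrom v (no ∉in)      = inj₁ (to (v , [ ∉in ]))
      v-tf : ∀ v d → vTo (vFrom v d) ≡ v
      v-tf v (yes (_ , e)) = e
      v-tf v (no ∉in)      = cong value (strictlyInverseʳ (v , [ ∉in ]))
      v-ft-loop : ∀ {l} (x : Isolated) d → from l ≡ x → vFrom (value x) d ≡ inj₁ l
      v-ft-loop (v , [ ∉in ]) (yes i) _   = contradiction-irr ∉in (λ n → n i)
      v-ft-loop (v , _) (no ∉in) eq       = cong inj₁ (trans (cong to (sym eq)) (strictlyInverseˡ _))
      v-ft-leg : ∀ i d → vFrom (leftV X i) d ≡ inj₂ i
      v-ft-leg i (yes (j , e)) = cong inj₂ (Sumₚ.inj₁-injective (inflow-inj F e))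
      v-ft-leg i (no ∉in)      = ⊥-elim (∉in (i , refl))

  -- Inverse to `attach`: the hyperedge with index 0 is removed, and its targets and sources become
  -- the first inputs and outputs. The others carry the predecessor of their index, so their
  -- enumeration has size `N` by definition.
  module Detach {m n N} (X : Cospan m n) (enum : Edge X ↔ Fin (suc N)) {g} (e₀ : E X (dom g) (cod g))
                (e₀≡ : Inverse.to enum (dom g , cod g , e₀) ≡ zero) (λe₀ : labelE X e₀ ≡ edge g) where
    open Inverse enum using (to; from; strictlyInverseˡ; strictlyInverseʳ)

    E⁻ : ℕ → ℕ → Set
    E⁻ k l = Σ[ e ∈ E X k l ] Σ[ i ∈ Fin N ] to (k , l , e) ≡ suc i

    private
      pack : (x : Edge X) (i : Fin N) → to x ≡ suc i → Σ[ k ∈ ℕ ] Σ[ l ∈ ℕ ] E⁻ k l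
      pack (k , l , e) i p = k , l , e , i , p

      pack≡ : ∀ {x y i} {p : to x ≡ suc i} {q : to y ≡ suc i} → x ≡ y → pack x i p ≡ pack y i q
      pack≡ {x = k , l , e} {i = i} {p} {q} refl = cong (λ r → k , l , e , i , r) (≡-irrelevant p q)

    enum⁻ : (Σ[ k ∈ ℕ ] Σ[ l ∈ ℕ ] E⁻ k l) ↔ Fin N
    enum⁻ = mk↔ₛ′ (λ (_ , _ , _ , i , _) → i) (λ i → pack (from (suc i)) i (strictlyInverseˡ (suc i)))
      (λ _ → refl) (λ { (k , l , e , i , p) → pack≡ (trans (cong from (sym p)) (strictlyInverseʳ (k , l , e))) })

    detached : Cospan (cod g + m) (dom g + n)
    detached = record
      { apex = F ; finite = proj₁ (finite X) , record { size = N ; enum = enum⁻ }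
      ; left = vertices F (copair (cod g) (t X e₀) (leftV X))
      ; right = vertices F (copair (dom g) (s X e₀) (rightV X)) }
      where
      F : LHyp
      F = record
        { graph = record { V = V X ; E = E⁻ ; s = λ (e , _) → s X e ; t = λ (e , _) → t X e }
        ; label = record { onV = λ _ → _ ; onE = λ (e , _) → labelE X e
                         ; on-s = λ _ _ → refl ; on-t = λ _ _ → refl } }

    private
      -- An equation between triples, since the arities of `e` are not known to be those of `e₀`.
      Removed : ∀ {k l} → E X k l → Set
      Removed {k} {l} e = _≡_ {A = Edge X} (dom g , cod g , e₀) (k , l , e)

      the-edge : ∀ {k l} {e : E X k l} → Removed e → SingleEdge (dom g) (cod g) k l
      the-edge refl = single

      index-zero : ∀ {k l} (e : E X k l) → to (k , l , e) ≡ zero → Removed e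
      index-zero e p = trans (sym (strictlyInverseʳ _)) (trans (cong from (trans e₀≡ (sym p))) (strictlyInverseʳ _))

      -- The index `z` of `e` is abstracted and its equation kept as an argument, so that later
      -- proofs can match on `z` and compare the equations by uniqueness of identity proofs.
      fwd′ : ∀ {k l} (e : E X k l) z → to (k , l , e) ≡ z → E⁻ k l ⊎ SingleEdge (dom g) (cod g) k l
      fwd′ e zero    p = inj₂ (the-edge (index-zero e p))
      fwd′ e (suc i) p = inj₁ (e , i , p)

      fwd : ∀ {k l} → E X k l → E⁻ k l ⊎ SingleEdge (dom g) (cod g) k l
      fwd e = fwd′ e _ refl

      bwd : ∀ {k l} → E⁻ k l ⊎ SingleEdge (dom g) (cod g) k l → E X k l
      bwd (inj₁ (e , _)) = e
      bwd (inj₂ single)  = e₀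

      bwd-the-edge : ∀ {k l} {e : E X k l} (p : Removed e) → bwd (inj₂ (the-edge p)) ≡ e
      bwd-the-edge refl = refl

      bwd-fwd′ : ∀ {k l} (e : E X k l) z p → bwd (fwd′ e z p) ≡ e
      bwd-fwd′ e zero    p = bwd-the-edge (index-zero e p)
      bwd-fwd′ e (suc i) p = refl

      fwd′-suc : ∀ {k l} (e : E X k l) i p z q → fwd′ e z q ≡ inj₁ (e , i , p)
      fwd′-suc e i p zero q with trans (sym q) p
      ... | ()
      fwd′-suc e i p (suc i′) q with Finₚ.suc-injective (trans (sym q) p)
      ... | refl = cong (λ r → inj₁ (e , i , r)) (≡-irrelevant q p)

      fwd′-zero : ∀ z q → fwd′ e₀ z q ≡ inj₂ single
      fwd′-zero zero q = cong inj₂ (the-edge≡ (index-zero e₀ q))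
        where
        the-edge≡ : (p : Removed e₀) → the-edge p ≡ single
        the-edge≡ p = cong the-edge (≡-irrelevant p refl)
      fwd′-zero (suc i) q with trans (sym e₀≡) q
      ... | ()

      fwd-bwd : ∀ {k l} (e : E⁻ k l ⊎ SingleEdge (dom g) (cod g) k l) → fwd (bwd e) ≡ e
      fwd-bwd (inj₁ (e , i , p)) = fwd′-suc e i p _ refl
      fwd-bwd (inj₂ single)      = fwd′-zero _ refl

    attach-detached : Iso (attach g detached) X
    attach-detached = record
      { vTo = λ v → v ; vFrom = λ v → v ; v-tf = λ _ → refl ; v-ft = λ _ → refl
      ; eTo = bwd ; eFrom = fwd ; e-tf = λ e → bwd-fwd′ e _ refl ; e-ft = fwd-bwd
      ; to-s = λ { (inj₁ e) i → refl ; (inj₂ single) i → copair-ˡ (s X e₀) (rightV X) i }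
      ; to-t = λ { (inj₁ e) j → refl ; (inj₂ single) j → copair-ˡ (t X e₀) (leftV X) j }
      ; to-l = λ { (inj₁ e) → refl ; (inj₂ single) → λe₀ }
      ; to-left = copair-ʳ {m = cod g} (t X e₀) (leftV X) ; to-right = copair-ʳ {m = dom g} (s X e₀) (rightV X) }

  -- The label of a removed hyperedge names the generator to be fed. `Flow` passes from `X` along
  -- the inverse of `attach-detached` and then through `detach-transfer`, so the induction
  -- hypothesis applies to the detached cospan.
  flow-full : ∀ N {m n} (X : Cospan m n) → Finite.size (proj₂ (finite X)) ≡ N → Flow X →
              Σ[ t ∈ T.Term m n ] ⟦ t ⟧ ≈ X
  flow-full zero X size≡ F = edgeless-full X
    (λ {k} {l} e → Finₚ.¬Fin0 (subst Fin size≡ (Inverse.to (Finite.enum (proj₂ (finite X))) (k , l , e)))) F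
  flow-full (suc N) {m} {n} X size≡ F = go _ (labelE X e₀) e₀ (Inverse.strictlyInverseˡ enum zero) refl
    where
    enum : Edge X ↔ Fin (suc N)
    enum = subst (λ k → Edge X ↔ Fin k) size≡ (Finite.enum (proj₂ (finite X)))
    e₀ = proj₂ (proj₂ (Inverse.from enum zero))
    go : ∀ {k} l (λe : SignatureEdge 𝓢 k l) (e : E X k l) → Inverse.to enum (k , l , e) ≡ zero →
         labelE X e ≡ λe → Σ[ t ∈ T.Term m n ] ⟦ t ⟧ ≈ X
    go _ (edge g) e p q with flow-full N M.detached refl
      (transfer (detach-transfer g M.detached) (transfer (iso-transfer (unIso (≈-sym (mkIso M.attach-detached)))) F))
      where module M = Detach X enum e p q
    ... | u , u≈ = feed (T.gen g) u ,
      ≈-trans (feed-attach g ⟦ u ⟧) (≈-trans (attach-cong g u≈) (mkIso (Detach.attach-detached X enum e p q)))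

  interpretation : PROPMorphism (TracedPROP.prop (𝐓 𝓢)) (PMCsp 𝓢)
  interpretation = record
    { ⟪_⟫ = λ u → ⟦ u ⟧ , flow⇒pm ⟦ u ⟧ (flow u)
    ; ⟪⟫-cong = ⟦⟧-cong
    -- The operations used by the fold are opaque, so they are replaced by those of `Csp` along
    -- propositional equations.
    ; ⟪⟫-id = λ m → subst (_≈ C.identity m) (sym (id≡ m)) ≈-refl
    ; ⟪⟫-⨾ = λ u v → subst (_≈ (⟦ u ⟧ C.⨾ ⟦ v ⟧)) (sym (⨾≡ ⟦ u ⟧ ⟦ v ⟧)) ≈-refl
    ; ⟪⟫-⊗ = λ u v → subst (_≈ (⟦ u ⟧ C.⊗ ⟦ v ⟧)) (sym (⊗≡ ⟦ u ⟧ ⟦ v ⟧)) ≈-refl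
    ; ⟪⟫-σ = λ m n → subst (_≈ C.symmetry m n) (sym (σ≡ m n)) ≈-refl }

corollary8p113 : (𝓢 : Generators) → TracedPROP.prop (𝐓 𝓢) ≅ PMCsp 𝓢
corollary8p113 𝓢 = fully-faithful⇒≅ interpretation
  (λ (X , pm) → flow-full _ X refl (pm⇒flow X pm)) (λ u v → faithful u v)
  where
  open Fullness 𝓢
  open Faithfulness 𝓢 using (faithful)
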